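{- Given a set $\mathcal{O}$ of disks in the plane (of possibly different radii) and an integer $k$, there is an algorithm that in time $|\mathcal{O}|^{O(\sqrt{k})}$ finds a set of $k$ pairwise disjoint disks from $\mathcal{O}$, if such a set exists. -}

module Defs where

open import Level using (0ℓ)
open import Algebra.Bundles using (CommutativeRing)
open import Data.Bool using (Bool; true; false; if_then_else_)
open import Data.Fin using (Fin; toℕ)
open import Data.Nat as ℕ using (ℕ; zero; suc)
open import Data.Product using (∃; ∃-syntax; _×_)
open import Data.Sum using (_⊎_)
open import Data.Vec.Functional as Vector using (Vector)
open import Function.Definitions using (Injective)
open import Relation.Binary using (Rel; IsDecTotalOrder)
open import Relation.Binary.PropositionalEquality using (_≡_; _≢_)
open import Relation.Nullary using (¬_; ⌊_⌋)

-- The standard library has no real numbers.  They are taken in the classical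
-- sense: a totally ordered field in which every nonempty set that is bounded
-- above has a least upper bound (unique up to isomorphism).  Decidability of
-- the order is the exact comparison that the real RAM below is built on.
record RealNumbers : Set₁ where
  field
    commutativeRing : CommutativeRing 0ℓ 0ℓ
  open CommutativeRing commutativeRing public

  infix 4 _≤_
  infix 8 _⁻¹
  field
    _≤_             : Rel Carrier 0ℓ
    isDecTotalOrder : IsDecTotalOrder _≈_ _≤_
    0≉1             : ¬ 0# ≈ 1#
    -- The value at 0# is unconstrained; it is never used.
    _⁻¹             : Carrier → Carrier
    ⁻¹-inverseʳ     : ∀ x → ¬ x ≈ 0# → x * x ⁻¹ ≈ 1#
    +-monoˡ-≤       : ∀ z {x y} → x ≤ y → x + z ≤ y + z
    *-nonNegative   : ∀ {x y} → 0# ≤ x → 0# ≤ y → 0# ≤ x * y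

  open IsDecTotalOrder isDecTotalOrder public using (_≟_; _≤?_)

  IsUpperBound : (Carrier → Set) → Carrier → Set
  IsUpperBound P b = ∀ x → P x → x ≤ b

  field
    supremum : (P : Carrier → Set) → ∃ P → ∃ (IsUpperBound P) →
               ∃[ s ] IsUpperBound P s × (∀ b → IsUpperBound P b → s ≤ b)

module Disks (ℝ : RealNumbers) where
  open RealNumbers ℝ

  record Point : Set where
    field
      x y : Carrier

  record Disk : Set where
    field
      centre   : Point
      radius   : Carrier
      radius≥0 : 0# ≤ radius
      radius≉0 : ¬ radius ≈ 0#

  infix 4 _≐_ _∈_

  _≐_ : Rel Disk 0ℓ
  D ≐ E = Point.x (Disk.centre D) ≈ Point.x (Disk.centre E)
        × Point.y (Disk.centre D) ≈ Point.y (Disk.centre E)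
        × Disk.radius D ≈ Disk.radius E

  -- Disks are closed.
  _∈_ : Point → Disk → Set
  p ∈ D = (dx * dx) + (dy * dy) ≤ Disk.radius D * Disk.radius D
    where
    dx dy : Carrier
    dx = Point.x p - Point.x (Disk.centre D)
    dy = Point.y p - Point.y (Disk.centre D)

  Disjoint : Rel Disk 0ℓ
  Disjoint D E = ¬ (∃[ p ] p ∈ D × p ∈ E)

  -- A set of n disks is given as an enumeration without repetitions.
  IsSet : ∀ {n} → Vector Disk n → Set
  IsSet O = Injective _≡_ _≐_ O

  -- The k chosen disks are given by distinct positions in O.
  IsDisjointSelection : ∀ {n k} → Vector Disk n → Vector (Fin n) k → Set
  IsDisjointSelection O s =
    Injective _≡_ _≡_ s × (∀ i j → i ≢ j → Disjoint (O (s i)) (O (s j)))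

-- Programs for a real RAM with structured control flow.  There are
-- integer (ℕ) and real registers, addressed directly, and an integer and a
-- real memory, addressed indirectly through the contents of an integer
-- register.  As usual for unit-cost machines there is no multiplication of
-- integers and no conversion (rounding) from reals to integers; this rules
-- out arithmetic on integers of exponential bit length at unit cost.
Register : Set
Register = ℕ

data Instr : Set where
  constℕ                : (d : Register) (c : ℕ) → Instr
  addℕ monusℕ           : (d a b : Register) → Instr
  loadℕ                 : (d addr : Register) → Instr
  storeℕ                : (addr a : Register) → Instr
  oneℝ                  : (d : Register) → Instr
  addℝ subℝ mulℝ divℝ   : (d a b : Register) → Instr
  loadℝ                 : (d addr : Register) → Instr
  storeℝ                : (addr a : Register) → Instr

data Test : Set where
  leqℕ leqℝ : (a b : Register) → Test

infixr 5 _⨾_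

data Program : Set where
  skip  : Program
  instr : Instr → Program
  _⨾_   : Program → Program → Program
  cond  : Test → Program → Program → Program
  while : Test → Program → Program

module RealRAM (ℝ : RealNumbers) where
  open RealNumbers ℝ
  open Disks ℝ public

  record State : Set where
    field
      regℕ memℕ : ℕ → ℕ
      regℝ memℝ : ℕ → Carrier

  open State

  _[_≔_] : {A : Set} → (ℕ → A) → ℕ → A → ℕ → A
  (f [ a ≔ v ]) b = if ⌊ a ℕ.≟ b ⌋ then v else f b

  setRegℕ : Register → ℕ → State → State
  setRegℕ d v σ = record σ { regℕ = regℕ σ [ d ≔ v ] }

  setRegℝ : Register → Carrier → State → State
  setRegℝ d v σ = record σ { regℝ = regℝ σ [ d ≔ v ] }

  exec : Instr → State → State
  exec (constℕ d c)    σ = setRegℕ d c σ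
  exec (addℕ d a b)    σ = setRegℕ d (regℕ σ a ℕ.+ regℕ σ b) σ
  exec (monusℕ d a b)  σ = setRegℕ d (regℕ σ a ℕ.∸ regℕ σ b) σ
  exec (loadℕ d addr)  σ = setRegℕ d (memℕ σ (regℕ σ addr)) σ
  exec (storeℕ addr a) σ = record σ { memℕ = memℕ σ [ regℕ σ addr ≔ regℕ σ a ] }
  exec (oneℝ d)        σ = setRegℝ d 1# σ
  exec (addℝ d a b)    σ = setRegℝ d (regℝ σ a + regℝ σ b) σ
  exec (subℝ d a b)    σ = setRegℝ d (regℝ σ a - regℝ σ b) σ
  exec (mulℝ d a b)    σ = setRegℝ d (regℝ σ a * regℝ σ b) σ
  exec (divℝ d a b)    σ = setRegℝ d (regℝ σ a * regℝ σ b ⁻¹) σ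
  exec (loadℝ d addr)  σ = setRegℝ d (memℝ σ (regℕ σ addr)) σ
  exec (storeℝ addr a) σ = record σ { memℝ = memℝ σ [ regℕ σ addr ≔ regℝ σ a ] }

  -- Division by zero blocks the machine: such a run has no outcome.
  Executable : Instr → State → Set
  Executable i σ = ∀ {d a b} → i ≡ divℝ d a b → ¬ regℝ σ b ≈ 0#

  test : Test → State → Bool
  test (leqℕ a b) σ = ⌊ regℕ σ a ℕ.≤? regℕ σ b ⌋
  test (leqℝ a b) σ = ⌊ regℝ σ a ≤? regℝ σ b ⌋

  -- ⟨ P , σ ⟩⇓[ t ] τ : started in σ, P halts in state τ after t unit-cost
  -- operations (instructions and tests).
  infix 4 ⟨_,_⟩⇓[_]_

  data ⟨_,_⟩⇓[_]_ : Program → State → ℕ → State → Set where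
    ⇓-skip  : ∀ {σ} → ⟨ skip , σ ⟩⇓[ 0 ] σ
    ⇓-instr : ∀ {i σ} → Executable i σ → ⟨ instr i , σ ⟩⇓[ 1 ] exec i σ
    ⇓-seq   : ∀ {P Q σ τ υ t u} →
              ⟨ P , σ ⟩⇓[ t ] τ → ⟨ Q , τ ⟩⇓[ u ] υ → ⟨ P ⨾ Q , σ ⟩⇓[ t ℕ.+ u ] υ
    ⇓-then  : ∀ {b P Q σ τ t} → test b σ ≡ true →
              ⟨ P , σ ⟩⇓[ t ] τ → ⟨ cond b P Q , σ ⟩⇓[ suc t ] τ
    ⇓-else  : ∀ {b P Q σ τ t} → test b σ ≡ false →
              ⟨ Q , σ ⟩⇓[ t ] τ → ⟨ cond b P Q , σ ⟩⇓[ suc t ] τ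
    ⇓-loop  : ∀ {b P σ τ υ t u} → test b σ ≡ true →
              ⟨ P , σ ⟩⇓[ t ] τ → ⟨ while b P , τ ⟩⇓[ u ] υ →
              ⟨ while b P , σ ⟩⇓[ suc (t ℕ.+ u) ] υ
    ⇓-exit  : ∀ {b P σ} → test b σ ≡ false → ⟨ while b P , σ ⟩⇓[ 1 ] σ

  -- Cells 3i, 3i+1, 3i+2 hold the centre and the radius of the i-th disk.
  encode : ∀ {n} → Vector Disk n → ℕ → Carrier
  encode {zero}  O _                   = 0#
  encode {suc n} O 0                   = Point.x (Disk.centre (Vector.head O))
  encode {suc n} O 1                   = Point.y (Disk.centre (Vector.head O))
  encode {suc n} O 2                   = Disk.radius (Vector.head O)
  encode {suc n} O (suc (suc (suc a))) = encode (Vector.tail O) a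

  input : ∀ {n} → Vector Disk n → ℕ → State
  input {n} O k = record
    { regℕ = ((λ _ → 0) [ 0 ≔ n ]) [ 1 ≔ k ]
    ; memℕ = λ _ → 0
    ; regℝ = λ _ → 0#
    ; memℝ = encode O
    }

  -- Register 0 tells whether a solution was found; if so, the positions of
  -- the chosen disks are in cells 0, …, k-1 of the integer memory.
  CorrectOutput : ∀ {n} → Vector Disk n → ℕ → State → Set
  CorrectOutput {n} O k τ =
      (regℕ τ 0 ≡ 1 × ∃[ s ] IsDisjointSelection {n} {k} O s
                           × (∀ j → memℕ τ (toℕ j) ≡ toℕ (s j)))
    ⊎ (regℕ τ 0 ≡ 0 × ¬ (∃[ s ] IsDisjointSelection {n} {k} O s))

-- e ∈ O(√k), with the square root cleared.  No additive constant or
-- threshold is needed: for k ≥ 1 it is absorbed by c.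
_∈O[√k] : (ℕ → ℕ) → Set
e ∈O[√k] = ∃[ c ] (∀ k → e k ℕ.* e k ℕ.≤ c ℕ.* k)

-- k disjoint disks have a balanced separator.  Among the balls (in the maximum norm, around
-- centres of disks) that contain a tenth of the centres take one of least radius t.  Nine cells
-- of diameter less than t cover the concentric squares of half-side less than 3t/2, so each of
-- these contains at most nine tenths of the centres.  Choose about √k such squares at distances
-- 2δ, where δ is of order t/√k.  A disk of radius less than δ crosses at most one of them, so
-- some square is crossed by at most √k of those; and only O(√k) disjoint disks of radius at
-- least δ touch the boundary of a square, because each contains a disk of radius δ close to the
-- boundary.  Removing the crossing disks leaves a part inside and a part outside the square.
--
-- Hence a solution is built from its disks by repeatedly joining solutions of two disjoint
-- regions, and O(√k) disks describe each region: it consists of the positions whose disks avoid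
-- all disks of a union of single disks, of sets of disks inside a square, and of polars of such
-- sets.  The square may be shrunk until it is determined by two disks of the solution.  There
-- are only |O|^O(√k) regions, and they arise by closing the describing sets under union and
-- polar for log √k + O(1) rounds, each of which about squares their number.  The program lists
-- them in memory and then, for 2k rounds, records for each region the largest independent
-- union of two recorded sets that it contains.
module Submission where

open import Defs
open import Level using (0ℓ)
open import Algebra.Bundles using (CommutativeRing; RawRing)
import Algebra.Properties.Ring
import Algebra.Properties.Semiring.Mult.TCOptimised
import Algebra.Solver.Ring
open import Algebra.Solver.Ring.AlmostCommutativeRing using (fromCommutativeRing; _-Raw-AlmostCommutative⟶_)
open import Data.Bool using (Bool; true; false; if_then_else_; _∧_; _∨_; not; T)
open import Data.Bool.Properties using (T-∧; ∧-zeroʳ; ∨-assoc; ∨-idem; ∨-identityʳ)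
open import Data.Empty using (⊥-elim)
open import Data.Fin as Fin using (Fin; toℕ; fromℕ<)
import Data.Fin.Properties as Fin
open import Data.Integer as ℤ using (ℤ; -[1+_])
import Data.Integer.Properties as ℤ
open import Data.Maybe using (Maybe; just; nothing)
open import Data.Nat as ℕ using (ℕ; zero; suc; _≤_; _<_; _+_; _*_; _∸_; _^_; _⊔_; _≤ᵇ_; _<ᵇ_; z≤n; s≤s)
open import Data.Nat.DivMod using (_/_; m≡m%n+[m/n]*n; m%n<n; m/n*n≤m)
open import Data.Nat.Properties hiding (_≟_; _≤?_)
open import Data.Nat.Tactic.RingSolver using (solve-∀)
open import Data.Product using (∃; ∃-syntax; _×_; _,_; proj₁; proj₂)
open import Data.Sum using (_⊎_; inj₁; inj₂; [_,_]′)
open import Data.Unit using (tt)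
open import Data.Vec.Functional using (Vector)
open import Function.Bundles using (Equivalence)
open import Relation.Binary using (IsDecTotalOrder)
open import Relation.Binary.PropositionalEquality using (_≡_; _≢_; refl; sym; trans; cong; cong₂; subst)
import Relation.Binary.Reasoning.Setoid
open import Relation.Nullary using (¬_; Dec; yes; no; ⌊_⌋)

-- A language with structured expressions, compiled to the real RAM

-- The machine neither multiplies integers nor takes roots, so `√k` occurs only in the analysis, as
-- `isqrt`; the program meets it through the test whether `4 ^ t` exceeds a multiple of `k`. Nor
-- does the program look for separators. It lists every set that might describe a region, and the
-- set that it finally reports is tested for disjointness. Separators only serve to show that no
-- solution is missed. This is why any memory address may count as a set.
--
-- Polars are needed because the inside of a square, too, must be described by sets to be avoided.
-- If `G` consists of the input disks inside the square, the outside part lies in `perp G` and the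
-- inside part in `perp (perp G)`, and these two never meet, whatever the solution is.
--
-- A separator of `s` disks costs `s + 1` describing sets and leaves parts with at most nine tenths
-- of the disks. The sets needed along a branch of the recursion are thus dominated by a geometric
-- series, and a budget whose square is a large multiple of the size pays for them.
--
-- The time is polynomial in the largest loop bound, with a degree fixed by the program text, so
-- only the number of listed cells has to be controlled.

data RExp : Set where
  coord          : (c x : ℕ) → RExp
  _:⊕_ _:⊖_ _:⊗_ : RExp → RExp → RExp
  :max           : RExp → RExp → RExp

infixl 6 _:⊕_ _:⊖_
infixl 7 _:⊗_

-- The index of Exp and Cmd is the first free register: a value is computed into
-- that register, and a binder binds it.
data Exp : ℕ → Set where
  var const : ∀ {d} → ℕ → Exp d
  plus      : ∀ {d} → Exp d → Exp (suc d) → Exp d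
  load      : ∀ {d} → Exp d → Exp d
  ifleq     : ∀ {d} → Exp d → Exp (suc d) → Exp d → Exp d → Exp d
  leqR      : ∀ {d} → RExp → RExp → Exp d
  -- In fold b init body, register d is the accumulator and d + 1 the loop index.
  fold      : ∀ {d} → ℕ → Exp d → Exp (suc (suc d)) → Exp d

-- Register 0 holds the answer and register 1 the number of cells of the
-- integer memory in use.
data Cmd : ℕ → Set where
  push   : ∀ {d} → Exp d → Cmd d
  _⨟_    : ∀ {d} → Cmd d → Cmd d → Cmd d
  for    : ∀ {d} → ℕ → Cmd (suc d) → Cmd d
  lett   : ∀ {d} → Exp d → Cmd (suc d) → Cmd d
  lettop : ∀ {d} → Cmd (suc d) → Cmd d
  ifleq  : ∀ {d} → Exp d → Exp (suc d) → Cmd d → Cmd d → Cmd d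
  nop    : ∀ {d} → Cmd d
  answer : ∀ {d} → ℕ → Cmd d
  reset  : ∀ {d} → Cmd d

infixr 5 _⨟_

foldn : ℕ → (ℕ → ℕ → ℕ) → ℕ → ℕ
foldn zero    f a = a
foldn (suc n) f a = f n (foldn n f a)

abstract
  -- Opaque: unfolding _≤?_ duplicates its arguments, exponentially so in nested expressions.
  leq : ℕ → ℕ → Bool
  leq a b = ⌊ a ℕ.≤? b ⌋

  leq-≡ : ∀ a b → ⌊ a ℕ.≤? b ⌋ ≡ leq a b
  leq-≡ a b = refl

  leq-true : ∀ {a b} → a ≤ b → leq a b ≡ true
  leq-true {a} {b} h with a ℕ.≤? b
  ... | yes _ = refl
  ... | no ¬h = ⊥-elim (¬h h)

  leq-false : ∀ {a b} → ¬ a ≤ b → leq a b ≡ false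
  leq-false {a} {b} ¬h with a ℕ.≤? b
  ... | yes h = ⊥-elim (¬h h)
  ... | no _  = refl

  leq-≤ : ∀ {a b} → leq a b ≡ true → a ≤ b
  leq-≤ {a} {b} h with a ℕ.≤? b
  ... | yes p = p

  leq-≰ : ∀ {a b} → leq a b ≡ false → ¬ a ≤ b
  leq-≰ {a} {b} h with a ℕ.≤? b
  ... | no ¬p = ¬p

record Store : Set where
  constructor store
  field
    ans top : ℕ
    mem     : ℕ → ℕ

open Store

okVar : ℕ → ℕ → Bool
okVar d x = (2 ≤ᵇ x) ∧ (x <ᵇ d)

okR : ℕ → RExp → Bool
okR d (coord c x) = okVar d x
okR d (p :⊕ q)    = okR d p ∧ okR d q
okR d (p :⊖ q)    = okR d p ∧ okR d q
okR d (p :⊗ q)    = okR d p ∧ okR d q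
okR d (:max p q)  = okR d p ∧ okR d q

-- Loop bounds must be variables below c, whose values then bound the running time.
okE : ∀ {d} → ℕ → Exp d → Bool
okE {d} c (var x)         = okVar d x
okE     c (const n)       = true
okE     c (plus e f)      = okE c e ∧ okE c f
okE     c (load e)        = okE c e
okE     c (ifleq a b e f) = okE c a ∧ (okE c b ∧ (okE c e ∧ okE c f))
okE {d} c (leqR p q)      = okR d p ∧ okR d q
okE {d} c (fold b e f)    = okVar c b ∧ (okVar d b ∧ (okE c e ∧ okE c f))

okC : ∀ {d} → Cmd d → Bool
okC {d} (push e)        = okE d e
okC     (c ⨟ c′)        = okC c ∧ okC c′
okC {d} (for b c)       = okVar d b ∧ okC c
okC {d} (lett e c)      = okE d e ∧ okC c
okC     (lettop c)      = okC c
okC {d} (ifleq a b c e) = okE d a ∧ (okE d b ∧ (okC c ∧ okC e))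
okC     nop             = true
okC     (answer n)      = true
okC     reset           = true

compileR : ℕ → ℕ → RExp → Program
compileR d h (coord c x) =
  instr (constℕ d c) ⨾ instr (addℕ d d x) ⨾ instr (addℕ d d x) ⨾ instr (addℕ d d x) ⨾ instr (loadℝ h d)
compileR d h (p :⊕ q)    = compileR d h p ⨾ compileR d (suc h) q ⨾ instr (addℝ h h (suc h))
compileR d h (p :⊖ q)    = compileR d h p ⨾ compileR d (suc h) q ⨾ instr (subℝ h h (suc h))
compileR d h (p :⊗ q)    = compileR d h p ⨾ compileR d (suc h) q ⨾ instr (mulℝ h h (suc h))
-- There is no exact copy between real registers, so q is evaluated again.
compileR d h (:max p q)  =
  compileR d h p ⨾ compileR d (suc h) q ⨾ cond (leqℝ h (suc h)) (compileR d h q) skip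

compileE : ∀ {d} → Exp d → Program
compileE {d} (var x)         = instr (constℕ d 0) ⨾ instr (addℕ d x d)
compileE {d} (const n)       = instr (constℕ d n)
compileE {d} (plus e f)      = compileE e ⨾ compileE f ⨾ instr (addℕ d d (suc d))
compileE {d} (load e)        = compileE e ⨾ instr (loadℕ d d)
compileE {d} (ifleq a b e f) = compileE a ⨾ compileE b ⨾ cond (leqℕ d (suc d)) (compileE e) (compileE f)
compileE {d} (leqR p q)      =
  compileR d 0 p ⨾ compileR d 1 q ⨾ cond (leqℝ 0 1) (instr (constℕ d 1)) (instr (constℕ d 0))
compileE {d} (fold b e f)    =
  compileE e ⨾ instr (constℕ (1 + d) 0) ⨾ instr (constℕ (2 + d) 1) ⨾
  -- The only test is `≤`, so register `2 + d` holds the successor of the index. The body leaves its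
  -- value in that register, so the successor is rebuilt after every pass.
  while (leqℕ (2 + d) b)
    (compileE f ⨾ instr (constℕ (3 + d) 0) ⨾ instr (addℕ d (2 + d) (3 + d)) ⨾ instr (constℕ (2 + d) 1) ⨾
     instr (addℕ (1 + d) (1 + d) (2 + d)) ⨾ instr (addℕ (2 + d) (1 + d) (2 + d)))

compileC : ∀ {d} → Cmd d → Program
compileC {d} (push e)        = compileE e ⨾ instr (storeℕ 1 d) ⨾ instr (constℕ d 1) ⨾ instr (addℕ 1 1 d)
compileC     (c ⨟ c′)        = compileC c ⨾ compileC c′
compileC {d} (for b c)       =
  instr (constℕ d 0) ⨾ instr (constℕ (1 + d) 1) ⨾
  while (leqℕ (1 + d) b)
    (compileC c ⨾ instr (constℕ (1 + d) 1) ⨾ instr (addℕ d d (1 + d)) ⨾ instr (addℕ (1 + d) d (1 + d)))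
compileC     (lett e c)      = compileE e ⨾ compileC c
compileC {d} (lettop c)      = instr (constℕ d 0) ⨾ instr (addℕ d 1 d) ⨾ compileC c
compileC {d} (ifleq a b c e) = compileE a ⨾ compileE b ⨾ cond (leqℕ d (suc d)) (compileC c) (compileC e)
compileC     nop             = skip
compileC     (answer n)      = instr (constℕ 0 n)
compileC     reset           = instr (constℕ 1 0)

costR : RExp → ℕ
costR (coord c x) = 5
costR (p :⊕ q)    = costR p + (costR q + 1)
costR (p :⊖ q)    = costR p + (costR q + 1)
costR (p :⊗ q)    = costR p + (costR q + 1)
costR (:max p q)  = costR p + (costR q + (1 + (costR q + 0)))

costE : ∀ {d} → Exp d → ℕ → ℕ
costE (var x)         B = 2
costE (const n)       B = 1
costE (plus e f)      B = costE e B + (costE f B + 1)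
costE (load e)        B = costE e B + 1
costE (ifleq a b e f) B = costE a B + (costE b B + (1 + (costE e B + costE f B)))
costE (leqR p q)      B = costR p + (costR q + 3)
costE (fold b e f)    B = costE e B + (2 + (B * (1 + (costE f B + 5)) + 1))

costC : ∀ {d} → Cmd d → ℕ → ℕ
costC (push e)        B = costE e B + 3
costC (c ⨟ c′)        B = costC c B + costC c′ B
costC (for b c)       B = 2 + (B * (1 + (costC c B + 3)) + 1)
costC (lett e c)      B = costE e B + costC c B
costC (lettop c)      B = 2 + costC c B
costC (ifleq a b c e) B = costE a B + (costE b B + (1 + (costC c B + costC e B)))
costC nop             B = 0
costC (answer n)      B = 1
costC reset           B = 1

-- Correctness and cost of compiled programs

module Compilation (ℝ : RealNumbers) where
  open RealRAM ℝ
  open State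
  open RealNumbers ℝ using (Carrier; _≤?_) renaming (_+_ to _+ᵣ_; _-_ to _-ᵣ_; _*_ to _*ᵣ_)

  private variable
    σ τ : State
    P P′ : Program
    Q Q′ : State → Set
    b b′ : ℕ

  upd-same : {A : Set} (f : ℕ → A) (a : ℕ) {v : A} → (f [ a ≔ v ]) a ≡ v
  upd-same f a with a ℕ.≟ a
  ... | yes _ = refl
  ... | no ne = ⊥-elim (ne refl)

  upd-other : {A : Set} (f : ℕ → A) (a x : ℕ) {v : A} → a ≢ x → (f [ a ≔ v ]) x ≡ f x
  upd-other f a x ne with a ℕ.≟ x
  ... | yes e = ⊥-elim (ne e)
  ... | no _  = refl

  -- A bound on the time instead of its value: a conditional can be charged for both branches, so
  -- the cost does not depend on the state.
  record Eval (P : Program) (σ : State) (b : ℕ) (Q : State → Set) : Set where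
    constructor eval
    field
      {time}  : ℕ
      {final} : State
      run     : ⟨ P , σ ⟩⇓[ time ] final
      time≤   : time ≤ b
      post    : Q final

  ev-map : (∀ {τ} → Q τ → Q′ τ) → Eval P σ b Q → Eval P σ b Q′
  ev-map f (eval r l q) = eval r l (f q)

  ev-weaken : b ≤ b′ → Eval P σ b Q → Eval P σ b′ Q
  ev-weaken h (eval r l q) = eval r (≤-trans l h) q

  ev-instr : ∀ {i} → Executable i σ → Q (exec i σ) → Eval (instr i) σ 1 Q
  ev-instr x q = eval (⇓-instr x) ≤-refl q

  ev-seq : Eval P σ b (λ τ → Eval P′ τ b′ Q) → Eval (P ⨾ P′) σ (b + b′) Q
  ev-seq (eval r l (eval r′ l′ q)) = eval (⇓-seq r r′) (+-mono-≤ l l′) q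

  infixr 4 _▸_

  _▸_ : ∀ {i} → Executable i σ → Eval P (exec i σ) b Q → Eval (instr i ⨾ P) σ (suc b) Q
  x ▸ e = ev-seq (ev-instr x e)

  ev-cond : ∀ {c} → (test c σ ≡ true → Eval P σ b Q) → (test c σ ≡ false → Eval P′ σ b′ Q) →
            Eval (cond c P P′) σ (1 + (b + b′)) Q
  ev-cond {σ = σ} {b = b} {b′ = b′} {c = c} f g with test c σ in eq
  ... | true  with f refl
  ...   | eval r l q = eval (⇓-then eq r) (s≤s (≤-trans l (m≤m+n b b′))) q
  ev-cond {σ = σ} {b = b} {b′ = b′} {c = c} f g | false with g refl
  ...   | eval r l q = eval (⇓-else eq r) (s≤s (≤-trans l (m≤n+m b′ b))) q

  -- Every loop counts to a bound known on entry. The invariant is therefore indexed by the number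
  -- of passes, and termination is part of the rule.
  ev-while : ∀ {c} (I : ℕ → State → Set) n →
             (∀ {i σ} → i < n → I i σ → test c σ ≡ true × Eval P σ b (I (suc i))) →
             (∀ {σ} → I n σ → test c σ ≡ false) →
             I 0 σ → Eval (while c P) σ (n * suc b + 1) (I n)
  ev-while {P = P} {b = b} {c = c} I n step stop = go n 0 (+-identityʳ n)
    where
    go : ∀ {σ} r i → r + i ≡ n → I i σ → Eval (while c P) σ (r * suc b + 1) (I n)
    go zero i refl inv = eval (⇓-exit (stop inv)) ≤-refl inv
    go (suc r) i refl inv with step (s≤s (m≤n+m i r)) inv
    ... | yes! , eval ru l inv′ with go r (suc i) (+-suc r i) inv′
    ... | eval ru′ l′ q = eval (⇓-loop yes! ru ru′)
        (s≤s (≤-trans (+-mono-≤ l l′) (≤-reflexive (sym (+-assoc b (r * suc b) 1))))) q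

  Agree : ℕ → State → (ℕ → ℕ) → Set
  Agree d σ ρ = ∀ x → 2 ≤ x → x < d → regℕ σ x ≡ ρ x

  -- What an evaluation with free registers from d (and h) on leaves untouched.
  record Frame (d h : ℕ) (σ τ : State) : Set where
    constructor frame
    field
      low   : ∀ x → x < d → regℕ τ x ≡ regℕ σ x
      lowR  : ∀ x → x < h → regℝ τ x ≡ regℝ σ x
      same  : memℕ τ ≡ memℕ σ
      sameR : memℝ τ ≡ memℝ σ

  open Frame

  Frame-refl : ∀ {d h} → Frame d h σ σ
  Frame-refl = frame (λ _ _ → refl) (λ _ _ → refl) refl refl

  Frame-trans : ∀ {d d′ h h′ σ τ υ} → d ≤ d′ → h ≤ h′ → Frame d h σ τ → Frame d′ h′ τ υ → Frame d h σ υ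
  Frame-trans d≤ h≤ (frame a b c e) (frame a′ b′ c′ e′) =
    frame (λ x l → trans (a′ x (≤-trans l d≤)) (a x l)) (λ x l → trans (b′ x (≤-trans l h≤)) (b x l))
          (trans c′ c) (trans e′ e)

  Frame-setℕ : ∀ {d h a v} → d ≤ a → Frame d h σ τ → Frame d h σ (setRegℕ a v τ)
  Frame-setℕ {τ = τ} {a = a} d≤a (frame p q r s) =
    frame (λ x l → trans (upd-other (regℕ τ) a x (λ { refl → <⇒≱ l d≤a })) (p x l)) q r s

  Frame-setℝ : ∀ {d h a v} → h ≤ a → Frame d h σ τ → Frame d h σ (setRegℝ a v τ)
  Frame-setℝ {τ = τ} {a = a} h≤a (frame p q r s) =
    frame p (λ x l → trans (upd-other (regℝ τ) a x (λ { refl → <⇒≱ l h≤a })) (q x l)) r s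

  Agree-frame : ∀ {d h d′ ρ} → d ≤ d′ → Agree d σ ρ → Frame d′ h σ τ → Agree d τ ρ
  Agree-frame d≤ ag fr x l u = trans (low fr x (≤-trans u d≤)) (ag x l u)

  ⟦_⟧R : RExp → (ℕ → ℕ) → (ℕ → Carrier) → Carrier
  ⟦ coord c x ⟧R ρ R = R (c + ρ x + ρ x + ρ x)
  ⟦ p :⊕ q ⟧R    ρ R = ⟦ p ⟧R ρ R +ᵣ ⟦ q ⟧R ρ R
  ⟦ p :⊖ q ⟧R    ρ R = ⟦ p ⟧R ρ R -ᵣ ⟦ q ⟧R ρ R
  ⟦ p :⊗ q ⟧R    ρ R = ⟦ p ⟧R ρ R *ᵣ ⟦ q ⟧R ρ R
  ⟦ :max p q ⟧R  ρ R = if ⌊ ⟦ p ⟧R ρ R ≤? ⟦ q ⟧R ρ R ⌋ then ⟦ q ⟧R ρ R else ⟦ p ⟧R ρ R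

  ⟦_⟧ : ∀ {d} → Exp d → (ℕ → ℕ) → (ℕ → ℕ) → (ℕ → Carrier) → ℕ
  ⟦ var x ⟧           ρ M R = ρ x
  ⟦ const n ⟧         ρ M R = n
  ⟦_⟧ {d} (plus e f)   ρ M R = ⟦ e ⟧ ρ M R + ⟦ f ⟧ (ρ [ d ≔ ⟦ e ⟧ ρ M R ]) M R
  ⟦ load e ⟧          ρ M R = M (⟦ e ⟧ ρ M R)
  ⟦_⟧ {d} (ifleq a b e f) ρ M R =
    if leq (⟦ a ⟧ ρ M R) (⟦ b ⟧ (ρ [ d ≔ ⟦ a ⟧ ρ M R ]) M R) then ⟦ e ⟧ ρ M R else ⟦ f ⟧ ρ M R
  ⟦ leqR p q ⟧        ρ M R = if ⌊ ⟦ p ⟧R ρ R ≤? ⟦ q ⟧R ρ R ⌋ then 1 else 0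
  ⟦_⟧ {d} (fold b e f) ρ M R =
    foldn (ρ b) (λ i a → ⟦ f ⟧ ((ρ [ d ≔ a ]) [ suc d ≔ i ]) M R) (⟦ e ⟧ ρ M R)

  ∧ˡ : ∀ {x y} → T (x ∧ y) → T x
  ∧ˡ t = proj₁ (Equivalence.to T-∧ t)

  ∧ʳ : ∀ {x y} → T (x ∧ y) → T y
  ∧ʳ {x} t = proj₂ (Equivalence.to (T-∧ {x}) t)

  okVar-< : ∀ {d x} → T (okVar d x) → x < d
  okVar-< {d} {x} t = <ᵇ⇒< x d (∧ʳ {2 ≤ᵇ x} t)

  okVar-≥ : ∀ {d x} → T (okVar d x) → 2 ≤ x
  okVar-≥ {d} {x} t = ≤ᵇ⇒≤ 2 x (∧ˡ t)

  PostR : ℕ → ℕ → RExp → (ℕ → ℕ) → State → State → Set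
  PostR d h p ρ σ τ = regℝ τ h ≡ ⟦ p ⟧R ρ (memℝ σ) × Frame d h σ τ

  module _ {d : ℕ} {ρ : ℕ → ℕ} where

    evalR : ∀ h p → T (okR d p) → Agree d σ ρ → Eval (compileR d h p) σ (costR p) (PostR d h p ρ σ)

    evalR₂ : ∀ h p q → T (okR d p ∧ okR d q) → Agree d σ ρ →
             (∀ {τ} → Frame d h σ τ → regℝ τ h ≡ ⟦ p ⟧R ρ (memℝ σ) → regℝ τ (suc h) ≡ ⟦ q ⟧R ρ (memℝ σ) →
              Eval P τ b Q) →
             Eval (compileR d h p ⨾ compileR d (suc h) q ⨾ P) σ (costR p + (costR q + b)) Q
    evalR₂ {σ = σ} h p q ok ag k =
      ev-seq (ev-map (λ {τ} (vp , fr) → ev-seq (ev-map (λ {υ} (vq , fr′) →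
          k (Frame-trans ≤-refl (n≤1+n h) fr fr′)
            (trans (lowR fr′ h ≤-refl) vp)
            (trans vq (cong (⟦ q ⟧R ρ) (sameR fr))))
        (evalR (suc h) q (∧ʳ {okR d p} ok) (Agree-frame ≤-refl ag fr))))
      (evalR h p (∧ˡ ok) ag))

    evalR {σ = σ} h (coord c x) ok ag =
      (λ ()) ▸ (λ ()) ▸ (λ ()) ▸ (λ ()) ▸ ev-instr (λ ())
        ( trans (upd-same (regℝ σ) h) (cong (memℝ σ) value)
        , Frame-setℝ ≤-refl (Frame-setℕ ≤-refl (Frame-setℕ ≤-refl (Frame-setℕ ≤-refl (Frame-setℕ ≤-refl Frame-refl)))))
      where
      d≢x : d ≢ x
      d≢x refl = <-irrefl refl (okVar-< {d} ok)
      ρx : regℕ σ x ≡ ρ x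
      ρx = ag x (okVar-≥ {d} ok) (okVar-< ok)
      σ₁ σ₂ σ₃ σ₄ : State
      σ₁ = exec (constℕ d c) σ
      σ₂ = exec (addℕ d d x) σ₁
      σ₃ = exec (addℕ d d x) σ₂
      σ₄ = exec (addℕ d d x) σ₃
      x₁ : regℕ σ₁ x ≡ ρ x
      x₁ = trans (upd-other (regℕ σ) d x d≢x) ρx
      x₂ : regℕ σ₂ x ≡ ρ x
      x₂ = trans (upd-other (regℕ σ₁) d x d≢x) x₁
      x₃ : regℕ σ₃ x ≡ ρ x
      x₃ = trans (upd-other (regℕ σ₂) d x d≢x) x₂
      value : regℕ σ₄ d ≡ c + ρ x + ρ x + ρ x
      value = trans (upd-same (regℕ σ₃) d) (cong₂ _+_
                (trans (upd-same (regℕ σ₂) d) (cong₂ _+_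
                  (trans (upd-same (regℕ σ₁) d) (cong₂ _+_ (upd-same (regℕ σ) d) x₁)) x₂)) x₃)
    evalR h (p :⊕ q) ok ag = evalR₂ h p q ok ag λ {τ} fr vp vq →
      ev-instr (λ ()) (trans (upd-same (regℝ τ) h) (cong₂ _+ᵣ_ vp vq) , Frame-setℝ ≤-refl fr)
    evalR h (p :⊖ q) ok ag = evalR₂ h p q ok ag λ {τ} fr vp vq →
      ev-instr (λ ()) (trans (upd-same (regℝ τ) h) (cong₂ _-ᵣ_ vp vq) , Frame-setℝ ≤-refl fr)
    evalR h (p :⊗ q) ok ag = evalR₂ h p q ok ag λ {τ} fr vp vq →
      ev-instr (λ ()) (trans (upd-same (regℝ τ) h) (cong₂ _*ᵣ_ vp vq) , Frame-setℝ ≤-refl fr)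
    evalR {σ = σ} h (:max p q) ok ag = evalR₂ h p q ok ag λ {τ} fr vp vq →
      let test≡ = cong₂ (λ u v → ⌊ u ≤? v ⌋) vp vq in
      ev-cond
        (λ t → ev-map (λ {υ} (v , fr′) →
             trans (trans v (cong (⟦ q ⟧R ρ) (sameR fr)))
                   (sym (cong (λ t → if t then ⟦ q ⟧R ρ (memℝ σ) else ⟦ p ⟧R ρ (memℝ σ)) (trans (sym test≡) t)))
           , Frame-trans ≤-refl ≤-refl fr fr′)
           (evalR h q (∧ʳ {okR d p} ok) (Agree-frame ≤-refl ag fr)))
        (λ t → eval ⇓-skip z≤n
           ( trans vp (sym (cong (λ t → if t then ⟦ q ⟧R ρ (memℝ σ) else ⟦ p ⟧R ρ (memℝ σ)) (trans (sym test≡) t)))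
           , fr))

  Agree-set : ∀ {d v} {ρ : ℕ → ℕ} {σ : State} → Agree d σ ρ → regℕ σ d ≡ v → Agree (suc d) σ (ρ [ d ≔ v ])
  Agree-set {d} {v} {ρ} ag e x 2≤x x<sd with d ℕ.≟ x
  ... | yes refl = e
  ... | no ne    = ag x 2≤x (≤∧≢⇒< (≤-pred x<sd) λ { refl → ne refl })

  PostE : ∀ {d} → Exp d → (ℕ → ℕ) → State → State → Set
  PostE {d} e ρ σ τ = regℕ τ d ≡ ⟦ e ⟧ ρ (memℕ σ) (memℝ σ) × Frame d 0 σ τ

  Below : ℕ → (ℕ → ℕ) → ℕ → Set
  Below c ρ B = ∀ x → 2 ≤ x → x < c → ρ x ≤ B

  module _ {c B : ℕ} where

    -- `Below` restricts only the registers under `c`, which are the possible loop bounds.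
    -- Accumulators live at `d` and above and may grow past `B`, as the powers of four in `powerE`
    -- do.
    evalE : ∀ {d ρ} (e : Exp d) → c ≤ d → T (okE c e) → Agree d σ ρ → Below c ρ B →
            Eval (compileE e) σ (costE e B) (PostE e ρ σ)

    evalE₂ : ∀ {d ρ} (e : Exp d) (f : Exp (suc d)) → c ≤ d → T (okE c e) → T (okE c f) →
             Agree d σ ρ → Below c ρ B →
             (∀ {τ} → Frame d 0 σ τ → regℕ τ d ≡ ⟦ e ⟧ ρ (memℕ σ) (memℝ σ) →
              regℕ τ (suc d) ≡ ⟦ f ⟧ (ρ [ d ≔ ⟦ e ⟧ ρ (memℕ σ) (memℝ σ) ]) (memℕ σ) (memℝ σ) → Eval P τ b Q) →
             Eval (compileE e ⨾ compileE f ⨾ P) σ (costE e B + (costE f B + b)) Q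
    evalE₂ {σ = σ} {d = d} {ρ} e f c≤d oke okf ag be k =
      ev-seq (ev-map (λ {τ} (ve , fr) → ev-seq (ev-map (λ {υ} (vf , fr′) →
          k (Frame-trans (n≤1+n d) z≤n fr fr′)
            (trans (low fr′ d ≤-refl) ve)
            (trans vf (cong₂ (⟦ f ⟧ _) (same fr) (sameR fr))))
        (evalE f (m≤n⇒m≤1+n c≤d) okf (Agree-set {ρ = ρ} {τ} (Agree-frame ≤-refl ag fr) ve)
           (λ x 2≤x x<c → ≤-trans (≤-reflexive (upd-other ρ d x λ { refl → <⇒≱ x<c c≤d })) (be x 2≤x x<c)))))
      (evalE e c≤d oke ag be))

    evalE {σ = σ} {d = d} {ρ = ρ} (var x) c≤d ok ag be =
      (λ ()) ▸ ev-instr (λ ())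
        ( trans (upd-same (regℕ σ₁) d) (trans (cong₂ _+_ (trans (upd-other (regℕ σ) d x (λ { refl → <-irrefl refl (okVar-< {d} ok) })) (ag x (okVar-≥ {d} ok) (okVar-< ok)))
                                                           (upd-same (regℕ σ) d)) (+-identityʳ (ρ x)))
        , Frame-setℕ ≤-refl (Frame-setℕ ≤-refl Frame-refl))
      where
      σ₁ : State
      σ₁ = exec (constℕ d 0) σ
    evalE {σ = σ} {d = d} (const n) c≤d ok ag be =
      ev-instr (λ ()) (upd-same (regℕ σ) d , Frame-setℕ ≤-refl Frame-refl)
    evalE {d = d} (plus e f) c≤d ok ag be =
      evalE₂ e f c≤d (∧ˡ ok) (∧ʳ {okE c e} ok) ag be λ {τ} fr ve vf →
        ev-instr (λ ()) (trans (upd-same (regℕ τ) d) (cong₂ _+_ ve vf) , Frame-setℕ ≤-refl fr)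
    evalE {σ = σ} {d = d} (load e) c≤d ok ag be =
      ev-seq (ev-map (λ {τ} (ve , fr) →
          ev-instr (λ ()) (trans (upd-same (regℕ τ) d) (cong₂ (λ M a → M a) (same fr) ve) , Frame-setℕ ≤-refl fr))
        (evalE e c≤d ok ag be))
    evalE {σ = σ} {d = d} {ρ = ρ} (ifleq a b e f) c≤d ok ag be =
      evalE₂ a b c≤d (∧ˡ ok) (∧ˡ (∧ʳ {okE c a} ok)) ag be λ {τ} fr va vb →
        let oks = ∧ʳ {okE c b} (∧ʳ {okE c a} ok)
            M = memℕ σ
            R = memℝ σ
            test≡ = trans (cong₂ (λ u v → ⌊ u ℕ.≤? v ⌋) va vb) (leq-≡ _ _)
            branch = λ {υ} (g : Exp d) (vg : PostE g ρ τ υ) →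
              trans (proj₁ vg) (cong₂ (⟦ g ⟧ ρ) (same fr) (sameR fr)) in
        ev-cond
          (λ t → ev-map (λ {υ} vg →
               trans (branch e vg) (sym (cong (λ t → if t then ⟦ e ⟧ ρ M R else ⟦ f ⟧ ρ M R) (trans (sym test≡) t)))
             , Frame-trans ≤-refl z≤n fr (proj₂ vg))
             (evalE e c≤d (∧ˡ oks) (Agree-frame ≤-refl ag fr) be))
          (λ t → ev-map (λ {υ} vg →
               trans (branch f vg) (sym (cong (λ t → if t then ⟦ e ⟧ ρ M R else ⟦ f ⟧ ρ M R) (trans (sym test≡) t)))
             , Frame-trans ≤-refl z≤n fr (proj₂ vg))
             (evalE f c≤d (∧ʳ {okE c e} oks) (Agree-frame ≤-refl ag fr) be))
    evalE {σ = σ} {d = d} {ρ = ρ} (leqR p q) c≤d ok ag be =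
      evalR₂ 0 p q ok ag λ {τ} fr vp vq →
        let test≡ = cong₂ (λ u v → ⌊ u ≤? v ⌋) vp vq in
        ev-cond
          (λ t → ev-instr (λ ()) (trans (upd-same (regℕ τ) d) (sym (cong (λ t → if t then 1 else 0) (trans (sym test≡) t))) , Frame-setℕ ≤-refl fr))
          (λ t → ev-instr (λ ()) (trans (upd-same (regℕ τ) d) (sym (cong (λ t → if t then 1 else 0) (trans (sym test≡) t))) , Frame-setℕ ≤-refl fr))
    evalE {σ = σ} {d = d} {ρ = ρ} (fold b e f) c≤d ok ag be =
      ev-seq (ev-map (λ {τ} (ve , fr) →
        (λ ()) ▸ (λ ()) ▸ ev-weaken (+-monoˡ-≤ 1 (*-monoˡ-≤ _ bound)) (ev-map (λ (va , _ , _ , fr′) → va , fr′)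
          (ev-while Inv n body exit
            ( trans (upd-other (regℕ (exec (constℕ (1 + d) 0) τ)) (2 + d) d 2+d≢d) (trans (upd-other (regℕ τ) (1 + d) d 1+d≢d) ve)
            , trans (upd-other (regℕ (exec (constℕ (1 + d) 0) τ)) (2 + d) (1 + d) (m+1+n≢n 0)) (upd-same (regℕ τ) (1 + d))
            , upd-same (regℕ (exec (constℕ (1 + d) 0) τ)) (2 + d)
            , Frame-setℕ d≤2+d (Frame-setℕ (n≤1+n d) fr)))))
        (evalE e c≤d oke ag be))
      where
      M = memℕ σ
      R = memℝ σ
      n = ρ b
      okb : T (okVar c b)
      okb = ∧ˡ ok
      oke : T (okE c e)
      oke = ∧ˡ (∧ʳ {okVar d b} (∧ʳ {okVar c b} ok))
      okf : T (okE c f)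
      okf = ∧ʳ {okE c e} (∧ʳ {okVar d b} (∧ʳ {okVar c b} ok))
      bound : n ≤ B
      bound = be b (okVar-≥ {c} okb) (okVar-< okb)
      b<d : b < d
      b<d = ≤-trans (okVar-< okb) c≤d
      d≤2+d : d ≤ 2 + d
      d≤2+d = m≤n+m d 2
      1+d≢d : 1 + d ≢ d
      1+d≢d = 1+n≢n
      2+d≢d : 2 + d ≢ d
      2+d≢d = m+1+n≢n 1
      g : ℕ → ℕ → ℕ
      g i a = ⟦ f ⟧ ((ρ [ d ≔ a ]) [ suc d ≔ i ]) M R
      Inv : ℕ → State → Set
      Inv i τ = regℕ τ d ≡ foldn i g (⟦ e ⟧ ρ M R) × regℕ τ (1 + d) ≡ i × regℕ τ (2 + d) ≡ suc i × Frame d 0 σ τ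
      reg-b : ∀ {τ} → Frame d 0 σ τ → regℕ τ b ≡ n
      reg-b fr = trans (low fr b b<d) (ag b (okVar-≥ {c} okb) b<d)
      exit : ∀ {τ} → Inv n τ → test (leqℕ (2 + d) b) τ ≡ false
      exit (_ , _ , j , fr) = trans (cong₂ (λ u v → ⌊ u ℕ.≤? v ⌋) j (reg-b fr)) (trans (leq-≡ _ _) (leq-false (<⇒≱ ≤-refl)))
      body : ∀ {i τ} → i < n → Inv i τ → test (leqℕ (2 + d) b) τ ≡ true × Eval _ τ _ (Inv (suc i))
      body {i} {τ} i<n (va , vi , vj , fr) =
          trans (cong₂ (λ u v → ⌊ u ℕ.≤? v ⌋) vj (reg-b fr)) (trans (leq-≡ _ _) (leq-true i<n))
        , ev-seq (ev-map next (evalE f (≤-trans c≤d d≤2+d) okf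
            (Agree-set {ρ = ρ [ d ≔ _ ]} {τ} (Agree-set {ρ = ρ} {τ} (Agree-frame ≤-refl ag fr) va) vi)
            (λ x 2≤x x<c → ≤-trans (≤-reflexive (trans (upd-other (ρ [ d ≔ _ ]) (suc d) x λ { refl → <⇒≱ x<c (m≤n⇒m≤1+n c≤d) })
                                                       (upd-other ρ d x λ { refl → <⇒≱ x<c c≤d })))
                                   (be x 2≤x x<c))))
        where
        next : ∀ {υ} → PostE f ((ρ [ d ≔ foldn i g (⟦ e ⟧ ρ M R) ]) [ suc d ≔ i ]) τ υ → Eval _ υ 5 (Inv (suc i))
        next {υ} (vf , fr′) = (λ ()) ▸ (λ ()) ▸ (λ ()) ▸ (λ ()) ▸ ev-instr (λ ()) (acc , idx , sidx , fr₅)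
          where
          υ₁ υ₂ υ₃ υ₄ : State
          υ₁ = exec (constℕ (3 + d) 0) υ
          υ₂ = exec (addℕ d (2 + d) (3 + d)) υ₁
          υ₃ = exec (constℕ (2 + d) 1) υ₂
          υ₄ = exec (addℕ (1 + d) (1 + d) (2 + d)) υ₃
          acc₂ : regℕ υ₂ d ≡ g i (foldn i g (⟦ e ⟧ ρ M R))
          acc₂ = trans (upd-same (regℕ υ₁) d) (trans (cong₂ _+_
                   (trans (upd-other (regℕ υ) (3 + d) (2 + d) (m+1+n≢n 0)) (trans vf (cong₂ (⟦ f ⟧ _) (same fr) (sameR fr))))
                   (upd-same (regℕ υ) (3 + d))) (+-identityʳ _))
          acc : regℕ (exec (addℕ (2 + d) (1 + d) (2 + d)) υ₄) d ≡ g i (foldn i g (⟦ e ⟧ ρ M R))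
          acc = trans (upd-other (regℕ υ₄) (2 + d) d 2+d≢d) (trans (upd-other (regℕ υ₃) (1 + d) d 1+d≢d) (trans (upd-other (regℕ υ₂) (2 + d) d 2+d≢d) acc₂))
          one₃ : regℕ υ₃ (2 + d) ≡ 1
          one₃ = upd-same (regℕ υ₂) (2 + d)
          idx₃ : regℕ υ₃ (1 + d) ≡ i
          idx₃ = trans (upd-other (regℕ υ₂) (2 + d) (1 + d) (m+1+n≢n 0)) (trans (upd-other (regℕ υ₁) d (1 + d) (λ e → 1+d≢d (sym e)))
                   (trans (upd-other (regℕ υ) (3 + d) (1 + d) (m+1+n≢n 1)) (trans (low fr′ (1 + d) ≤-refl) vi)))
          idx₄ : regℕ υ₄ (1 + d) ≡ suc i
          idx₄ = trans (upd-same (regℕ υ₃) (1 + d)) (trans (cong₂ _+_ idx₃ one₃) (+-comm i 1))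
          one₄ : regℕ υ₄ (2 + d) ≡ 1
          one₄ = trans (upd-other (regℕ υ₃) (1 + d) (2 + d) (λ e → m+1+n≢n 0 (sym e))) one₃
          idx : regℕ (exec (addℕ (2 + d) (1 + d) (2 + d)) υ₄) (1 + d) ≡ suc i
          idx = trans (upd-other (regℕ υ₄) (2 + d) (1 + d) (m+1+n≢n 0)) idx₄
          sidx : regℕ (exec (addℕ (2 + d) (1 + d) (2 + d)) υ₄) (2 + d) ≡ suc (suc i)
          sidx = trans (upd-same (regℕ υ₄) (2 + d)) (trans (cong₂ _+_ idx₄ one₄) (+-comm (suc i) 1))
          fr₅ : Frame d 0 σ (exec (addℕ (2 + d) (1 + d) (2 + d)) υ₄)
          fr₅ = Frame-setℕ d≤2+d (Frame-setℕ (n≤1+n d) (Frame-setℕ d≤2+d (Frame-setℕ ≤-refl (Frame-setℕ (m≤n+m d 3)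
                  (Frame-trans d≤2+d z≤n fr fr′)))))

  -- Weakest preconditions of commands

  infix 4 _⊑_

  record _⊑_ (s s′ : Store) : Set where
    constructor grow
    field
      top-≤ : top s ≤ top s′
      kept  : ∀ a → a < top s → mem s′ a ≡ mem s a

  open _⊑_ public

  ⊑-refl : ∀ {s} → s ⊑ s
  ⊑-refl = grow ≤-refl λ _ _ → refl

  ⊑-trans : ∀ {s s′ s″} → s ⊑ s′ → s′ ⊑ s″ → s ⊑ s″
  ⊑-trans (grow l k) (grow l′ k′) = grow (≤-trans l l′) λ a h → trans (k′ a (≤-trans h l)) (k a h)

  -- The cell values may be computed in a memory that already contains some of the new cells.
  record Row (s s′ : Store) (len : ℕ) (E : ℕ → (ℕ → ℕ) → ℕ) : Set where
    field
      extends : s ⊑ s′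
      length≡ : top s′ ≡ top s + len
      cells   : ∀ {j} → j < len → ∃[ M ] (∀ a → a < top s → M a ≡ mem s a) × mem s′ (top s + j) ≡ E j M

  open Row public

  module _ (R : ℕ → Carrier) where

    Pred : Set₁
    Pred = Store → Set

    wpLoop : (ℕ → Pred → Pred) → ℕ → ℕ → Pred → Pred
    wpLoop W zero    j Q = Q
    wpLoop W (suc r) j Q = W j (wpLoop W r (suc j) Q)

    -- Besides the postcondition, this demands that all variables remain below B.
    wp : ∀ {d} → ℕ → Cmd d → (ℕ → ℕ) → Pred → Pred
    wp B (push e) ρ Q s = Q (store (ans s) (suc (top s)) (mem s [ top s ≔ ⟦ e ⟧ ρ (mem s) R ]))
    wp B (c ⨟ c′) ρ Q s = wp B c ρ (wp B c′ ρ Q) s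
    wp {d} B (for b c) ρ Q s = wpLoop (λ i → wp B c (ρ [ d ≔ i ])) (ρ b) 0 Q s
    wp {d} B (lett e c) ρ Q s = ⟦ e ⟧ ρ (mem s) R ≤ B × wp B c (ρ [ d ≔ ⟦ e ⟧ ρ (mem s) R ]) Q s
    wp {d} B (lettop c) ρ Q s = top s ≤ B × wp B c (ρ [ d ≔ top s ]) Q s
    wp {d} B (ifleq a b c e) ρ Q s =
        (⟦ a ⟧ ρ (mem s) R ≤ ⟦ b ⟧ (ρ [ d ≔ ⟦ a ⟧ ρ (mem s) R ]) (mem s) R → wp B c ρ Q s)
      × (¬ ⟦ a ⟧ ρ (mem s) R ≤ ⟦ b ⟧ (ρ [ d ≔ ⟦ a ⟧ ρ (mem s) R ]) (mem s) R → wp B e ρ Q s)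
    wp B nop ρ Q s = Q s
    wp B (answer n) ρ Q s = Q (store n (top s) (mem s))
    wp B reset ρ Q s = Q (store (ans s) 0 (mem s))

    record Sim (d : ℕ) (σ : State) (ρ : ℕ → ℕ) (s : Store) : Set where
      constructor sim
      field
        ans≡  : regℕ σ 0 ≡ ans s
        top≡  : regℕ σ 1 ≡ top s
        mem≡  : memℕ σ ≡ mem s
        memR≡ : memℝ σ ≡ R
        agree : Agree d σ ρ

    open Sim

    Sim-frame : ∀ {d d′ h ρ s} → 2 ≤ d′ → d ≤ d′ → Sim d σ ρ s → Frame d′ h σ τ → Sim d τ ρ s
    Sim-frame 2≤d d≤ (sim a b c e f) fr =
      sim (trans (low fr 0 (≤-trans (s≤s z≤n) 2≤d)) a) (trans (low fr 1 2≤d) b) (trans (same fr) c)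
          (trans (sameR fr) e) (Agree-frame d≤ f fr)

    Sim-bind : ∀ {d v ρ s} → Sim d σ ρ s → regℕ σ d ≡ v → Sim (suc d) σ (ρ [ d ≔ v ]) s
    Sim-bind {σ = σ} {ρ = ρ} (sim a b c e f) v = sim a b c e (Agree-set {ρ = ρ} {σ} f v)

    Sim-unbind : ∀ {d v ρ s} → Sim (suc d) σ (ρ [ d ≔ v ]) s → Sim d σ ρ s
    Sim-unbind {d = d} {ρ = ρ} (sim a b c e f) = sim a b c e λ x 2≤x x<d →
      trans (f x 2≤x (m≤n⇒m≤1+n x<d)) (upd-other ρ d x λ { refl → <-irrefl refl x<d })

    Below-bind : ∀ {d v ρ B} → v ≤ B → Below d ρ B → Below (suc d) (ρ [ d ≔ v ]) B
    Below-bind {d} v≤ be x 2≤x x<sd with d ℕ.≟ x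
    ... | yes refl = v≤
    ... | no ne    = be x 2≤x (≤∧≢⇒< (≤-pred x<sd) λ { refl → ne refl })

    evalSim : ∀ {c d B ρ s} (e : Exp d) → 2 ≤ d → c ≤ d → T (okE c e) → Sim d σ ρ s → Below c ρ B →
              Eval (compileE e) σ (costE e B)
                   (λ τ → regℕ τ d ≡ ⟦ e ⟧ ρ (mem s) R × Sim d τ ρ s)
    evalSim {σ = σ} {ρ = ρ} e 2≤d c≤d ok S be =
      ev-map (λ {τ} (v , fr) → trans v (cong₂ (⟦ e ⟧ ρ) (mem≡ S) (memR≡ S)) , Sim-frame 2≤d ≤-refl S fr)
             (evalE e c≤d ok (agree S) be)

    evalC : ∀ {d B ρ s} (c : Cmd d) {Q : Pred} → 2 ≤ d → T (okC c) → Sim d σ ρ s → Below d ρ B → wp B c ρ Q s →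
            Eval (compileC c) σ (costC c B) (λ τ → ∃[ s′ ] (Q s′ × Sim d τ ρ s′))
    evalC {σ = σ} {d = d} {ρ = ρ} {s = s} (push e) {Q} 2≤d ok S be q =
      ev-seq (ev-map (λ {τ} (v , S′) → (λ ()) ▸ (λ ()) ▸ ev-instr (λ ())
          (store (ans s) (suc (top s)) (mem s [ top s ≔ ⟦ e ⟧ ρ (mem s) R ]) , q , stored τ v S′))
        (evalSim e 2≤d ≤-refl ok S be))
      where
      0≢d : 0 ≢ d
      0≢d refl = case2 2≤d
        where
        case2 : ¬ 2 ≤ 0
        case2 ()
      1≢d : 1 ≢ d
      1≢d refl = case2 2≤d
        where
        case2 : ¬ 2 ≤ 1
        case2 (s≤s ())
      stored : ∀ τ → regℕ τ d ≡ ⟦ e ⟧ ρ (mem s) R → Sim d τ ρ s →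
               Sim d (exec (addℕ 1 1 d) (exec (constℕ d 1) (exec (storeℕ 1 d) τ))) ρ
                   (store (ans s) (suc (top s)) (mem s [ top s ≔ ⟦ e ⟧ ρ (mem s) R ]))
      stored τ v (sim a b c r f) = sim
        (trans (upd-other (regℕ τ) d 0 λ x → 0≢d (sym x)) a)
        (trans (cong₂ _+_ (trans (upd-other (regℕ τ) d 1 λ x → 1≢d (sym x)) b) (upd-same (regℕ τ) d)) (+-comm (top s) 1))
        (trans (cong₂ (λ M x → M [ x ≔ regℕ τ d ]) c b) (cong (λ x → mem s [ top s ≔ x ]) v))
        r
        (λ x 2≤x x<d → trans (upd-other (regℕ τ [ d ≔ 1 ]) 1 x (λ { refl → <⇒≱ (s≤s (s≤s z≤n)) 2≤x }))
                         (trans (upd-other (regℕ τ) d x λ { refl → <-irrefl refl x<d }) (f x 2≤x x<d)))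
    evalC (c ⨟ c′) 2≤d ok S be q =
      ev-seq (ev-map (λ (_ , q′ , S′) → evalC c′ 2≤d (∧ʳ {okC c} ok) S′ be q′)
                     (evalC c 2≤d (∧ˡ ok) S be q))
    evalC {σ = σ} {d = d} {B = B} {ρ = ρ} {s = s} (for b c) {Q} 2≤d ok S be q =
      (λ ()) ▸ (λ ()) ▸ ev-weaken (+-monoˡ-≤ 1 (*-monoˡ-≤ _ bound)) (ev-map final
        (ev-while Inv n body exit
          (s , n , +-identityʳ n , q
          , Sim-frame 2≤d ≤-refl S (Frame-setℕ {a = 1 + d} (n≤1+n d) (Frame-setℕ {a = d} ≤-refl (Frame-refl {h = 0})))
          , trans (upd-other (regℕ (exec (constℕ d 0) σ)) (1 + d) d 1+n≢n) (upd-same (regℕ σ) d)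
          , upd-same (regℕ (exec (constℕ d 0) σ)) (1 + d))))
      where
      n = ρ b
      okb : T (okVar d b)
      okb = ∧ˡ ok
      bound : n ≤ B
      bound = be b (okVar-≥ {d} okb) (okVar-< {d} okb)
      W : ℕ → Pred → Pred
      W i = wp B c (ρ [ d ≔ i ])
      Inv : ℕ → State → Set
      Inv i τ = ∃[ s′ ] ∃[ r ] (r + i ≡ n × wpLoop W r i Q s′ × Sim d τ ρ s′ × regℕ τ d ≡ i × regℕ τ (1 + d) ≡ suc i)
      final : ∀ {τ} → Inv n τ → ∃[ s′ ] (Q s′ × Sim d τ ρ s′)
      final (s′ , zero , _ , w , S′ , _) = s′ , w , S′
      final (s′ , suc r , eq , _) = ⊥-elim (<-irrefl (sym eq) (s≤s (m≤n+m n r)))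
      reg-b : ∀ {τ s′} → Sim d τ ρ s′ → regℕ τ b ≡ n
      reg-b S′ = agree S′ b (okVar-≥ {d} okb) (okVar-< {d} okb)
      exit : ∀ {τ} → Inv n τ → test (leqℕ (1 + d) b) τ ≡ false
      exit (_ , _ , _ , _ , S′ , _ , j) = trans (cong₂ (λ u v → ⌊ u ℕ.≤? v ⌋) j (reg-b S′)) (trans (leq-≡ _ _) (leq-false (<⇒≱ ≤-refl)))
      body : ∀ {i τ} → i < n → Inv i τ → test (leqℕ (1 + d) b) τ ≡ true × Eval _ τ _ (Inv (suc i))
      body {i} i<n (s′ , zero , refl , _) = ⊥-elim (<-irrefl refl i<n)
      body {i} {τ} i<n (s′ , suc r , eq , w , S′ , vi , vj) =
          trans (cong₂ (λ u v → ⌊ u ℕ.≤? v ⌋) vj (reg-b S′)) (trans (leq-≡ _ _) (leq-true i<n))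
        , ev-seq (ev-map next (evalC c (m≤n⇒m≤1+n 2≤d) (∧ʳ {okVar d b} ok) (Sim-bind S′ vi)
                   (Below-bind (≤-trans (<⇒≤ i<n) bound) be) w))
        where
        next : ∀ {υ} → ∃[ s″ ] (wpLoop W r (suc i) Q s″ × Sim (suc d) υ (ρ [ d ≔ i ]) s″) → Eval _ υ 3 (Inv (suc i))
        next {υ} (s″ , w″ , S″) = (λ ()) ▸ (λ ()) ▸ ev-instr (λ ())
          ( s″ , r , trans (+-suc r i) eq , w″
          , Sim-frame 2≤d ≤-refl (Sim-unbind {ρ = ρ} S″)
              (Frame-setℕ {a = 1 + d} (n≤1+n d) (Frame-setℕ {a = d} ≤-refl (Frame-setℕ {a = 1 + d} (n≤1+n d) (Frame-refl {h = 0}))))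
          , trans (upd-other (regℕ υ₂) (1 + d) d 1+n≢n) idx
          , trans (upd-same (regℕ υ₂) (1 + d)) (trans (cong₂ _+_ idx one) (+-comm (suc i) 1)))
          where
          υ₁ υ₂ : State
          υ₁ = exec (constℕ (1 + d) 1) υ
          υ₂ = exec (addℕ d d (1 + d)) υ₁
          idx : regℕ υ₂ d ≡ suc i
          idx = trans (upd-same (regℕ υ₁) d) (trans (cong₂ _+_
                  (trans (upd-other (regℕ υ) (1 + d) d 1+n≢n) (trans (agree S″ d 2≤d ≤-refl) (upd-same ρ d)))
                  (upd-same (regℕ υ) (1 + d))) (+-comm i 1))
          one : regℕ υ₂ (1 + d) ≡ 1
          one = trans (upd-other (regℕ υ₁) d (1 + d) (λ e → 1+n≢n (sym e))) (upd-same (regℕ υ) (1 + d))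
    evalC {d = d} {ρ = ρ} (lett e c) 2≤d ok S be (v≤ , q) =
      ev-seq (ev-map (λ (v , S′) →
          ev-map (λ (s′ , q′ , S″) → s′ , q′ , Sim-unbind {ρ = ρ} S″)
            (evalC c (m≤n⇒m≤1+n 2≤d) (∧ʳ {okE d e} ok) (Sim-bind S′ v) (Below-bind v≤ be) q))
        (evalSim e 2≤d ≤-refl (∧ˡ ok) S be))
    evalC {σ = σ} {d = d} {ρ = ρ} {s = s} (lettop c) 2≤d ok S be (v≤ , q) =
      (λ ()) ▸ (λ ()) ▸ ev-map (λ (s′ , q′ , S″) → s′ , q′ , Sim-unbind {ρ = ρ} S″)
        (evalC c (m≤n⇒m≤1+n 2≤d) ok
           (Sim-bind (Sim-frame 2≤d ≤-refl S (Frame-setℕ {a = d} ≤-refl (Frame-setℕ {a = d} ≤-refl (Frame-refl {h = 0}))))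
             (trans (upd-same (regℕ (exec (constℕ d 0) σ)) d)
               (trans (cong₂ _+_ (trans (upd-other (regℕ σ) d 1 λ { refl → <-irrefl refl 2≤d }) (top≡ S)) (upd-same (regℕ σ) d))
                      (+-identityʳ (top s)))))
           (Below-bind v≤ be) q)
    evalC {σ = σ} {d = d} {B = B} {ρ = ρ} {s = s} (ifleq a b c e) {Q} 2≤d ok S be (qc , qe) =
      ev-seq (ev-map (λ {τ} (va , S₁) →
        ev-seq (ev-map (λ {υ} (vb , S₂) →
          let test≡ = trans (cong₂ (λ u v → ⌊ u ℕ.≤? v ⌋) (trans (agree S₂ d 2≤d ≤-refl) (upd-same ρ d)) vb) (leq-≡ _ _)
              S₃ = Sim-unbind {ρ = ρ} S₂ in
          ev-cond (λ t → evalC c 2≤d (∧ˡ oks) S₃ be (qc (leq-≤ (trans (sym test≡) t))))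
                  (λ t → evalC e 2≤d (∧ʳ {okC c} oks) S₃ be (qe (leq-≰ (trans (sym test≡) t)))))
        (evalSim b (m≤n⇒m≤1+n 2≤d) (n≤1+n d) (∧ˡ (∧ʳ {okE d a} ok)) (Sim-bind S₁ va) below)))
        (evalSim a 2≤d ≤-refl (∧ˡ ok) S be))
      where
      oks : T (okC c ∧ okC e)
      oks = ∧ʳ {okE d b} (∧ʳ {okE d a} ok)
      below : Below d (ρ [ d ≔ ⟦ a ⟧ ρ (mem s) R ]) B
      below x 2≤x x<d = ≤-trans (≤-reflexive (upd-other ρ d x λ { refl → <-irrefl refl x<d })) (be x 2≤x x<d)
    evalC nop 2≤d ok S be q = eval ⇓-skip z≤n (_ , q , S)
    evalC {σ = σ} {d = d} {ρ = ρ} (answer n) 2≤d ok (sim a b c e f) be q =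
      ev-instr (λ ()) (_ , q , sim refl b c e (λ x 2≤x x<d → trans (upd-other (regℕ σ) 0 x λ { refl → <⇒≱ (s≤s z≤n) 2≤x }) (f x 2≤x x<d)))
    evalC {σ = σ} reset 2≤d ok (sim a b c e f) be q =
      ev-instr (λ ()) (_ , q , sim a refl c e (λ x 2≤x x<d → trans (upd-other (regℕ σ) 1 x λ { refl → <⇒≱ (s≤s (s≤s z≤n)) 2≤x }) (f x 2≤x x<d)))

    wpLoop-inv : ∀ {W : ℕ → Pred → Pred} n (I : ℕ → Pred) {Q} →
      (∀ {j s Q′} → j < n → I j s → (∀ s′ → I (suc j) s′ → Q′ s′) → W j Q′ s) →
      (∀ s → I n s → Q s) → ∀ r j {s} → r + j ≡ n → I j s → wpLoop W r j Q s
    wpLoop-inv n I step done zero    j refl i = done _ i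
    wpLoop-inv n I step done (suc r) j refl i =
      step (s≤s (m≤n+m j r)) i λ s′ i′ → wpLoop-inv n I step done r (suc j) (+-suc r j) i′

    wp-for : ∀ {d B} b (c : Cmd (suc d)) ρ (I : ℕ → Pred) {s Q} →
      (∀ {j s Q′} → j < ρ b → I j s → (∀ s′ → I (suc j) s′ → Q′ s′) → wp B c (ρ [ d ≔ j ]) Q′ s) →
      I 0 s → (∀ s′ → I (ρ b) s′ → Q s′) → wp B (for b c) ρ Q s
    wp-for b c ρ I step start done = wpLoop-inv (ρ b) I step done (ρ b) 0 (+-identityʳ (ρ b)) start

    wp-row : ∀ {d B} b (e : Exp (suc d)) ρ {s Q} →
      (∀ s′ → Row s s′ (ρ b) (λ j M → ⟦ e ⟧ (ρ [ d ≔ j ]) M R) → Q s′) → wp B (for b (push e)) ρ Q s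
    wp-row {d} {B} b e ρ {s} done = wp-for {B = B} b (push e) ρ (λ j s′ → Row s s′ j E)
      (λ {j} {s′} j<n row k → k (store (ans s′) (suc (top s′)) (mem s′ [ top s′ ≔ E j (mem s′) ])) (next row))
      (record { extends = ⊑-refl ; length≡ = sym (+-identityʳ (top s)) ; cells = λ () }) done
      where
      E : ℕ → (ℕ → ℕ) → ℕ
      E j M = ⟦ e ⟧ (ρ [ d ≔ j ]) M R
      next : ∀ {s′ j} → Row s s′ j E → Row s (store (ans s′) (suc (top s′)) (mem s′ [ top s′ ≔ E j (mem s′) ])) (suc j) E
      next {s′} {j} row = record
        { extends = ⊑-trans (extends row) (grow (n≤1+n (top s′)) old)
        ; length≡ = trans (cong suc (length≡ row)) (sym (+-suc (top s) j))
        ; cells = new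
        }
        where
        old : ∀ a → a < top s′ → (mem s′ [ top s′ ≔ E j (mem s′) ]) a ≡ mem s′ a
        old a l = upd-other (mem s′) (top s′) a λ { refl → <-irrefl refl l }
        new : ∀ {i} → i < suc j → ∃[ M ] (∀ a → a < top s → M a ≡ mem s a) × (mem s′ [ top s′ ≔ E j (mem s′) ]) (top s + i) ≡ E i M
        new {i} l with ℕ._≟_ i j
        ... | yes refl = mem s′ , kept (extends row) ,
              trans (cong (mem s′ [ top s′ ≔ E j (mem s′) ]) (sym (length≡ row))) (upd-same (mem s′) (top s′))
        ... | no ne = let i<j = ≤∧≢⇒< (≤-pred l) ne
                          M , low , v = cells {s} {s′} {j} {E} row i<j
                      in M , low , trans (old (top s + i) (≤-trans (+-monoʳ-< (top s) i<j) (≤-reflexive (sym (length≡ row))))) v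

    -- The rule for nested loops that append: a pass adds `w` cells and establishes `G j`, and later
    -- passes preserve it because they only extend the memory.
    wp-collect : ∀ {d B} b (c : Cmd (suc d)) ρ w (G : ℕ → Pred) {s₀ Q} →
      (∀ {j s s′} → s ⊑ s′ → G j s → G j s′) →
      (∀ {j s Q′} → j < ρ b → s₀ ⊑ s → (∀ s′ → s ⊑ s′ → top s′ ≡ top s + w → G j s′ → Q′ s′) → wp B c (ρ [ d ≔ j ]) Q′ s) →
      (∀ s′ → s₀ ⊑ s′ → top s′ ≡ top s₀ + ρ b * w → (∀ {j} → j < ρ b → G j s′) → Q s′) → wp B (for b c) ρ Q s₀
    wp-collect b c ρ w G {s₀} mono step done =
      wp-for b c ρ (λ j s → s₀ ⊑ s × top s ≡ top s₀ + j * w × (∀ {i} → i < j → G i s))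
        (λ {j} j<n (ext , size , gs) k → step j<n ext λ s′ ext′ size′ g → k s′
          ( ⊑-trans ext ext′
          , trans size′ (trans (cong (_+ w) size) (trans (+-assoc (top s₀) (j * w) w) (cong (top s₀ +_) (+-comm (j * w) w))))
          , λ {i} l → collect gs ext′ g l))
        (⊑-refl , sym (+-identityʳ (top s₀)) , λ ())
        (λ s′ (ext , size , gs) → done s′ ext size gs)
      where
      collect : ∀ {i j s s′} → (∀ {i} → i < j → G i s) → s ⊑ s′ → G j s′ → i < suc j → G i s′
      collect {i} {j} gs ext g l with ℕ._≟_ i j
      ... | yes refl = g
      ... | no ne    = mono ext (gs (≤∧≢⇒< (≤-pred l) ne))

    wp-lett : ∀ {d B} (e : Exp d) (c : Cmd (suc d)) ρ {s Q} v → ⟦ e ⟧ ρ (mem s) R ≡ v → v ≤ B →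
              wp B c (ρ [ d ≔ v ]) Q s → wp B (lett e c) ρ Q s
    wp-lett e c ρ v refl v≤ w = v≤ , w

-- Finite sets of natural numbers

≢⇒<∨> : ∀ {i j} → i ≢ j → i < j ⊎ j < i
≢⇒<∨> {i} {j} ne with i ℕ.<? j
... | yes l = inj₁ l
... | no ¬l = inj₂ (≤∧≢⇒< (≮⇒≥ ¬l) λ e → ne (sym e))

sumTo : ℕ → (ℕ → ℕ) → ℕ
sumTo n f = foldn n (λ i a → a + f i) 0

sumTo-mono : ∀ n {f g} → (∀ {i} → i < n → f i ≤ g i) → sumTo n f ≤ sumTo n g
sumTo-mono zero    h = z≤n
sumTo-mono (suc n) h = +-mono-≤ (sumTo-mono n λ l → h (m≤n⇒m≤1+n l)) (h ≤-refl)

sumTo-cong : ∀ n {f g} → (∀ {i} → i < n → f i ≡ g i) → sumTo n f ≡ sumTo n g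
sumTo-cong zero    h = refl
sumTo-cong (suc n) h = cong₂ _+_ (sumTo-cong n λ l → h (m≤n⇒m≤1+n l)) (h ≤-refl)

+-interchange : ∀ a b c d → (a + b) + (c + d) ≡ (a + c) + (b + d)
+-interchange = solve-∀

sumTo-+ : ∀ n f g → sumTo n (λ i → f i + g i) ≡ sumTo n f + sumTo n g
sumTo-+ zero    f g = refl
sumTo-+ (suc n) f g = trans (cong (_+ (f n + g n)) (sumTo-+ n f g)) (+-interchange (sumTo n f) (sumTo n g) (f n) (g n))

sumTo-0 : ∀ n {f} → sumTo n f ≡ 0 → ∀ {i} → i < n → f i ≡ 0
sumTo-0 (suc n) {f} h {i} i<sn with ℕ._≟_ i n
... | yes refl = m+n≡0⇒n≡0 (sumTo n f) h
... | no ne    = sumTo-0 n (m+n≡0⇒m≡0 (sumTo n f) h) (≤∧≢⇒< (≤-pred i<sn) ne)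

sumTo-≡0 : ∀ n {f} → (∀ {i} → i < n → f i ≡ 0) → sumTo n f ≡ 0
sumTo-≡0 zero    h = refl
sumTo-≡0 (suc n) h = cong₂ _+_ (sumTo-≡0 n λ l → h (m≤n⇒m≤1+n l)) (h ≤-refl)

sumTo-const : ∀ n c → sumTo n (λ _ → c) ≡ n * c
sumTo-const zero    c = refl
sumTo-const (suc n) c = trans (cong (_+ c) (sumTo-const n c)) (+-comm (n * c) c)

yes! : ∀ {P : Set} (d : Dec P) → P → ⌊ d ⌋ ≡ true
yes! (yes _) p = refl
yes! (no ¬p) p = ⊥-elim (¬p p)

no! : ∀ {P : Set} (d : Dec P) → ¬ P → ⌊ d ⌋ ≡ false
no! (yes p) ¬p = ⊥-elim (¬p p)
no! (no _)  ¬p = refl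

from-yes! : ∀ {P : Set} (d : Dec P) → ⌊ d ⌋ ≡ true → P
from-yes! (yes p) _ = p

from-no! : ∀ {P : Set} (d : Dec P) → ⌊ d ⌋ ≡ false → ¬ P
from-no! (no ¬p) _ = ¬p

true-or-false : ∀ b → b ≡ true ⊎ b ≡ false
true-or-false true  = inj₁ refl
true-or-false false = inj₂ refl

true≢false : ∀ {b} → b ≡ true → ¬ b ≡ false
true≢false refl ()

∧-fst : ∀ {a b} → a ∧ b ≡ true → a ≡ true
∧-fst {true} _ = refl

∧-snd : ∀ {a b} → a ∧ b ≡ true → b ≡ true
∧-snd {true} e = e

∧-pair : ∀ {a b} → a ≡ true → b ≡ true → a ∧ b ≡ true
∧-pair refl refl = refl

∨-left : ∀ {a b} → a ≡ true → a ∨ b ≡ true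
∨-left refl = refl

∨-right : ∀ {a b} → b ≡ true → a ∨ b ≡ true
∨-right {true}  refl = refl
∨-right {false} refl = refl

∨-elim : ∀ {a b} {P : Set} → a ∨ b ≡ true → (a ≡ true → P) → (b ≡ true → P) → P
∨-elim {true}  e f g = f refl
∨-elim {false} e f g = g e

not-true : ∀ {b} → not b ≡ true → b ≡ false
not-true {false} _ = refl

not-false : ∀ {b} → b ≡ false → not b ≡ true
not-false refl = refl

-- A set of disk positions; only its elements below n matter.
Subset : Set
Subset = ℕ → Bool

infixr 6 _∪_
infixr 7 _∩_ _∖_

_∪_ _∩_ _∖_ : Subset → Subset → Subset
(A ∪ B) i = A i ∨ B i
(A ∩ B) i = A i ∧ B i
(A ∖ B) i = A i ∧ not (B i)

∅ : Subset
∅ _ = false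

⁅_⁆ : ℕ → Subset
⁅ x ⁆ i = ⌊ x ℕ.≟ i ⌋

⁅⁆-refl : ∀ x → ⁅ x ⁆ x ≡ true
⁅⁆-refl x = yes! (x ℕ.≟ x) refl

⁅⁆-≡ : ∀ {x i} → ⁅ x ⁆ i ≡ true → x ≡ i
⁅⁆-≡ {x} {i} = from-yes! (x ℕ.≟ i)

[_] : Bool → ℕ
[ true ]  = 1
[ false ] = 0

any : ℕ → Subset → Bool
any zero    A = false
any (suc n) A = A n ∨ any n A

any-witness : ∀ n {A} → any n A ≡ true → ∃[ i ] i < n × A i ≡ true
any-witness (suc n) {A} h with A n in eq
... | true = n , ≤-refl , eq
... | false with any-witness n h
...   | i , l , a = i , m≤n⇒m≤1+n l , a

any-intro : ∀ n {A i} → i < n → A i ≡ true → any n A ≡ true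
any-intro (suc n) {A} {i} i<sn a with ℕ._≟_ i n
... | yes refl = ∨-left a
... | no ne    = ∨-right {A n} (any-intro n (≤∧≢⇒< (≤-pred i<sn) ne) a)

module Counting (n : ℕ) where

  ♯ : Subset → ℕ
  ♯ A = sumTo n (λ i → [ A i ])

  infix 4 _⊆_

  _⊆_ : Subset → Subset → Set
  A ⊆ B = ∀ {i} → i < n → A i ≡ true → B i ≡ true

  []-mono : ∀ {a b} → (a ≡ true → b ≡ true) → [ a ] ≤ [ b ]
  []-mono {true}  h with refl ← h refl = ≤-refl
  []-mono {false} h = z≤n

  ♯-mono : ∀ {A B} → A ⊆ B → ♯ A ≤ ♯ B
  ♯-mono h = sumTo-mono n λ l → []-mono (h l)

  ♯-cong : ∀ {A B} → A ⊆ B → B ⊆ A → ♯ A ≡ ♯ B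
  ♯-cong h k = ≤-antisym (♯-mono h) (♯-mono k)

  ♯-split : ∀ A B → ♯ A ≡ ♯ (A ∩ B) + ♯ (A ∖ B)
  ♯-split A B = trans (sumTo-cong n λ {i} _ → cell (A i) (B i)) (sumTo-+ n _ _)
    where
    cell : ∀ a b → [ a ] ≡ [ a ∧ b ] + [ a ∧ not b ]
    cell true  true  = refl
    cell true  false = refl
    cell false _     = refl

  ♯-∪ : ∀ {A B} → (∀ {i} → i < n → A i ≡ true → B i ≡ false) → ♯ (A ∪ B) ≡ ♯ A + ♯ B
  ♯-∪ {A} {B} dis = trans (sumTo-cong n λ {i} l → cell (A i) (B i) (dis l)) (sumTo-+ n _ _)
    where
    cell : ∀ a b → (a ≡ true → b ≡ false) → [ a ∨ b ] ≡ [ a ] + [ b ]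
    cell true  b d with refl ← d refl = refl
    cell false b d = refl

  ♯-≡0 : ∀ {A} → (∀ {i} → i < n → A i ≡ false) → ♯ A ≡ 0
  ♯-≡0 h = sumTo-≡0 n λ l → cong [_] (h l)

  ♯-witness : ∀ {A} → 1 ≤ ♯ A → ∃[ i ] i < n × A i ≡ true
  ♯-witness {A} h with any n A in eq
  ... | true  = any-witness n eq
  ... | false = ⊥-elim (<-irrefl (sym (♯-≡0 empty)) h)
    where
    empty : ∀ {i} → i < n → A i ≡ false
    empty {i} l with A i in eq′
    ... | false = refl
    ... | true with () ← trans (sym eq) (any-intro n l eq′)

  ♯-⁅⁆ : ∀ {x} → x < n → ♯ ⁅ x ⁆ ≡ 1
  ♯-⁅⁆ {x} x<n = go n x<n
    where
    below : ∀ m → m ≤ x → sumTo m (λ i → [ ⁅ x ⁆ i ]) ≡ 0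
    below m m≤x = sumTo-≡0 m λ {i} l → cong [_] (no! (x ℕ.≟ i) λ { refl → <⇒≱ l m≤x })
    go : ∀ m → x < m → sumTo m (λ i → [ ⁅ x ⁆ i ]) ≡ 1
    go (suc m) l with x ℕ.≟ m
    ... | yes refl = cong (_+ 1) (below m ≤-refl)
    ... | no ne    = trans (+-identityʳ _) (go m (≤∧≢⇒< (≤-pred l) ne))

  ♯-remove : ∀ {A x} → x < n → A x ≡ true → ♯ A ≡ suc (♯ (A ∖ ⁅ x ⁆))
  ♯-remove {A} {x} x<n a = trans (♯-split A ⁅ x ⁆) (cong (_+ ♯ (A ∖ ⁅ x ⁆))
    (trans (♯-cong (λ _ e → ∧-snd {A _} e) (λ _ e → ∧-pair (subst (λ i → A i ≡ true) (⁅⁆-≡ e) a) e)) (♯-⁅⁆ x<n)))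

  ♯-≤1 : ∀ {A} → (∀ {i j} → i < n → j < n → A i ≡ true → A j ≡ true → i ≡ j) → ♯ A ≤ 1
  ♯-≤1 {A} h with any n A in eq
  ... | true with any-witness n eq
  ...   | i , l , a = ≤-trans (♯-mono λ l′ a′ → yes! (i ℕ.≟ _) (h l l′ a a′)) (≤-reflexive (♯-⁅⁆ l))
  ♯-≤1 {A} h | false = ≤-trans (≤-reflexive (♯-≡0 empty)) z≤n
    where
    empty : ∀ {i} → i < n → A i ≡ false
    empty {i} l with A i in eq′
    ... | false = refl
    ... | true with () ← trans (sym eq) (any-intro n l eq′)

  -- Pigeonhole. Nested applications count by several coordinates: the cells of a grid in `crowd`,
  -- the slots along a boundary in `packing`.
  ♯-classes : ∀ {A c} Q (f : ℕ → ℕ) → (∀ {i} → i < n → A i ≡ true → f i < Q) →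
              (∀ {q} → q < Q → ♯ (A ∩ (λ i → ⌊ f i ℕ.≟ q ⌋)) ≤ c) → ♯ A ≤ Q * c
  ♯-classes {A} {c} zero    f lt h = ≤-reflexive (♯-≡0 empty)
    where
    empty : ∀ {i} → i < n → A i ≡ false
    empty {i} l with A i in eq
    ... | false = refl
    ... | true with () ← lt l eq
  ♯-classes {A} {c} (suc Q) f lt h = begin
    ♯ A                                       ≡⟨ ♯-split A _ ⟩
    ♯ (A ∩ last) + ♯ (A ∖ last)               ≤⟨ +-mono-≤ (h ≤-refl) (♯-classes Q f below inner) ⟩
    c + Q * c                                 ∎
    where
    open ≤-Reasoning
    last : Subset
    last i = ⌊ f i ℕ.≟ Q ⌋
    below : ∀ {i} → i < n → (A ∖ last) i ≡ true → f i < Q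
    below {i} l a = ≤∧≢⇒< (≤-pred (lt l (∧-fst a))) (from-no! (f i ℕ.≟ Q) (not-true (∧-snd {A i} a)))
    inner : ∀ {q} → q < Q → ♯ ((A ∖ last) ∩ (λ i → ⌊ f i ℕ.≟ q ⌋)) ≤ c
    inner l = ≤-trans (♯-mono λ {i} _ a → ∧-pair (∧-fst {A i} (∧-fst {A i ∧ not (last i)} a)) (∧-snd {A i ∧ not (last i)} a))
                      (h (m≤n⇒m≤1+n l))

  ♯-disjoint-family : ∀ {A c} J (S : ℕ → Subset) → (∀ {q} → q < J → S q ⊆ A) →
    (∀ {q q′ i} → q < q′ → q′ < J → i < n → S q i ≡ true → S q′ i ≡ false) →
    (∀ {q} → q < J → c ≤ ♯ (S q)) → J * c ≤ ♯ A
  ♯-disjoint-family zero    S sub dis h = z≤n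
  ♯-disjoint-family {A} {c} (suc J) S sub dis h = begin
    c + J * c                      ≤⟨ +-mono-≤ (h ≤-refl) (♯-disjoint-family J S sub′ (λ l l′ → dis l (m≤n⇒m≤1+n l′)) λ l → h (m≤n⇒m≤1+n l)) ⟩
    ♯ (S J) + ♯ (A ∖ S J)          ≤⟨ +-monoˡ-≤ _ (♯-mono λ l s → ∧-pair (sub ≤-refl l s) s) ⟩
    ♯ (A ∩ S J) + ♯ (A ∖ S J)      ≡⟨ ♯-split A (S J) ⟨
    ♯ A                            ∎
    where
    open ≤-Reasoning
    sub′ : ∀ {q} → q < J → S q ⊆ A ∖ S J
    sub′ l i<n s = ∧-pair (sub (m≤n⇒m≤1+n l) i<n s) (not-false (dis l ≤-refl i<n s))

  below-suc : ∀ {P : ℕ → Set} {m} → (∀ {i} → i < m → P i) → P m → ∀ {i} → i < suc m → P i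
  below-suc {m = m} h p {i} l with ℕ._≟_ i m
  ... | yes refl = p
  ... | no ne    = h (≤∧≢⇒< (≤-pred l) ne)

  module _ {_≲_ : ℕ → ℕ → Set} (tr : ∀ {i j k} → i ≲ j → j ≲ k → i ≲ k) (to : ∀ i j → i ≲ j ⊎ j ≲ i) where

    ≲-refl : ∀ i → i ≲ i
    ≲-refl i with to i i
    ... | inj₁ p = p
    ... | inj₂ p = p

    greatest-below : ∀ (A : Subset) m → m ≤ n →
      (∀ {i} → i < m → A i ≡ false) ⊎ ∃[ l ] l < n × A l ≡ true × (∀ {i} → i < m → A i ≡ true → i ≲ l)
    greatest-below A zero    _ = inj₁ λ ()
    greatest-below A (suc m) m<n with true-or-false (A m) | greatest-below A m (<⇒≤ m<n)
    ... | inj₂ am | inj₁ h = inj₁ (below-suc h am)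
    ... | inj₂ am | inj₂ (k , k<n , ak , h) =
      inj₂ (k , k<n , ak , below-suc {λ i → A i ≡ true → i ≲ k} h λ a → ⊥-elim (true≢false a am))
    ... | inj₁ am | inj₁ h =
      inj₂ (m , m<n , am , below-suc {λ i → A i ≡ true → i ≲ m} (λ l a → ⊥-elim (true≢false a (h l))) λ _ → ≲-refl m)
    ... | inj₁ am | inj₂ (k , k<n , ak , h) with to k m
    ...   | inj₁ k≲m = inj₂ (m , m<n , am , below-suc {λ i → A i ≡ true → i ≲ m} (λ l a → tr (h l a) k≲m) λ _ → ≲-refl m)
    ...   | inj₂ m≲k = inj₂ (k , k<n , ak , below-suc {λ i → A i ≡ true → i ≲ k} h λ _ → m≲k)

    -- The order is a parameter so that one search yields the farthest centre, the nearest one and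
    -- the outermost disk.
    greatest : ∀ (A : Subset) {x} → x < n → A x ≡ true → ∃[ l ] l < n × A l ≡ true × (∀ {i} → i < n → A i ≡ true → i ≲ l)
    greatest A x<n a with greatest-below A n ≤-refl
    ... | inj₁ h = ⊥-elim (true≢false a (h x<n))
    ... | inj₂ r = r

-- Ordered fields

-- Gives the ring solver coefficients in `ℤ`, whose equality is decided by computation, so that
-- numerical constants cancel in an abstract ring.
module IntegerCoefficients (R : CommutativeRing 0ℓ 0ℓ) where
  private module F = CommutativeRing R
  open F using (Carrier; _≈_; 0#; 1#; semiring; setoid; reflexive; -‿inverseʳ; -‿cong)
    renaming (refl to ≈-refl; sym to ≈-sym; trans to ≈-trans; _+_ to _⊕_; _*_ to _⊗_; -_ to ⊝_)
  open Algebra.Properties.Ring F.ring using (-0#≈0#; -‿involutive; -‿+-comm; -‿distribˡ-*; -‿distribʳ-*)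
  open Algebra.Properties.Semiring.Mult.TCOptimised semiring using (1+×; ×-homo-+; ×1-homo-*) renaming (_×_ to _·_)
  open Relation.Binary.Reasoning.Setoid setoid

  fromℤ : ℤ → Carrier
  fromℤ (ℤ.+ n)    = n · 1#
  fromℤ -[1+ n ] = ⊝ (suc n · 1#)

  fromℤ-neg : ∀ i → fromℤ (ℤ.- i) ≈ ⊝ fromℤ i
  fromℤ-neg (ℤ.+ zero)  = ≈-sym -0#≈0#
  fromℤ-neg (ℤ.+ suc n) = ≈-refl
  fromℤ-neg -[1+ n ]  = ≈-sym (-‿involutive _)

  fromℤ-⊖ : ∀ m n → fromℤ (m ℤ.⊖ n) ≈ m · 1# ⊕ ⊝ (n · 1#)
  fromℤ-⊖ m       zero    = ≈-sym (≈-trans (F.+-congˡ -0#≈0#) (F.+-identityʳ _))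
  fromℤ-⊖ zero    (suc n) = ≈-sym (F.+-identityˡ _)
  fromℤ-⊖ (suc m) (suc n) = begin
    fromℤ (suc m ℤ.⊖ suc n)                 ≡⟨ cong fromℤ (ℤ.[1+m]⊖[1+n]≡m⊖n m n) ⟩
    fromℤ (m ℤ.⊖ n)                         ≈⟨ fromℤ-⊖ m n ⟩
    x ⊕ ⊝ y                                 ≈⟨ F.+-congʳ (F.+-identityˡ x) ⟨
    (0# ⊕ x) ⊕ ⊝ y                          ≈⟨ F.+-congʳ (F.+-congʳ (-‿inverseʳ 1#)) ⟨
    ((1# ⊕ ⊝ 1#) ⊕ x) ⊕ ⊝ y                 ≈⟨ F.+-congʳ (F.+-assoc 1# (⊝ 1#) x) ⟩
    (1# ⊕ (⊝ 1# ⊕ x)) ⊕ ⊝ y                 ≈⟨ F.+-congʳ (F.+-congˡ (F.+-comm (⊝ 1#) x)) ⟩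
    (1# ⊕ (x ⊕ ⊝ 1#)) ⊕ ⊝ y                 ≈⟨ F.+-congʳ (F.+-assoc 1# x (⊝ 1#)) ⟨
    ((1# ⊕ x) ⊕ ⊝ 1#) ⊕ ⊝ y                 ≈⟨ F.+-assoc (1# ⊕ x) (⊝ 1#) (⊝ y) ⟩
    (1# ⊕ x) ⊕ (⊝ 1# ⊕ ⊝ y)                 ≈⟨ F.+-congˡ (-‿+-comm 1# y) ⟩
    (1# ⊕ x) ⊕ ⊝ (1# ⊕ y)                   ≈⟨ F.+-cong (1+× m 1#) (-‿cong (1+× n 1#)) ⟨
    suc m · 1# ⊕ ⊝ (suc n · 1#)             ∎
    where
    x y : Carrier
    x = m · 1#
    y = n · 1#

  fromℤ-+ : ∀ i j → fromℤ (i ℤ.+ j) ≈ fromℤ i ⊕ fromℤ j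
  fromℤ-+ (ℤ.+ m)    (ℤ.+ n)    = ×-homo-+ 1# m n
  fromℤ-+ (ℤ.+ m)    -[1+ n ] = fromℤ-⊖ m (suc n)
  fromℤ-+ -[1+ m ] (ℤ.+ n)    = ≈-trans (fromℤ-⊖ n (suc m)) (F.+-comm _ _)
  fromℤ-+ -[1+ m ] -[1+ n ] = begin
    ⊝ (suc (suc (m + n)) · 1#)              ≡⟨ cong (λ k → ⊝ (k · 1#)) (+-suc (suc m) n) ⟨
    ⊝ ((suc m + suc n) · 1#)                ≈⟨ -‿cong (×-homo-+ 1# (suc m) (suc n)) ⟩
    ⊝ (suc m · 1# ⊕ suc n · 1#)             ≈⟨ -‿+-comm _ _ ⟨
    ⊝ (suc m · 1#) ⊕ ⊝ (suc n · 1#)         ∎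

  fromℤ-* : ∀ i j → fromℤ (i ℤ.* j) ≈ fromℤ i ⊗ fromℤ j
  fromℤ-* (ℤ.+ m)    (ℤ.+ n)    = ≈-trans (reflexive (cong fromℤ (sym (ℤ.pos-* m n)))) (×1-homo-* m n)
  fromℤ-* (ℤ.+ m)    -[1+ n ] = begin
    fromℤ (ℤ.+ m ℤ.* -[1+ n ])                ≡⟨ cong fromℤ (ℤ.neg-distribʳ-* (ℤ.+ m) (ℤ.+ suc n)) ⟨
    fromℤ (ℤ.- (ℤ.+ m ℤ.* ℤ.+ suc n))           ≈⟨ fromℤ-neg (ℤ.+ m ℤ.* ℤ.+ suc n) ⟩
    ⊝ fromℤ (ℤ.+ m ℤ.* ℤ.+ suc n)               ≈⟨ -‿cong (fromℤ-* (ℤ.+ m) (ℤ.+ suc n)) ⟩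
    ⊝ (m · 1# ⊗ suc n · 1#)                 ≈⟨ -‿distribʳ-* _ _ ⟩
    m · 1# ⊗ ⊝ (suc n · 1#)                 ∎
  fromℤ-* -[1+ m ] (ℤ.+ n)    = begin
    fromℤ (-[1+ m ] ℤ.* ℤ.+ n)                ≡⟨ cong fromℤ (ℤ.neg-distribˡ-* (ℤ.+ suc m) (ℤ.+ n)) ⟨
    fromℤ (ℤ.- (ℤ.+ suc m ℤ.* ℤ.+ n))           ≈⟨ fromℤ-neg (ℤ.+ suc m ℤ.* ℤ.+ n) ⟩
    ⊝ fromℤ (ℤ.+ suc m ℤ.* ℤ.+ n)               ≈⟨ -‿cong (fromℤ-* (ℤ.+ suc m) (ℤ.+ n)) ⟩
    ⊝ (suc m · 1# ⊗ n · 1#)                 ≈⟨ -‿distribˡ-* _ _ ⟩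
    ⊝ (suc m · 1#) ⊗ n · 1#                 ∎
  fromℤ-* -[1+ m ] -[1+ n ] = begin
    fromℤ (ℤ.+ suc m ℤ.* ℤ.+ suc n)             ≈⟨ fromℤ-* (ℤ.+ suc m) (ℤ.+ suc n) ⟩
    suc m · 1# ⊗ suc n · 1#                 ≈⟨ -‿involutive _ ⟨
    ⊝ ⊝ (suc m · 1# ⊗ suc n · 1#)           ≈⟨ -‿cong (-‿distribˡ-* _ _) ⟩
    ⊝ (⊝ (suc m · 1#) ⊗ suc n · 1#)         ≈⟨ -‿distribʳ-* _ _ ⟩
    ⊝ (suc m · 1#) ⊗ ⊝ (suc n · 1#)         ∎

  ℤ-rawRing : RawRing _ _
  ℤ-rawRing = record
    { Carrier = ℤ ; _≈_ = _≡_ ; _+_ = ℤ._+_ ; _*_ = ℤ._*_ ; -_ = ℤ.-_ ; 0# = ℤ.+ 0 ; 1# = ℤ.+ 1 }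

  homomorphism : ℤ-rawRing -Raw-AlmostCommutative⟶ fromCommutativeRing R
  homomorphism = record
    { ⟦_⟧ = fromℤ ; +-homo = fromℤ-+ ; *-homo = fromℤ-* ; -‿homo = fromℤ-neg ; 0-homo = ≈-refl ; 1-homo = ≈-refl }

  coefficient≟ : ∀ i j → Maybe (fromℤ i ≈ fromℤ j)
  coefficient≟ i j with i ℤ.≟ j
  ... | yes i≡j = just (reflexive (cong fromℤ i≡j))
  ... | no _    = nothing

  open Algebra.Solver.Ring ℤ-rawRing (fromCommutativeRing R) homomorphism coefficient≟ public
    using (solve; _:=_; _:+_; _:*_; _:-_; :-_; con)

module OrderedField (ℝ : RealNumbers) where
  private module F = RealNumbers ℝ
  open F public using (Carrier; _≈_; 0#; 1#; setoid; _⁻¹; ⁻¹-inverseʳ)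
    renaming (refl to ≈-refl; sym to ≈-sym; trans to ≈-trans; reflexive to ≈-reflexive;
              _+_ to _⊕_; _*_ to _⊗_; -_ to ⊝_; _-_ to _⊖_; _≤_ to _≼_; _≤?_ to _≼?_;
              *-nonNegative to ⊗-nonNegative)
  open IsDecTotalOrder F.isDecTotalOrder public using ()
    renaming (refl to ≼-refl; trans to ≼-trans; antisym to ≼-antisym; total to ≼-total; reflexive to ≼-reflexive)
  open IntegerCoefficients F.commutativeRing public using (solve; _:=_; _:+_; _:*_; _:-_; :-_; con)

  infix 4 _≺_

  _≺_ : Carrier → Carrier → Set
  x ≺ y = ¬ y ≼ x

  ≼-respˡ : ∀ {x y z} → x ≈ y → x ≼ z → y ≼ z
  ≼-respˡ e h = ≼-trans (≼-reflexive (≈-sym e)) h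

  ≼-respʳ : ∀ {x y z} → y ≈ z → x ≼ y → x ≼ z
  ≼-respʳ e h = ≼-trans h (≼-reflexive e)

  ≺⇒≼ : ∀ {x y} → x ≺ y → x ≼ y
  ≺⇒≼ {x} {y} h = [ (λ l → l) , (λ l → ⊥-elim (h l)) ]′ (≼-total x y)

  ≺-≼-trans : ∀ {x y z} → x ≺ y → y ≼ z → x ≺ z
  ≺-≼-trans h l k = h (≼-trans l k)

  ≼-≺-trans : ∀ {x y z} → x ≼ y → y ≺ z → x ≺ z
  ≼-≺-trans l h k = h (≼-trans k l)

  ≼∨≺ : ∀ x y → x ≼ y ⊎ y ≺ x
  ≼∨≺ x y with x ≼? y
  ... | yes l = inj₁ l
  ... | no h  = inj₂ h

  diff≽0 : ∀ {x y} → x ≼ y → 0# ≼ y ⊖ x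
  diff≽0 {x} {y} h = ≼-respˡ (F.-‿inverseʳ x) (F.+-monoˡ-≤ (⊝ x) h)

  by-diff : ∀ {x y d} → 0# ≼ d → d ≈ y ⊖ x → x ≼ y
  by-diff {x} {y} {d} h e =
    ≼-respˡ (F.+-identityˡ x) (≼-respʳ (solve 2 (λ x y → (y :- x) :+ x := y) ≈-refl x y) (F.+-monoˡ-≤ x (≼-respʳ e h)))

  0≼+ : ∀ {x y} → 0# ≼ x → 0# ≼ y → 0# ≼ x ⊕ y
  0≼+ {x} {y} h k = ≼-trans k (≼-respˡ (F.+-identityˡ y) (F.+-monoˡ-≤ y h))

  0≼sq : ∀ x → 0# ≼ x ⊗ x
  0≼sq x with ≼-total 0# x
  ... | inj₁ h = ⊗-nonNegative h h
  ... | inj₂ h = ≼-respʳ (solve 1 (λ x → (con (ℤ.+ 0) :- x) :* (con (ℤ.+ 0) :- x) := x :* x) ≈-refl x)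
                         (⊗-nonNegative (diff≽0 h) (diff≽0 h))

  0≼1 : 0# ≼ 1#
  0≼1 = ≼-respʳ (F.*-identityˡ 1#) (0≼sq 1#)

  0≺1 : 0# ≺ 1#
  0≺1 h = F.0≉1 (≼-antisym 0≼1 h)

  ⊕-mono : ∀ {x y z w} → x ≼ y → z ≼ w → x ⊕ z ≼ y ⊕ w
  ⊕-mono {x} {y} {z} {w} h k = by-diff (0≼+ (diff≽0 h) (diff≽0 k))
    (solve 4 (λ x y z w → (y :- x) :+ (w :- z) := (y :+ w) :- (x :+ z)) ≈-refl x y z w)

  ⊗-monoˡ : ∀ {x y z} → 0# ≼ z → x ≼ y → z ⊗ x ≼ z ⊗ y
  ⊗-monoˡ {x} {y} {z} hz h = by-diff (⊗-nonNegative hz (diff≽0 h))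
    (solve 3 (λ x y z → z :* (y :- x) := z :* y :- z :* x) ≈-refl x y z)

  0≺⇒≉0 : ∀ {x} → 0# ≺ x → ¬ x ≈ 0#
  0≺⇒≉0 h e = h (≼-reflexive e)

  0≺* : ∀ {x y} → 0# ≺ x → 0# ≺ y → 0# ≺ x ⊗ y
  0≺* {x} {y} hx hy h = 0≺⇒≉0 hx (begin
    x                  ≈⟨ F.*-identityʳ x ⟨
    x ⊗ 1#             ≈⟨ F.*-congˡ (⁻¹-inverseʳ y (0≺⇒≉0 hy)) ⟨
    x ⊗ (y ⊗ y ⁻¹)     ≈⟨ F.*-assoc x y (y ⁻¹) ⟨
    (x ⊗ y) ⊗ y ⁻¹     ≈⟨ F.*-congʳ (≼-antisym h (⊗-nonNegative (≺⇒≼ hx) (≺⇒≼ hy))) ⟩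
    0# ⊗ y ⁻¹          ≈⟨ F.zeroˡ (y ⁻¹) ⟩
    0#                 ∎)
    where open Relation.Binary.Reasoning.Setoid setoid

  0≺+ : ∀ {x y} → 0# ≺ x → 0# ≼ y → 0# ≺ x ⊕ y
  0≺+ {x} {y} hx hy h = hx (≼-trans (by-diff hy (solve 2 (λ x y → y := (x :+ y) :- x) ≈-refl x y)) h)

  ≺-diff : ∀ {x y} → x ≺ y → 0# ≺ y ⊖ x
  ≺-diff {x} {y} h k = h (by-diff (diff≽0 k) (solve 2 (λ x y → con (ℤ.+ 0) :- (y :- x) := x :- y) ≈-refl x y))

  by-diff≺ : ∀ {x y d} → 0# ≺ d → d ≈ y ⊖ x → x ≺ y
  by-diff≺ {x} {y} h e k = h (≼-respˡ (≈-sym e) (by-diff (diff≽0 k) (solve 2 (λ x y → x :- y := con (ℤ.+ 0) :- (y :- x)) ≈-refl x y)))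

  ⊗-cancelˡ : ∀ {x y z} → 0# ≺ z → z ⊗ x ≼ z ⊗ y → x ≼ y
  ⊗-cancelˡ {x} {y} {z} hz h with ≼∨≺ x y
  ... | inj₁ l = l
  ... | inj₂ g = ⊥-elim (0≺* hz (≺-diff g)
    (by-diff (diff≽0 h) (solve 3 (λ x y z → z :* y :- z :* x := con (ℤ.+ 0) :- z :* (x :- y)) ≈-refl x y z)))

  0≺⁻¹ : ∀ {x} → 0# ≺ x → 0# ≺ x ⁻¹
  0≺⁻¹ {x} h k = 0≺1 (≼-respˡ (⁻¹-inverseʳ x (0≺⇒≉0 h)) (≼-respʳ (F.zeroʳ x) (⊗-monoˡ (≺⇒≼ h) k)))

  sq-≼ : ∀ {x r} → 0# ≼ r → x ⊗ x ≼ r ⊗ r → x ≼ r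
  sq-≼ {x} {r} hr h with ≼∨≺ x r
  ... | inj₁ l = l
  ... | inj₂ g = ⊥-elim (0≺* (≺-diff g) 0≺sum (by-diff (diff≽0 h)
    (solve 2 (λ x r → r :* r :- x :* x := con (ℤ.+ 0) :- (x :- r) :* (x :+ r)) ≈-refl x r)))
    where
    0≺sum : 0# ≺ x ⊕ r
    0≺sum = 0≺+ (≼-≺-trans hr g) hr

  maxr : Carrier → Carrier → Carrier
  maxr a b = if ⌊ a ≼? b ⌋ then b else a

  maxr-≽ˡ : ∀ a b → a ≼ maxr a b
  maxr-≽ˡ a b with a ≼? b
  ... | yes h = h
  ... | no h  = ≼-refl

  maxr-≽ʳ : ∀ a b → b ≼ maxr a b
  maxr-≽ʳ a b with a ≼? b
  ... | yes h = ≼-refl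
  ... | no h  = ≺⇒≼ h

  maxr-lub : ∀ {a b c} → a ≼ c → b ≼ c → maxr a b ≼ c
  maxr-lub {a} {b} h k with a ≼? b
  ... | yes _ = k
  ... | no _  = h

  infixr 7 _·_

  _·_ : ℕ → Carrier → Carrier
  zero  · x = 0#
  suc n · x = n · x ⊕ x

  0≼· : ∀ n {x} → 0# ≼ x → 0# ≼ n · x
  0≼· zero    h = ≼-refl
  0≼· (suc n) h = 0≼+ (0≼· n h) h

  ·-mono : ∀ {m n x} → 0# ≼ x → m ≤ n → m · x ≼ n · x
  ·-mono {n = n} h z≤n = 0≼· n h
  ·-mono h (s≤s l) = ⊕-mono (·-mono h l) ≼-refl

  ·-⊗ : ∀ n x y → n · (x ⊗ y) ≈ (n · x) ⊗ y
  ·-⊗ zero    x y = ≈-sym (F.zeroˡ y)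
  ·-⊗ (suc n) x y = ≈-trans (F.+-congʳ (·-⊗ n x y)) (≈-sym (F.distribʳ y (n · x) x))

  ·-+ : ∀ m n x → (m + n) · x ≈ m · x ⊕ n · x
  ·-+ zero    n x = ≈-sym (F.+-identityˡ _)
  ·-+ (suc m) n x = ≈-trans (F.+-congʳ (·-+ m n x))
    (solve 3 (λ a b x → (a :+ b) :+ x := (a :+ x) :+ b) ≈-refl (m · x) (n · x) x)

  divide : ∀ n {x} → 0# ≺ x → ∃[ d ] 0# ≺ d × suc n · d ≈ x
  divide n {x} h = (N ⁻¹ ⊗ x) , 0≺* (0≺⁻¹ 0≺N) h , ≈-trans (·-⊗ (suc n) (N ⁻¹) x)
      (≈-trans (F.*-congʳ (≈-trans (scale (suc n) (N ⁻¹)) (⁻¹-inverseʳ N (0≺⇒≉0 0≺N)))) (F.*-identityˡ x))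
    where
    N : Carrier
    N = suc n · 1#
    0≺N : 0# ≺ N
    0≺N = ≺-≼-trans 0≺1 (by-diff (0≼· n 0≼1) (solve 2 (λ a b → a := (a :+ b) :- b) ≈-refl (n · 1#) 1#))
    scale : ∀ n y → n · y ≈ (n · 1#) ⊗ y
    scale n y = ≈-trans (·-cong n (≈-sym (F.*-identityˡ y))) (·-⊗ n 1# y)
      where
      ·-cong : ∀ n {x y} → x ≈ y → n · x ≈ n · y
      ·-cong zero    e = ≈-refl
      ·-cong (suc n) e = F.+-cong (·-cong n e) e

  -- The floor of `v / d`, capped by the bound and found by comparisons from the top. Cells are
  -- closed on both sides, so the right end of the range needs no cell of its own.
  cell : ℕ → Carrier → Carrier → ℕ
  cell zero    d v = 0
  cell (suc n) d v = if ⌊ n · d ≼? v ⌋ then n else cell n d v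

  InCell : ℕ → Carrier → Carrier → Set
  InCell q d v = q · d ≼ v × v ≼ suc q · d

  cell-spec : ∀ n {d v} → 0# ≼ v → v ≼ suc n · d → cell (suc n) d v < suc n × InCell (cell (suc n) d v) d v
  cell-spec zero {d} {v} h k with 0# ≼? v
  ... | yes h′ = s≤s z≤n , h′ , k
  ... | no h′  = ⊥-elim (h′ h)
  cell-spec (suc n) {d} {v} h k with suc n · d ≼? v
  ... | yes h′ = ≤-refl , h′ , k
  ... | no h′ with cell-spec n h (≺⇒≼ h′)
  ...   | l , c = m≤n⇒m≤1+n l , c

  cell-close : ∀ {q d v w} → InCell q d v → InCell q d w → v ⊖ w ≼ d
  cell-close {q} {d} {v} {w} (_ , v≤) (≤w , _) = by-diff (0≼+ (diff≽0 v≤) (diff≽0 ≤w))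
    (solve 4 (λ a d v w → ((a :+ d) :- v) :+ (w :- a) := d :- (v :- w)) ≈-refl (q · d) d v w)

-- Disks in the plane

module PlaneGeometry (ℝ : RealNumbers) where
  private module F = RealNumbers ℝ
  open OrderedField ℝ

  sq : Carrier → Carrier
  sq x = x ⊗ x

  sq-cong : ∀ {x y} → x ≈ y → sq x ≈ sq y
  sq-cong e = F.*-cong e e

  InDisk : (cx cy r px py : Carrier) → Set
  InDisk cx cy r px py = sq (px ⊖ cx) ⊕ sq (py ⊖ cy) ≼ sq r

  InDisk-cong : ∀ {cx cy r px py qx qy} → px ≈ qx → py ≈ qy → InDisk cx cy r px py → InDisk cx cy r qx qy
  InDisk-cong e f = ≼-respˡ (F.+-cong (sq-cong (F.+-congʳ e)) (sq-cong (F.+-congʳ f)))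

  AbsLe : Carrier → Carrier → Set
  AbsLe R u = u ≼ R × ⊝ u ≼ R

  AbsLe-cong : ∀ {R u v} → u ≈ v → AbsLe R u → AbsLe R v
  AbsLe-cong e (h , k) = ≼-respˡ e h , ≼-respˡ (F.-‿cong e) k

  AbsLe-mono : ∀ {R R′ u} → R ≼ R′ → AbsLe R u → AbsLe R′ u
  AbsLe-mono l (h , k) = ≼-trans h l , ≼-trans k l

  AbsLe-neg : ∀ {R u} → AbsLe R u → AbsLe R (⊝ u)
  AbsLe-neg {u = u} (h , k) = k , ≼-respˡ (solve 1 (λ u → u := :- (:- u)) ≈-refl u) h

  AbsLe-⊗ : ∀ {R t u} → 0# ≼ t → AbsLe R u → AbsLe (t ⊗ R) (t ⊗ u)
  AbsLe-⊗ {R} {t} {u} ht (h , k) =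
    ⊗-monoˡ ht h , ≼-respˡ (solve 2 (λ t u → t :* (:- u) := :- (t :* u)) ≈-refl t u) (⊗-monoˡ ht k)

  AbsLe-+ : ∀ {R S u v} → AbsLe R u → AbsLe S v → AbsLe (R ⊕ S) (u ⊕ v)
  AbsLe-+ {u = u} {v} (h , k) (h′ , k′) =
    ⊕-mono h h′ , ≼-respˡ (solve 2 (λ u v → :- u :+ :- v := :- (u :+ v)) ≈-refl u v) (⊕-mono k k′)

  AbsLe-sq : ∀ {d u} → AbsLe d u → sq u ≼ sq d
  AbsLe-sq {d} {u} (h , k) = by-diff (⊗-nonNegative (diff≽0 h) (diff≽0 k))
    (solve 2 (λ d u → (d :- u) :* (d :- (:- u)) := d :* d :- u :* u) ≈-refl d u)

  sq-AbsLe : ∀ {d u} → 0# ≼ d → sq u ≼ sq d → AbsLe d u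
  sq-AbsLe {u = u} hd h =
    sq-≼ hd h , sq-≼ hd (≼-respˡ (solve 1 (λ u → u :* u := (:- u) :* (:- u)) ≈-refl u) h)

  sq≼sum : ∀ a b → sq a ≼ sq a ⊕ sq b
  sq≼sum a b = by-diff (0≼sq b) (solve 2 (λ a b → b :* b := (a :* a :+ b :* b) :- a :* a) ≈-refl a b)

  sq≼sum′ : ∀ a b → sq b ≼ sq a ⊕ sq b
  sq≼sum′ a b = ≼-respʳ (F.+-comm _ _) (sq≼sum b a)

  InDisk-bounds : ∀ {cx cy r px py} → 0# ≼ r → InDisk cx cy r px py → AbsLe r (px ⊖ cx) × AbsLe r (py ⊖ cy)
  InDisk-bounds hr h =
    sq-AbsLe hr (≼-trans (sq≼sum _ _) h) , sq-AbsLe hr (≼-trans (sq≼sum′ _ _) h)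

  mix : Carrier → Carrier → Carrier → Carrier
  mix t p q = p ⊕ t ⊗ (q ⊖ p)

  Unit : Carrier → Set
  Unit t = 0# ≼ t × t ≼ 1#

  AbsLe-mix : ∀ {R t p q} → Unit t → AbsLe R p → AbsLe R q → AbsLe R (mix t p q)
  AbsLe-mix {R} {t} {p} {q} (ht , ht′) (h , k) (h′ , k′) =
      by-diff (0≼+ (⊗-nonNegative (diff≽0 ht′) (diff≽0 h)) (⊗-nonNegative ht (diff≽0 h′)))
        (solve 4 (λ R t p q → (con (ℤ.+ 1) :- t) :* (R :- p) :+ t :* (R :- q) := R :- (p :+ t :* (q :- p))) ≈-refl R t p q)
    , by-diff (0≼+ (⊗-nonNegative (diff≽0 ht′) (diff≽0 k)) (⊗-nonNegative ht (diff≽0 k′)))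
        (solve 4 (λ R t p q → (con (ℤ.+ 1) :- t) :* (R :- :- p) :+ t :* (R :- :- q) := R :- :- (p :+ t :* (q :- p))) ≈-refl R t p q)

  -- Convexity of the square with its exact defect, which reduces `InDisk-convex` to sums of
  -- nonnegative terms.
  mix-sq : ∀ t p q c → sq (mix t p q ⊖ c) ⊕ t ⊗ (1# ⊖ t) ⊗ sq (q ⊖ p) ≈ (1# ⊖ t) ⊗ sq (p ⊖ c) ⊕ t ⊗ sq (q ⊖ c)
  mix-sq = solve 4 (λ t p q c →
      ((p :+ t :* (q :- p)) :- c) :* ((p :+ t :* (q :- p)) :- c) :+ t :* (con (ℤ.+ 1) :- t) :* ((q :- p) :* (q :- p))
    := (con (ℤ.+ 1) :- t) :* ((p :- c) :* (p :- c)) :+ t :* ((q :- c) :* (q :- c))) ≈-refl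

  InDisk-convex : ∀ {cx cy r px py qx qy t} → Unit t → InDisk cx cy r px py → InDisk cx cy r qx qy →
                  InDisk cx cy r (mix t px qx) (mix t py qy)
  InDisk-convex {cx} {cy} {r} {px} {py} {qx} {qy} {t} (ht , ht′) hp hq = ≼-trans
    (by-diff (0≼+ (⊗-nonNegative tt′ (0≼sq (qx ⊖ px))) (⊗-nonNegative tt′ (0≼sq (qy ⊖ py))))
      (solve 4 (λ a b c d → b :+ d := ((a :+ b) :+ (c :+ d)) :- (a :+ c)) ≈-refl _ _ _ _))
    (≼-respˡ (≈-sym (F.+-cong (mix-sq t px qx cx) (mix-sq t py qy cy)))
      (by-diff (0≼+ (⊗-nonNegative (diff≽0 ht′) (diff≽0 hp)) (⊗-nonNegative ht (diff≽0 hq)))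
        (solve 6 (λ t r a b c d →
            (con (ℤ.+ 1) :- t) :* (r :- (a :+ c)) :+ t :* (r :- (b :+ d))
          := r :- (((con (ℤ.+ 1) :- t) :* a :+ t :* b) :+ ((con (ℤ.+ 1) :- t) :* c :+ t :* d))) ≈-refl
          t (sq r) (sq (px ⊖ cx)) (sq (qx ⊖ cx)) (sq (py ⊖ cy)) (sq (qy ⊖ cy)))))
    where
    tt′ : 0# ≼ t ⊗ (1# ⊖ t)
    tt′ = ⊗-nonNegative ht (diff≽0 ht′)

  Meet : (cx cy r dx dy s : Carrier) → Set
  Meet cx cy r dx dy s = sq (cx ⊖ dx) ⊕ sq (cy ⊖ dy) ≼ sq (r ⊕ s)

  -- With u = p - c and v = p - d: (r + s)(s|u|² + r|v|²) = rs|u - v|² + |su + rv|².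
  common-point⇒Meet : ∀ {cx cy r dx dy s px py} → 0# ≺ r → 0# ≺ s →
                      InDisk cx cy r px py → InDisk dx dy s px py → Meet cx cy r dx dy s
  common-point⇒Meet {cx} {cy} {r} {dx} {dy} {s} {px} {py} hr hs hp hq = ⊗-cancelˡ (0≺* hr hs) (by-diff
    (0≼+ (⊗-nonNegative (0≼+ (≺⇒≼ hr) (≺⇒≼ hs)) (0≼+ (⊗-nonNegative (≺⇒≼ hs) (diff≽0 hp)) (⊗-nonNegative (≺⇒≼ hr) (diff≽0 hq))))
         (0≼+ (0≼sq (s ⊗ (px ⊖ cx) ⊕ r ⊗ (px ⊖ dx))) (0≼sq (s ⊗ (py ⊖ cy) ⊕ r ⊗ (py ⊖ dy)))))
    (≈-trans (solve 6 (λ r s a b c d →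
        (r :+ s) :* (s :* (r :* r :- (a :* a :+ c :* c)) :+ r :* (s :* s :- (b :* b :+ d :* d)))
          :+ ((s :* a :+ r :* b) :* (s :* a :+ r :* b) :+ (s :* c :+ r :* d) :* (s :* c :+ r :* d))
      := (r :* s) :* ((r :+ s) :* (r :+ s)) :- (r :* s) :* ((b :- a) :* (b :- a) :+ (d :- c) :* (d :- c))) ≈-refl
      r s (px ⊖ cx) (px ⊖ dx) (py ⊖ cy) (py ⊖ dy))
    (F.+-congˡ (F.-‿cong (F.*-congˡ (F.+-cong (sq-cong (shift px cx dx)) (sq-cong (shift py cy dy))))))))
    where
    shift : ∀ p c d → (p ⊖ d) ⊖ (p ⊖ c) ≈ c ⊖ d
    shift = solve 3 (λ p c d → (p :- d) :- (p :- c) := c :- d) ≈-refl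

  -- The witness divides the segment between the centres in the ratio `r : s`. With the converse
  -- above, disjointness becomes a polynomial inequality that the machine can test.
  Meet⇒common-point : ∀ {cx cy r dx dy s} → 0# ≺ r → 0# ≺ s → Meet cx cy r dx dy s →
                      ∃[ px ] ∃[ py ] InDisk cx cy r px py × InDisk dx dy s px py
  Meet⇒common-point {cx} {cy} {r} {dx} {dy} {s} hr hs h =
    mix t cx dx , mix t cy dy ,
    scaled (r ⊗ i) (solve 3 (λ t c d → (c :+ t :* (d :- c)) :- c := (:- t) :* (c :- d)) ≈-refl t cx dx)
                   (solve 3 (λ t c d → (c :+ t :* (d :- c)) :- c := (:- t) :* (c :- d)) ≈-refl t cy dy)
                   (≈-trans (solve 3 (λ r s i → :- (r :* i) :* (r :+ s) := :- (r :* ((r :+ s) :* i))) ≈-refl r s i)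
                            (≈-trans (F.-‿cong (F.*-congˡ inv)) (F.-‿cong (F.*-identityʳ r)))) (solve 1 (λ r → (:- r) :* (:- r) := r :* r) ≈-refl r) ,
    scaled (⊝ (s ⊗ i)) (other cx dx) (other cy dy)
                   (≈-trans (solve 3 (λ r s i → :- (:- (s :* i)) :* (r :+ s) := s :* ((r :+ s) :* i)) ≈-refl r s i)
                            (≈-trans (F.*-congˡ inv) (F.*-identityʳ s))) ≈-refl
    where
    i t : Carrier
    i = (r ⊕ s) ⁻¹
    t = r ⊗ i
    inv : (r ⊕ s) ⊗ i ≈ 1#
    inv = ⁻¹-inverseʳ (r ⊕ s) (0≺⇒≉0 (0≺+ hr (≺⇒≼ hs)))
    scaled : ∀ k {ux uy ρ w} → ux ≈ (⊝ k) ⊗ (cx ⊖ dx) → uy ≈ (⊝ k) ⊗ (cy ⊖ dy) → (⊝ k) ⊗ (r ⊕ s) ≈ ρ → sq ρ ≈ sq w →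
             sq ux ⊕ sq uy ≼ sq w
    scaled k ex ey e e′ = ≼-respʳ (≈-trans (≈-trans
      (solve 2 (λ k n → (k :* k) :* (n :* n) := (k :* n) :* (k :* n)) ≈-refl (⊝ k) (r ⊕ s)) (sq-cong e)) e′)
      (≼-respˡ (≈-sym (≈-trans (F.+-cong (sq-cong ex) (sq-cong ey))
        (solve 3 (λ k a b → (k :* a) :* (k :* a) :+ (k :* b) :* (k :* b) := (k :* k) :* (a :* a :+ b :* b)) ≈-refl (⊝ k) (cx ⊖ dx) (cy ⊖ dy))))
        (⊗-monoˡ (0≼sq (⊝ k)) h))
    other : ∀ c d → mix t c d ⊖ d ≈ (⊝ ⊝ (s ⊗ i)) ⊗ (c ⊖ d)
    other c d = ≈-trans (solve 4 (λ c d r i → (c :+ (r :* i) :* (d :- c)) :- d := (con (ℤ.+ 1) :- r :* i) :* (c :- d)) ≈-refl c d r i)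
      (F.*-congʳ (≈-trans (F.+-congʳ (≈-sym inv))
        (solve 3 (λ r s i → (r :+ s) :* i :- r :* i := :- (:- (s :* i))) ≈-refl r s i)))

  module Crossing {R : Carrier} (0≼R : 0# ≼ R) where

    clip-upper : ∀ {a b} → AbsLe R a → R ≺ b → ∃[ t ] Unit t × mix t a b ≈ R
    clip-upper {a} {b} (a≤ , _) R<b =
      (R ⊖ a) ⊗ i ,
      (⊗-nonNegative (diff≽0 a≤) (≺⇒≼ (0≺⁻¹ 0≺b-a)) ,
       ≼-respʳ (⁻¹-inverseʳ (b ⊖ a) (0≺⇒≉0 0≺b-a)) (≼-respˡ (F.*-comm _ _) (≼-respʳ (F.*-comm _ _) (⊗-monoˡ (≺⇒≼ (0≺⁻¹ 0≺b-a))
         (by-diff (diff≽0 (≺⇒≼ R<b)) (solve 3 (λ a b R → b :- R := (b :- a) :- (R :- a)) ≈-refl a b R)))))) ,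
      ≈-trans (solve 4 (λ a b R i → a :+ ((R :- a) :* i) :* (b :- a) := a :+ (R :- a) :* ((b :- a) :* i)) ≈-refl a b R i)
        (≈-trans (F.+-congˡ (F.*-congˡ (⁻¹-inverseʳ (b ⊖ a) (0≺⇒≉0 0≺b-a))))
          (solve 2 (λ a R → a :+ (R :- a) :* con (ℤ.+ 1) := R) ≈-refl a R))
      where
      i : Carrier
      i = (b ⊖ a) ⁻¹
      0≺b-a : 0# ≺ b ⊖ a
      0≺b-a = ≺-diff (≼-≺-trans a≤ R<b)

    OnSide : Carrier → Set
    OnSide u = u ≈ R ⊎ u ≈ ⊝ R

    OnSide⇒AbsLe : ∀ {u} → OnSide u → AbsLe R u
    OnSide⇒AbsLe (inj₁ e) = AbsLe-cong (≈-sym e) (≼-refl , by-diff (0≼+ 0≼R 0≼R) (solve 1 (λ R → R :+ R := R :- (:- R)) ≈-refl R))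
    OnSide⇒AbsLe (inj₂ e) = AbsLe-cong (≈-sym e) (AbsLe-neg (OnSide⇒AbsLe (inj₁ ≈-refl)))

    clip : ∀ {a b} → AbsLe R a → AbsLe R b ⊎ ∃[ t ] Unit t × OnSide (mix t a b)
    clip {a} {b} ha with ≼∨≺ b R | ≼∨≺ (⊝ b) R
    ... | inj₂ R<b | _        = let t , u , e = clip-upper ha R<b in inj₂ (t , u , inj₁ e)
    ... | inj₁ _   | inj₂ R<b = let t , u , e = clip-upper (AbsLe-neg ha) R<b in
      inj₂ (t , u , inj₂ (≈-trans (mix-neg t a b) (F.-‿cong e)))
      where
      mix-neg : ∀ t a b → mix t a b ≈ ⊝ mix t (⊝ a) (⊝ b)
      mix-neg = solve 3 (λ t a b → a :+ t :* (b :- a) := :- ((:- a) :+ t :* (:- b :- :- a))) ≈-refl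
    ... | inj₁ h | inj₁ k     = inj₁ (h , k)

    module _ {cx cy r : Carrier} where

      BoundaryPoint : Set
      BoundaryPoint = ∃[ zx ] ∃[ zy ] InDisk cx cy r zx zy × AbsLe R zx × AbsLe R zy × (OnSide zx ⊎ OnSide zy)

      -- The segment from `a` to `b` is cut where its first coordinate leaves the square, and what
      -- remains is cut where the second one does. Convexity keeps the end in the disk.
      boundary-point : ∀ {ax ay bx by} → InDisk cx cy r ax ay → AbsLe R ax → AbsLe R ay →
                       InDisk cx cy r bx by → ¬ (AbsLe R bx × AbsLe R by) → BoundaryPoint
      boundary-point {ax} {ay} {bx} {by} ha hx hy hb out with clip {ax} {bx} hx
      ... | inj₁ hbx with clip {ay} {by} hy
      ...   | inj₁ hby = ⊥-elim (out (hbx , hby))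
      ...   | inj₂ (t , u , side) =
              mix t ax bx , mix t ay by , InDisk-convex u ha hb , AbsLe-mix u hx hbx , OnSide⇒AbsLe side , inj₂ side
      boundary-point {ax} {ay} {bx} {by} ha hx hy hb out | inj₂ (t , u , side) with clip {ay} {mix t ay by} hy
      ... | inj₁ hzy =
              mix t ax bx , mix t ay by , InDisk-convex u ha hb , OnSide⇒AbsLe side , hzy , inj₁ side
      ... | inj₂ (t′ , u′ , side′) =
              mix t′ ax (mix t ax bx) , mix t′ ay (mix t ay by) , InDisk-convex u′ ha (InDisk-convex u ha hb) ,
              AbsLe-mix u′ hx (OnSide⇒AbsLe side) , OnSide⇒AbsLe side′ , inj₂ side′

  module Core {δ : Carrier} (0≺δ : 0# ≺ δ) where

    Inner : (cx cy r yx yy : Carrier) → Set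
    Inner cx cy r yx yy = ∀ {wx wy} → sq (wx ⊖ yx) ⊕ sq (wy ⊖ yy) ≼ sq δ → InDisk cx cy r wx wy

    -- The homothety with centre `z` and ratio `δ / r` maps the disk to a disk of radius `δ` inside
    -- it. Its centre `y` is the image of the old centre and hence within `δ` of `z`.
    shrink : ∀ {cx cy r zx zy} → δ ≼ r → InDisk cx cy r zx zy →
             ∃[ yx ] ∃[ yy ] Inner cx cy r yx yy × AbsLe δ (yx ⊖ zx) × AbsLe δ (yy ⊖ zy)
    shrink {cx} {cy} {r} {zx} {zy} δ≤r hz =
      mix t zx cx , mix t zy cy , inner , near zx cx (proj₁ bounds) , near zy cy (proj₂ bounds)
      where
      0≺r : 0# ≺ r
      0≺r = ≺-≼-trans 0≺δ δ≤r
      t k : Carrier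
      t = δ ⊗ r ⁻¹
      k = r ⊗ δ ⁻¹
      rr : r ⊗ r ⁻¹ ≈ 1#
      rr = ⁻¹-inverseʳ r (0≺⇒≉0 0≺r)
      dd : δ ⊗ δ ⁻¹ ≈ 1#
      dd = ⁻¹-inverseʳ δ (0≺⇒≉0 0≺δ)
      tr : t ⊗ r ≈ δ
      tr = ≈-trans (solve 3 (λ d i r → (d :* i) :* r := d :* (r :* i)) ≈-refl δ (r ⁻¹) r) (≈-trans (F.*-congˡ rr) (F.*-identityʳ δ))
      kδ : k ⊗ δ ≈ r
      kδ = ≈-trans (solve 3 (λ d i r → (r :* i) :* d := r :* (d :* i)) ≈-refl δ (δ ⁻¹) r) (≈-trans (F.*-congˡ dd) (F.*-identityʳ r))
      tk : t ⊗ k ≈ 1#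
      tk = ≈-trans (solve 4 (λ d i r j → (d :* i) :* (r :* j) := (r :* i) :* (d :* j)) ≈-refl δ (r ⁻¹) r (δ ⁻¹))
                   (≈-trans (F.*-cong rr dd) (F.*-identityʳ 1#))
      0≼t : 0# ≼ t
      0≼t = ⊗-nonNegative (≺⇒≼ 0≺δ) (≺⇒≼ (0≺⁻¹ 0≺r))
      unit : Unit t
      unit = 0≼t , ≼-respʳ rr (≼-respˡ (F.*-comm _ _) (≼-respʳ (F.*-comm _ _) (⊗-monoˡ (≺⇒≼ (0≺⁻¹ 0≺r)) δ≤r)))
      bounds : AbsLe r (zx ⊖ cx) × AbsLe r (zy ⊖ cy)
      bounds = InDisk-bounds (≺⇒≼ 0≺r) hz
      near : ∀ z c → AbsLe r (z ⊖ c) → AbsLe δ (mix t z c ⊖ z)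
      near z c h = AbsLe-cong (solve 3 (λ t z c → t :* :- (z :- c) := (z :+ t :* (c :- z)) :- z) ≈-refl t z c)
        (AbsLe-mono (≼-reflexive tr) (AbsLe-⊗ 0≼t (AbsLe-neg h)))
      inner : Inner cx cy r (mix t zx cx) (mix t zy cy)
      inner {wx} {wy} h = InDisk-cong (unmix zx cx wx) (unmix zy cy wy) (InDisk-convex unit hz
        (≼-respʳ (≈-trans (solve 2 (λ k d → (k :* k) :* (d :* d) := (k :* d) :* (k :* d)) ≈-refl k δ) (sq-cong kδ))
          (≼-respˡ (solve 5 (λ k a b c d → (k :* k) :* (a :* a :+ b :* b)
                      := ((c :+ k :* a) :- c) :* ((c :+ k :* a) :- c) :+ ((d :+ k :* b) :- d) :* ((d :+ k :* b) :- d))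
                      ≈-refl k (wx ⊖ mix t zx cx) (wy ⊖ mix t zy cy) cx cy)
            (⊗-monoˡ (0≼sq k) h))))
        where
        unmix : ∀ z c w → mix t z (c ⊕ k ⊗ (w ⊖ mix t z c)) ≈ w
        unmix z c w = ≈-trans
          (solve 5 (λ t k z c w → z :+ t :* ((c :+ k :* (w :- (z :+ t :* (c :- z)))) :- z)
                     := (z :+ t :* (c :- z)) :+ (t :* k) :* (w :- (z :+ t :* (c :- z)))) ≈-refl t k z c w)
          (≈-trans (F.+-congˡ (F.*-congʳ tk))
            (solve 2 (λ m w → m :+ con (ℤ.+ 1) :* (w :- m) := w) ≈-refl (mix t z c) w))

    -- The midpoint of `y` and `v` works: both coordinates are off by at most `δ / 2`, and twice the
    -- square of that is below `δ²`.
    close⇒common-point : ∀ {cx cy r yx yy dx dy s vx vy} → Inner cx cy r yx yy → Inner dx dy s vx vy →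
      AbsLe δ (vx ⊖ yx) → AbsLe δ (vy ⊖ yy) → ∃[ px ] ∃[ py ] InDisk cx cy r px py × InDisk dx dy s px py
    close⇒common-point {yx = yx} {yy} {vx = vx} {vy} iy iv hx hy =
      mix h yx vx , mix h yy vy ,
      iy (small (solve 3 (λ h y v → (y :+ h :* (v :- y)) :- y := h :* (v :- y)) ≈-refl h yx vx)
                (solve 3 (λ h y v → (y :+ h :* (v :- y)) :- y := h :* (v :- y)) ≈-refl h yy vy) hx hy) ,
      iv (small (far yx vx) (far yy vy) (AbsLe-neg hx) (AbsLe-neg hy))
      where
      h : Carrier
      h = proj₁ (divide 1 0≺1)
      0≺h : 0# ≺ h
      0≺h = proj₁ (proj₂ (divide 1 0≺1))
      hh : 2 · h ≈ 1#
      hh = proj₂ (proj₂ (divide 1 0≺1))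
      2h≈1 : h ⊕ h ≈ 1#
      2h≈1 = ≈-trans (F.+-congʳ (≈-sym (F.+-identityˡ h))) hh
      h≼1 : h ≼ 1#
      h≼1 = by-diff (≺⇒≼ 0≺h) (≈-trans (solve 1 (λ h → h := (h :+ h) :- h) ≈-refl h) (F.+-congʳ 2h≈1))
      far : ∀ y v → mix h y v ⊖ v ≈ h ⊗ ⊝ (v ⊖ y)
      far y v = ≈-trans (solve 3 (λ h y v → (y :+ h :* (v :- y)) :- v := (con (ℤ.+ 1) :- h) :* (:- (v :- y))) ≈-refl h y v)
        (F.*-congʳ (≈-trans (F.+-congʳ (≈-sym 2h≈1)) (solve 1 (λ h → (h :+ h) :- h := h) ≈-refl h)))
      small : ∀ {a b u v} → a ≈ h ⊗ u → b ≈ h ⊗ v → AbsLe δ u → AbsLe δ v → sq a ⊕ sq b ≼ sq δ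
      small {u = u} {v} ea eb hu hv = ≼-respˡ (≈-sym (F.+-cong (sq-cong ea) (sq-cong eb)))
        (≼-trans (⊕-mono (AbsLe-sq (AbsLe-⊗ (≺⇒≼ 0≺h) hu)) (AbsLe-sq (AbsLe-⊗ (≺⇒≼ 0≺h) hv)))
          (≼-respˡ (≈-trans (F.*-congʳ (≈-sym (F.*-identityʳ h))) (≈-trans (F.*-congʳ (F.*-congˡ (≈-sym 2h≈1)))
             (solve 2 (λ h d → (h :* (h :+ h)) :* (d :* d) := (h :* d) :* (h :* d) :+ (h :* d) :* (h :* d)) ≈-refl h δ)))
            (≼-respʳ (F.*-identityˡ (sq δ)) (≼-respˡ (F.*-comm _ _) (≼-respʳ (F.*-comm _ _) (⊗-monoˡ (0≼sq δ) h≼1))))))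

-- Separators

-- Turns witnesses into a function of the position, as `♯-classes` requires; `b` fills the positions
-- that have none.
pick : ∀ {n : ℕ} {A : Subset} {B : Set} {P : ℕ → B → Set} → B →
       (∀ {i} → i < n → A i ≡ true → ∃ (P i)) → ∀ i → ∃[ b ] (i < n → A i ≡ true → P i b)
pick {n} {A} b h i with i ℕ.<? n | true-or-false (A i)
... | yes l | inj₁ a = proj₁ (h l a) , λ _ _ → proj₂ (h l a)
... | yes l | inj₂ a = b , λ _ a′ → ⊥-elim (true≢false a′ a)
... | no ¬l | _      = b , λ l → ⊥-elim (¬l l)

isqrt : ℕ → ℕ
isqrt zero = 0
isqrt (suc m) with suc (isqrt m) * suc (isqrt m) ℕ.≤? suc m
... | yes _ = suc (isqrt m)
... | no _  = isqrt m

isqrt-lower : ∀ m → isqrt m * isqrt m ≤ m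
isqrt-lower zero = z≤n
isqrt-lower (suc m) with suc (isqrt m) * suc (isqrt m) ℕ.≤? suc m
... | yes h = h
... | no _  = m≤n⇒m≤1+n (isqrt-lower m)

isqrt-upper : ∀ m → m < suc (isqrt m) * suc (isqrt m)
isqrt-upper zero = s≤s z≤n
isqrt-upper (suc m) with suc (isqrt m) * suc (isqrt m) ℕ.≤? suc m
... | no h  = ≰⇒> h
... | yes _ = ≤-trans (s≤s (isqrt-upper m)) (*-mono-< (n<1+n (suc (isqrt m))) (n<1+n (suc (isqrt m))))

abstract
  -- Opaque: products with a large literal must not be unfolded.
  separatorConstant : ℕ
  separatorConstant = 121 * 121

  separatorConstant-≡ : separatorConstant ≡ 121 * 121
  separatorConstant-≡ = refl

  20≤separatorConstant : 20 ≤ separatorConstant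
  20≤separatorConstant = ≤ᵇ⇒≤ 20 14641 _

square-bound : ∀ {K k a s m} → K ≡ k * k → a ≤ k * s → s * s ≤ m → a * a ≤ K * m
square-bound {K} {k} {a} {s} {m} refl a≤ s²≤m = begin
  a * a                ≤⟨ *-mono-≤ a≤ a≤ ⟩
  (k * s) * (k * s)    ≡⟨ [m*n]*[o*p]≡[m*o]*[n*p] k s k s ⟩
  (k * k) * (s * s)    ≤⟨ *-monoʳ-≤ (k * k) s²≤m ⟩
  (k * k) * m          ∎
  where open ≤-Reasoning

module ThreeCells (ℝ : RealNumbers) where
  open OrderedField ℝ
  private module F = RealNumbers ℝ

  halve : ∀ {a} → 0# ≺ a ⊕ a → 0# ≺ a
  halve h k = h (≼-respʳ (F.+-identityʳ 0#) (⊕-mono k k))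

  -- The interval from -3t/2 to 3t/2 is cut into three parts of diameter less than t.
  third : Carrier → Carrier → ℕ
  third t u = if ⌊ u ⊕ u ≼? ⊝ t ⌋ then 0 else if ⌊ t ≼? u ⊕ u ⌋ then 2 else 1

  third<3 : ∀ t u → third t u < 3
  third<3 t u with u ⊕ u ≼? ⊝ t
  ... | yes _ = s≤s z≤n
  ... | no _ with t ≼? u ⊕ u
  ...   | yes _ = s≤s (s≤s (s≤s z≤n))
  ...   | no _  = s≤s (s≤s z≤n)

  Range : Carrier → Carrier → Set
  Range t u = u ⊕ u ≺ t ⊕ t ⊕ t × ⊝ (u ⊕ u) ≺ t ⊕ t ⊕ t

  third-close : ∀ {t u v} → Range t u → Range t v → third t u ≡ third t v → u ⊖ v ≺ t
  third-close {t} {u} {v} (u< , _) (_ , v>) e with u ⊕ u ≼? ⊝ t | v ⊕ v ≼? ⊝ t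
  ... | yes hu | yes hv = by-diff≺ (halve (≺-≼-trans (0≺+ (≺-diff v>) (diff≽0 hu))
          (≼-reflexive (solve 3 (λ t u v → ((t :+ t :+ t) :- (:- (v :+ v))) :+ (:- t :- (u :+ u)) := (t :- (u :- v)) :+ (t :- (u :- v))) ≈-refl t u v)))) ≈-refl
  ... | no hu | yes hv with t ≼? u ⊕ u
  third-close _ _ () | no hu | yes hv | yes _
  third-close _ _ () | no hu | yes hv | no _
  third-close {t} {u} {v} _ _ e | yes hu | no hv with t ≼? v ⊕ v
  third-close _ _ () | yes hu | no hv | yes _
  third-close _ _ () | yes hu | no hv | no _
  third-close {t} {u} {v} (u< , _) (_ , v>) e | no hu | no hv with t ≼? u ⊕ u | t ≼? v ⊕ v
  ... | yes ku | yes kv = by-diff≺ (halve (≺-≼-trans (0≺+ (≺-diff u<) (diff≽0 kv))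
          (≼-reflexive (solve 3 (λ t u v → ((t :+ t :+ t) :- (u :+ u)) :+ ((v :+ v) :- t) := (t :- (u :- v)) :+ (t :- (u :- v))) ≈-refl t u v)))) ≈-refl
  ... | no ku | no kv = by-diff≺ (halve (≺-≼-trans (0≺+ (≺-diff ku) (≺⇒≼ (≺-diff hv)))
          (≼-reflexive (solve 3 (λ t u v → (t :- (u :+ u)) :+ ((v :+ v) :- (:- t)) := (t :- (u :- v)) :+ (t :- (u :- v))) ≈-refl t u v)))) ≈-refl
  third-close _ _ () | no hu | no hv | yes _ | no _
  third-close _ _ () | no hu | no hv | no _ | yes _

module Separators (ℝ : RealNumbers) (n : ℕ) (x y r : ℕ → RealNumbers.Carrier ℝ)
                  (r>0 : ∀ {i} → i < n → OrderedField._≺_ ℝ (RealNumbers.0# ℝ) (r i)) where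
  open OrderedField ℝ
  open PlaneGeometry ℝ
  open ThreeCells ℝ
  open Counting n
  private module F = RealNumbers ℝ

  meet : ℕ → ℕ → Bool
  meet i j = ⌊ sq (x i ⊖ x j) ⊕ sq (y i ⊖ y j) ≼? sq (r i ⊕ r j) ⌋

  dist : ℕ → ℕ → Carrier
  dist c j = maxr (maxr (x j ⊖ x c) (x c ⊖ x j)) (maxr (y j ⊖ y c) (y c ⊖ y j))

  -- Half the side of the least square around centre `c` that contains disk `j`. Hence `inRow c l`
  -- is the set of disks inside the least such square that contains disk `l`.
  ψ : ℕ → ℕ → Carrier
  ψ c j = dist c j ⊕ r j

  inRow : ℕ → ℕ → Subset
  inRow c l j = ⌊ ψ c j ≼? ψ c l ⌋

  Independent : Subset → Set
  Independent X = ∀ {i j} → i < n → j < n → X i ≡ true → X j ≡ true → i ≢ j → meet i j ≡ false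

  data Basic : Set where
    single : ∀ g → g < n → Basic
    row    : ∀ c l → c < n → l < n → Basic

  ⟪_⟫ : Basic → Subset
  ⟪ single g _ ⟫  = ⁅ g ⁆
  ⟪ row c l _ _ ⟫ = inRow c l

  -- `G` is a set of input disks, in `X` or not. It contains the inside part and none of its members
  -- meets the outside part, which is all that the description of the two regions uses.
  record Separation (X : Subset) : Set where
    field
      S In : Subset
      G    : Basic
      S⊆X   : S ⊆ X
      I⊆G   : (X ∖ S) ∩ In ⊆ ⟪ G ⟫
      G⊥U   : ∀ {g u} → g < n → u < n → ⟪ G ⟫ g ≡ true → ((X ∖ S) ∖ In) u ≡ true → meet g u ≡ false
      ♯I≤   : 10 * ♯ ((X ∖ S) ∩ In) ≤ 9 * ♯ X
      ♯U≤   : 10 * ♯ ((X ∖ S) ∖ In) ≤ 9 * ♯ X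
      ♯S≤   : ♯ S * ♯ S ≤ separatorConstant * ♯ X
    I U : Subset
    I = (X ∖ S) ∩ In
    U = (X ∖ S) ∖ In

  flip-diff : ∀ a b → ⊝ (a ⊖ b) ≈ b ⊖ a
  flip-diff = solve 2 (λ a b → :- (a :- b) := b :- a) ≈-refl

  dist⇒AbsLe : ∀ {c j R} → dist c j ≼ R → AbsLe R (x j ⊖ x c) × AbsLe R (y j ⊖ y c)
  dist⇒AbsLe {c} {j} h =
    (≼-trans (≼-trans (maxr-≽ˡ _ _) (maxr-≽ˡ _ _)) h , ≼-respˡ (≈-sym (flip-diff (x j) (x c))) (≼-trans (≼-trans (maxr-≽ʳ _ _) (maxr-≽ˡ _ _)) h)) ,
    (≼-trans (≼-trans (maxr-≽ˡ _ _) (maxr-≽ʳ _ _)) h , ≼-respˡ (≈-sym (flip-diff (y j) (y c))) (≼-trans (≼-trans (maxr-≽ʳ _ _) (maxr-≽ʳ _ _)) h))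

  AbsLe⇒dist : ∀ {c j R} → AbsLe R (x j ⊖ x c) → AbsLe R (y j ⊖ y c) → dist c j ≼ R
  AbsLe⇒dist {c} {j} (a , b) (c′ , d) =
    maxr-lub (maxr-lub a (≼-respˡ (flip-diff (x j) (x c)) b)) (maxr-lub c′ (≼-respˡ (flip-diff (y j) (y c)) d))

  maxr-≺ : ∀ {a b c} → a ≺ c → b ≺ c → maxr a b ≺ c
  maxr-≺ {a} {b} h k with a ≼? b
  ... | yes _ = k
  ... | no _  = h

  AbsLe-0 : ∀ {R a} → 0# ≼ R → AbsLe R (a ⊖ a)
  AbsLe-0 {a = a} h = ≼-respˡ (solve 1 (λ a → con (ℤ.+ 0) := a :- a) ≈-refl a) h ,
                      ≼-respˡ (solve 1 (λ a → con (ℤ.+ 0) := :- (a :- a)) ≈-refl a) h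

  dist-self : ∀ {c R} → 0# ≼ R → dist c c ≼ R
  dist-self h = AbsLe⇒dist (AbsLe-0 h) (AbsLe-0 h)

  dist0⇒meet : ∀ {i j} → dist i j ≼ 0# → meet i j ≡ true
  dist0⇒meet {i} {j} h with dist⇒AbsLe h
  ... | a , b = yes! (_ ≼? _) (≼-trans (⊕-mono (AbsLe-sq (AbsLe-cong (flip-diff (x j) (x i)) (AbsLe-neg a)))
                                               (AbsLe-sq (AbsLe-cong (flip-diff (y j) (y i)) (AbsLe-neg b))))
    (≼-respˡ (solve 0 (con (ℤ.+ 0) := con (ℤ.+ 0) :* con (ℤ.+ 0) :+ con (ℤ.+ 0) :* con (ℤ.+ 0)) ≈-refl) (0≼sq _)))

  meet⇒point : ∀ {i j} → i < n → j < n → meet i j ≡ true →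
               ∃[ px ] ∃[ py ] InDisk (x i) (y i) (r i) px py × InDisk (x j) (y j) (r j) px py
  meet⇒point i<n j<n h = Meet⇒common-point (r>0 i<n) (r>0 j<n) (from-yes! (_ ≼? _) h)

  point⇒meet : ∀ {i j px py} → i < n → j < n → InDisk (x i) (y i) (r i) px py → InDisk (x j) (y j) (r j) px py →
               meet i j ≡ true
  point⇒meet i<n j<n p q = yes! (_ ≼? _) (common-point⇒Meet (r>0 i<n) (r>0 j<n) p q)

  meet-sym : ∀ {i j} → i < n → j < n → meet i j ≡ true → meet j i ≡ true
  meet-sym i<n j<n h = let _ , _ , p , q = meet⇒point i<n j<n h in point⇒meet j<n i<n q p

  meet-refl : ∀ {i} → i < n → meet i i ≡ true
  meet-refl {i} i<n = dist0⇒meet (dist-self ≼-refl)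

  -- So few disks may all be removed: the square of their number is at most `20 * ♯ X`. This spares
  -- the large case the sizes for which its rounding is too coarse.
  small-separation : ∀ {X} → ♯ X ≤ 20 → 1 ≤ ♯ X → Separation X
  small-separation {X} small pos with ♯-witness pos
  ... | g , g<n , _ = record
    { S = X ; In = ∅ ; G = single g g<n
    ; S⊆X = λ _ h → h
    ; I⊆G = λ {i} _ h → ⊥-elim (none i (∧-fst h))
    ; G⊥U = λ {_} {u} _ _ _ h → ⊥-elim (none u (∧-fst h))
    ; ♯I≤ = ≤-trans (≤-reflexive (cong (10 *_) (♯-≡0 λ {i} _ → empty i false))) z≤n
    ; ♯U≤ = ≤-trans (≤-reflexive (cong (10 *_) (♯-≡0 λ {i} _ → empty i true))) z≤n
    ; ♯S≤ = *-monoˡ-≤ (♯ X) (≤-trans small 20≤separatorConstant)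
    }
    where
    none : ∀ i → ¬ (X ∖ X) i ≡ true
    none i h with X i
    none i () | true
    none i () | false
    empty : ∀ i b → (X i ∧ not (X i)) ∧ b ≡ false
    empty i b with X i
    ... | true  = refl
    ... | false = refl

  module Relative (c : ℕ) where

    dx dy : ℕ → Carrier
    dx i = x i ⊖ x c
    dy i = y i ⊖ y c

    InRel : ℕ → Carrier → Carrier → Set
    InRel i = InDisk (dx i) (dy i) (r i)

    Touches : Carrier → ℕ → Set
    Touches R i = ∃[ ax ] ∃[ ay ] InRel i ax ay × AbsLe R ax × AbsLe R ay

    to-relative : ∀ {i px py} → InDisk (x i) (y i) (r i) px py → InRel i (px ⊖ x c) (py ⊖ y c)
    to-relative {i} {px} {py} = ≼-respˡ (F.+-cong (sq-cong (shift px (x i) (x c))) (sq-cong (shift py (y i) (y c))))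
      where
      shift : ∀ p a c → p ⊖ a ≈ (p ⊖ c) ⊖ (a ⊖ c)
      shift = solve 3 (λ p a c → p :- a := (p :- c) :- (a :- c)) ≈-refl

    to-absolute : ∀ {i px py} → InRel i px py → InDisk (x i) (y i) (r i) (px ⊕ x c) (py ⊕ y c)
    to-absolute {i} {px} {py} = ≼-respˡ (F.+-cong (sq-cong (shift px (x i) (x c))) (sq-cong (shift py (y i) (y c))))
      where
      shift : ∀ p a c → p ⊖ (a ⊖ c) ≈ (p ⊕ c) ⊖ a
      shift = solve 3 (λ p a c → p :- (a :- c) := (p :+ c) :- a) ≈-refl

    inside : ∀ {R j px py} → j < n → ψ c j ≼ R → InDisk (x j) (y j) (r j) px py →
             AbsLe R (px ⊖ x c) × AbsLe R (py ⊖ y c)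
    inside {R} {j} {px} {py} j<n h p =
      let bx , by = InDisk-bounds (≺⇒≼ (r>0 j<n)) p
          ex , ey = dist⇒AbsLe {c} {j} ≼-refl
      in AbsLe-cong (shift (x j) px (x c)) (AbsLe-mono h (AbsLe-+ ex bx)) ,
         AbsLe-cong (shift (y j) py (y c)) (AbsLe-mono h (AbsLe-+ ey by))
      where
      shift : ∀ a p c → (a ⊖ c) ⊕ (p ⊖ a) ≈ p ⊖ c
      shift = solve 3 (λ a p c → (a :- c) :+ (p :- a) := p :- c) ≈-refl

    -- A disk that reaches the square extends beyond it by at most its diameter; this is why a small
    -- disk crosses few of the squares.
    ψ-touching : ∀ {R i} → i < n → Touches R i → ψ c i ≼ R ⊕ (r i ⊕ r i)
    ψ-touching {R} {i} i<n (ax , ay , a∈ , hx , hy) =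
      let bx , by = InDisk-bounds (≺⇒≼ (r>0 i<n)) a∈ in
      ≼-respʳ (F.+-assoc R (r i) (r i)) (⊕-mono (AbsLe⇒dist
        (AbsLe-cong (back ax (dx i)) (AbsLe-+ hx (AbsLe-neg bx))) (AbsLe-cong (back ay (dy i)) (AbsLe-+ hy (AbsLe-neg by)))) ≼-refl)
      where
      back : ∀ a d → a ⊕ ⊝ (a ⊖ d) ≈ d
      back = solve 2 (λ a d → a :+ :- (a :- d) := d) ≈-refl

    Protrudes : Carrier → ℕ → Set
    Protrudes R i = ∃[ bx ] ∃[ by ] InRel i bx by × ¬ (AbsLe R bx × AbsLe R by)

    InRel-east : ∀ i k → k ≈ r i ⊎ k ≈ ⊝ r i → InRel i (dx i ⊕ k) (dy i)
    InRel-east i k e = ≼-reflexive (≈-trans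
      (solve 3 (λ a b k → ((a :+ k) :- a) :* ((a :+ k) :- a) :+ (b :- b) :* (b :- b) := k :* k) ≈-refl (dx i) (dy i) k)
      ([ sq-cong , (λ h → ≈-trans (sq-cong h) (solve 1 (λ r → (:- r) :* (:- r) := r :* r) ≈-refl (r i))) ]′ e))

    InRel-north : ∀ i k → k ≈ r i ⊎ k ≈ ⊝ r i → InRel i (dx i) (dy i ⊕ k)
    InRel-north i k e = ≼-reflexive (≈-trans
      (solve 3 (λ a b k → (a :- a) :* (a :- a) :+ ((b :+ k) :- b) :* ((b :+ k) :- b) := k :* k) ≈-refl (dx i) (dy i) k)
      ([ sq-cong , (λ h → ≈-trans (sq-cong h) (solve 1 (λ r → (:- r) :* (:- r) := r :* r) ≈-refl (r i))) ]′ e))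

    -- One of the four extreme points of the disk in the directions of the axes lies outside the
    -- square.
    protrudes : ∀ {R i} → ¬ ψ c i ≼ R → Protrudes R i
    protrudes {R} {i} ¬h =
      [ (λ e → [ (λ w → [ (λ n → [ (λ s → ⊥-elim (¬h (≼-respʳ (solve 2 (λ R r → (R :- r) :+ r := R) ≈-refl R (r i))
              (⊕-mono (AbsLe⇒dist (minus (dx i) e , minus′ (dx i) w) (minus (dy i) n , minus′ (dy i) s)) ≼-refl))))
          , (λ g → dx i , dy i ⊕ ⊝ r i , InRel-north i (⊝ r i) (inj₂ ≈-refl) , λ b → g (proj₂ (proj₂ b)))
          ]′ (≼∨≺ (⊝ (dy i ⊕ ⊝ r i)) R))
          , (λ g → dx i , dy i ⊕ r i , InRel-north i (r i) (inj₁ ≈-refl) , λ b → g (proj₁ (proj₂ b)))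
          ]′ (≼∨≺ (dy i ⊕ r i) R))
          , (λ g → dx i ⊕ ⊝ r i , dy i , InRel-east i (⊝ r i) (inj₂ ≈-refl) , λ b → g (proj₂ (proj₁ b)))
          ]′ (≼∨≺ (⊝ (dx i ⊕ ⊝ r i)) R))
          , (λ g → dx i ⊕ r i , dy i , InRel-east i (r i) (inj₁ ≈-refl) , λ b → g (proj₁ (proj₁ b)))
          ]′ (≼∨≺ (dx i ⊕ r i) R)
      where
      minus : ∀ d → d ⊕ r i ≼ R → d ≼ R ⊖ r i
      minus d h = by-diff (diff≽0 h) (solve 3 (λ R d r → R :- (d :+ r) := (R :- r) :- d) ≈-refl R d (r i))
      minus′ : ∀ d → ⊝ (d ⊕ ⊝ r i) ≼ R → ⊝ d ≼ R ⊖ r i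
      minus′ d h = by-diff (diff≽0 h) (solve 3 (λ R d r → R :- :- (d :+ :- r) := (R :- r) :- :- d) ≈-refl R d (r i))

    module Packing {R δ : Carrier} (0≼R : 0# ≼ R) (0≺δ : 0# ≺ δ) (Q : ℕ) (Qδ : (R ⊕ δ) ⊕ (R ⊕ δ) ≼ suc Q · δ) where
      open Crossing 0≼R
      open Core 0≺δ

      -- Coordinates across and along the strip of a side, shifted so that both start at zero. Sides
      -- 0 and 1 are vertical, sides 2 and 3 horizontal.
      across along : ℕ → Carrier → Carrier → Carrier
      across 0 yx yy = yx ⊖ (R ⊖ δ)
      across 1 yx yy = yx ⊖ (⊝ R ⊖ δ)
      across 2 yx yy = yy ⊖ (R ⊖ δ)
      across _ yx yy = yy ⊖ (⊝ R ⊖ δ)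
      along 0 yx yy = yy ⊕ (R ⊕ δ)
      along 1 yx yy = yy ⊕ (R ⊕ δ)
      along _ yx yy = yx ⊕ (R ⊕ δ)

      -- The four sides of the boundary are thickened to strips of width 2δ,
      -- which are cut into cells of side δ.
      Slot : ℕ → ℕ × ℕ × ℕ → Set
      Slot i (side , u , v) = (side < 4 × u < 2 × v < suc Q) × ∃[ yx ] ∃[ yy ]
        Inner (dx i) (dy i) (r i) yx yy × InCell u δ (across side yx yy) × InCell v δ (along side yx yy)

      strip : ∀ {y z Z} → z ≈ Z → AbsLe δ (y ⊖ z) → 0# ≼ y ⊖ (Z ⊖ δ) × y ⊖ (Z ⊖ δ) ≼ 2 · δ
      strip {y} {z} {Z} e (h , k) =
          ≼-respʳ (≈-trans (solve 3 (λ y z d → d :- :- (y :- z) := y :- (z :- d)) ≈-refl y z δ) fix) (diff≽0 k)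
        , by-diff (diff≽0 h) (≈-trans (solve 3 (λ y z d → d :- (y :- z) := ((con (ℤ.+ 0) :+ d) :+ d) :- (y :- (z :- d))) ≈-refl y z δ) (F.+-congˡ (F.-‿cong fix)))
        where
        fix : y ⊖ (z ⊖ δ) ≈ y ⊖ (Z ⊖ δ)
        fix = F.+-congˡ (F.-‿cong (F.+-congʳ e))

      wide : ∀ {y z} → AbsLe R z → AbsLe δ (y ⊖ z) → 0# ≼ y ⊕ (R ⊕ δ) × y ⊕ (R ⊕ δ) ≼ suc Q · δ
      wide {y} {z} hz hy =
        let h , k = AbsLe-cong (solve 2 (λ z y → z :+ (y :- z) := y) ≈-refl z y) (AbsLe-+ hz hy) in
        ≼-respʳ (solve 2 (λ w y → w :- :- y := y :+ w) ≈-refl (R ⊕ δ) y) (diff≽0 k) , ≼-trans (⊕-mono h ≼-refl) Qδ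

      slot : ∀ {i} side {yx yy} → side < 4 → Inner (dx i) (dy i) (r i) yx yy →
             0# ≼ across side yx yy × across side yx yy ≼ 2 · δ →
             0# ≼ along side yx yy × along side yx yy ≼ suc Q · δ → ∃ (Slot i)
      slot side {yx} {yy} s<4 inn (a , b) (a′ , b′) =
        let u<2 , cu = cell-spec 1 a b
            v<Q , cv = cell-spec Q a′ b′
        in (side , _ , _) , (s<4 , u<2 , v<Q) , yx , yy , inn , cu , cv

      place : ∀ {i} → δ ≼ r i → BoundaryPoint {dx i} {dy i} {r i} → ∃ (Slot i)
      place {i} δ≤r (zx , zy , z∈ , hx , hy , side) =
        let yx , yy , inn , ex , ey = shrink δ≤r z∈ in
        [ [ (λ e → slot 0 (s≤s z≤n) inn (strip e ex) (wide hy ey))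
          , (λ e → slot 1 (s≤s (s≤s z≤n)) inn (strip e ex) (wide hy ey)) ]′
        , [ (λ e → slot 2 (s≤s (s≤s (s≤s z≤n))) inn (strip e ey) (wide hx ex))
          , (λ e → slot 3 (s≤s (s≤s (s≤s (s≤s z≤n)))) inn (strip e ey) (wide hx ex)) ]′ ]′ side

      close : ∀ {q a b w} → InCell q δ (a ⊕ w) → InCell q δ (b ⊕ w) → AbsLe δ (b ⊖ a)
      close {q} {a} {b} {w} h k =
          ≼-respˡ (solve 3 (λ a b w → (b :+ w) :- (a :+ w) := b :- a) ≈-refl a b w) (cell-close {q} k h)
        , ≼-respˡ (solve 3 (λ a b w → (a :+ w) :- (b :+ w) := :- (b :- a)) ≈-refl a b w) (cell-close {q} h k)

      same-slot : ∀ {i j side u v} → i < n → j < n → Slot i (side , u , v) → Slot j (side , u , v) → meet i j ≡ true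
      same-slot {i} {j} {side} {u} {v} i<n j<n (_ , yx , yy , inn , cu , cv) (_ , yx′ , yy′ , inn′ , cu′ , cv′) =
        let hx , hy = deltas side cu cu′ cv cv′
            _ , _ , p , q = close⇒common-point inn inn′ hx hy
        in point⇒meet i<n j<n (to-absolute {i} p) (to-absolute {j} q)
        where
        deltas : ∀ side → InCell u δ (across side yx yy) → InCell u δ (across side yx′ yy′) →
                 InCell v δ (along side yx yy) → InCell v δ (along side yx′ yy′) → AbsLe δ (yx′ ⊖ yx) × AbsLe δ (yy′ ⊖ yy)
        deltas 0 a b c d = close {u} a b , close {v} c d
        deltas 1 a b c d = close {u} a b , close {v} c d
        deltas 2 a b c d = close {v} c d , close {u} a b
        deltas (suc (suc (suc _))) a b c d = close {v} c d , close {u} a b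

      packing : ∀ {A} → Independent A → (∀ {i} → i < n → A i ≡ true → ∃ (Slot i)) → ♯ A ≤ 4 * (2 * (suc Q * 1))
      packing {A} ind h =
        ♯-classes 4 side (λ l a → proj₁ (proj₁ (spec l a))) λ {s} _ →
        ♯-classes 2 u (λ l a → proj₁ (proj₂ (proj₁ (spec l (∧-fst a))))) λ {a} _ →
        ♯-classes (suc Q) v (λ {i} l a → proj₂ (proj₂ (proj₁ (spec l (∧-fst {A i} (∧-fst a)))))) λ {b} _ →
        ♯-≤1 λ {i} {j} i<n j<n p q → unique i<n j<n
          (∧-fst (∧-fst (∧-fst p))) (∧-fst (∧-fst (∧-fst q)))
          (from-yes! (_ ℕ.≟ _) (∧-snd {A i} (∧-fst (∧-fst p)))) (from-yes! (_ ℕ.≟ _) (∧-snd {A j} (∧-fst (∧-fst q))))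
          (from-yes! (_ ℕ.≟ _) (∧-snd {A i ∧ _} (∧-fst p))) (from-yes! (_ ℕ.≟ _) (∧-snd {A j ∧ _} (∧-fst q)))
          (from-yes! (_ ℕ.≟ _) (∧-snd {(A i ∧ _) ∧ _} p)) (from-yes! (_ ℕ.≟ _) (∧-snd {(A j ∧ _) ∧ _} q))
        where
        slotOf : ∀ i → ∃[ b ] (i < n → A i ≡ true → Slot i b)
        slotOf = pick (0 , 0 , 0) h
        side u v : ℕ → ℕ
        side i = proj₁ (proj₁ (slotOf i))
        u i = proj₁ (proj₂ (proj₁ (slotOf i)))
        v i = proj₂ (proj₂ (proj₁ (slotOf i)))
        spec : ∀ {i} → i < n → A i ≡ true → Slot i (side i , u i , v i)
        spec {i} = proj₂ (slotOf i)
        same : ∀ {i j s a b} → i < n → j < n → Slot i (s , a , b) → ∀ {s′ a′ b′} → Slot j (s′ , a′ , b′) →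
               s ≡ s′ → a ≡ a′ → b ≡ b′ → meet i j ≡ true
        same i<n j<n p q refl refl refl = same-slot i<n j<n p q
        unique : ∀ {i j s a b} → i < n → j < n → A i ≡ true → A j ≡ true → side i ≡ s → side j ≡ s →
                 u i ≡ a → u j ≡ a → v i ≡ b → v j ≡ b → i ≡ j
        unique {i} {j} i<n j<n Ai Aj e e′ f f′ g g′ with i ℕ.≟ j
        ... | yes i≡j = i≡j
        ... | no ne   = ⊥-elim (true≢false
            (same i<n j<n (spec i<n Ai) (spec j<n Aj) (trans e (sym e′)) (trans f (sym f′)) (trans g (sym g′))) (ind i<n j<n Ai Aj ne))

      big-crossings : ∀ {A} → Independent A →
        (∀ {i} → i < n → A i ≡ true → δ ≼ r i × Touches R i × ¬ ψ c i ≼ R) → ♯ A ≤ 4 * (2 * (suc Q * 1))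
      big-crossings ind h = packing ind λ i<n a →
        let δ≤r , (_ , _ , a∈ , hx , hy) , out = h i<n a
            _ , _ , b∈ , ¬box = protrudes out
        in place δ≤r (boundary-point a∈ hx hy b∈ ¬box)

  -- Balls around centres and the choice of the scale

  ball : Subset → ℕ → ℕ → Subset
  ball X i l = X ∩ (λ j → ⌊ dist i j ≼? dist i l ⌋)

  -- Only distances to centres of `X` serve as radii, since the number of centres in a ball changes
  -- at no other value.
  heavy : Subset → ℕ → ℕ → Subset
  heavy X p i = X ∩ (λ l → ⌊ p ℕ.≤? ♯ (ball X i l) ⌋)

  -- A ball around a centre in X with at least p centres, of least possible radius.
  record Scale (X : Subset) (p : ℕ) : Set where
    field
      c l₀    : ℕ
      c<n     : c < n
      Xc      : X c ≡ true
      t-heavy : p ≤ ♯ (ball X c l₀)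
      t-least : ∀ {i l} → i < n → l < n → X i ≡ true → heavy X p i l ≡ true → dist c l₀ ≼ dist i l

  -- The ball that just reaches the farthest centre of `X` contains all of them.
  some-heavy : ∀ {X p} → 1 ≤ p → p ≤ ♯ X → ∀ i → ∃[ l ] l < n × heavy X p i l ≡ true
  some-heavy {X} {p} 1≤p p≤X i =
    let x₀ , x₀<n , Xx₀ = ♯-witness (≤-trans 1≤p p≤X)
        l , l<n , Xl , far = greatest {λ a b → dist i a ≼ dist i b} ≼-trans (λ a b → ≼-total _ _) X x₀<n Xx₀
    in l , l<n , ∧-pair Xl (yes! (p ℕ.≤? _) (≤-trans p≤X (♯-mono λ j<n Xj → ∧-pair Xj (yes! (_ ≼? _) (far j<n Xj)))))

  Nearest : Subset → ℕ → ℕ → ℕ → Set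
  Nearest X p i l = l < n × heavy X p i l ≡ true × (∀ {j} → j < n → heavy X p i j ≡ true → dist i l ≼ dist i j)

  nearest-heavy : ∀ {X p} → 1 ≤ p → p ≤ ♯ X → ∀ i → ∃ (Nearest X p i)
  nearest-heavy {X} {p} 1≤p p≤X i = let x₀ , x₀<n , h = some-heavy 1≤p p≤X i in
    greatest {λ a b → dist i b ≼ dist i a} (λ h k → ≼-trans k h) (λ a b → ≼-total _ _) (heavy X p i) x₀<n h

  lightest : ∀ {X p} (l : ℕ → ℕ) → (∀ i → Nearest X p i (l i)) → 1 ≤ p → p ≤ ♯ X → Scale X p
  lightest {X} {p} l near 1≤p p≤X =
    let x₀ , x₀<n , Xx₀ = ♯-witness (≤-trans 1≤p p≤X)
        c , c<n , Xc , least = greatest {λ a b → dist b (l b) ≼ dist a (l a)}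
                                 (λ h k → ≼-trans k h) (λ a b → ≼-total _ _) X x₀<n Xx₀
    in record
      { c = c ; l₀ = l c ; c<n = c<n ; Xc = Xc
      ; t-heavy = from-yes! (p ℕ.≤? _) (∧-snd {X (l c)} (proj₁ (proj₂ (near c))))
      ; t-least = λ {i} {j} i<n j<n Xi h → ≼-trans (least i<n Xi) (proj₂ (proj₂ (near i)) j<n h)
      }

  scale : ∀ {X p} → 1 ≤ p → p ≤ ♯ X → Scale X p
  scale 1≤p p≤X = lightest (λ i → proj₁ (nearest-heavy 1≤p p≤X i)) (λ i → proj₂ (nearest-heavy 1≤p p≤X i)) 1≤p p≤X

  module Large {X : Subset} (ind : Independent X) (p s : ℕ) (2≤p : 2 ≤ p) (sc : Scale X p)
               (X<JJ : ♯ X < suc s * suc s) where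
    open Scale sc

    t : Carrier
    t = dist c l₀

    -- Otherwise the ball around a centre of `A` that just reaches the rest of `A` would be heavy,
    -- with a radius less than `t`.
    sparse : ∀ {A} → A ⊆ X → (∀ {i j} → i < n → j < n → A i ≡ true → A j ≡ true → dist i j ≺ t) → suc (♯ A) ≤ p
    sparse {A} A⊆X close = ≰⇒> λ p≤A →
      let i , i<n , Ai = ♯-witness (≤-trans (≤-trans (s≤s z≤n) 2≤p) p≤A)
          l , l<n , Al , far = greatest {λ a b → dist i a ≼ dist i b} ≼-trans (λ a b → ≼-total _ _) A i<n Ai
      in close i<n l<n Ai Al (t-least i<n l<n (A⊆X i<n Ai) (∧-pair (A⊆X l<n Al) (yes! (p ℕ.≤? _)
           (≤-trans p≤A (♯-mono λ j<n Aj → ∧-pair (A⊆X j<n Aj) (yes! (_ ≼? _) (far j<n Aj)))))))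

    -- A ball of radius 0 with at least two centres would give two disks with the same centre, and
    -- these meet.
    0≺t : 0# ≺ t
    0≺t t≼0 = <⇒≱ 2≤p (≤-trans t-heavy (♯-≤1 λ {i} {j} i<n j<n bi bj → trans (sym (only i<n bi)) (only j<n bj)))
      where
      only : ∀ {i} → i < n → ball X c l₀ i ≡ true → c ≡ i
      only {i} i<n b with ℕ._≟_ c i
      ... | yes e = e
      ... | no ne = ⊥-elim (true≢false (dist0⇒meet (≼-trans (from-yes! (_ ≼? _) (∧-snd {X i} b)) t≼0))
                                       (ind c<n i<n Xc (∧-fst b) ne))

    open Relative c

    crowd : ∀ {A q} → p ≡ suc q → A ⊆ X → (∀ {i} → i < n → A i ≡ true → Range t (dx i) × Range t (dy i)) → ♯ A ≤ 3 * (3 * q)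
    crowd {A} {q} refl A⊆X range =
      ♯-classes 3 (λ i → third t (dx i)) (λ _ _ → third<3 t _) λ {u} _ →
      ♯-classes 3 (λ i → third t (dy i)) (λ _ _ → third<3 t _) λ {v} _ →
      ≤-pred (sparse (λ i<n a → A⊆X i<n (∧-fst (∧-fst a))) λ {i} {j} i<n j<n a b →
        let cx = same {dx} (∧-snd {A i} (∧-fst a)) (∧-snd {A j} (∧-fst b))
            cy = same {dy} (∧-snd {A i ∧ _} a) (∧-snd {A j ∧ _} b)
            rix , riy = range i<n (∧-fst (∧-fst a))
            rjx , rjy = range j<n (∧-fst (∧-fst b))
        in maxr-≺ (maxr-≺ (cancel x i j (third-close rjx rix (sym cx))) (cancel x j i (third-close rix rjx cx)))
                  (maxr-≺ (cancel y i j (third-close rjy riy (sym cy))) (cancel y j i (third-close riy rjy cy))))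
      where
      same : ∀ {f i j u} → ⌊ third t (f i) ℕ.≟ u ⌋ ≡ true → ⌊ third t (f j) ℕ.≟ u ⌋ ≡ true → third t (f i) ≡ third t (f j)
      same a b = trans (from-yes! (_ ℕ.≟ _) a) (sym (from-yes! (_ ℕ.≟ _) b))
      cancel : ∀ (z : ℕ → Carrier) i j → (z j ⊖ z c) ⊖ (z i ⊖ z c) ≺ t → z j ⊖ z i ≺ t
      cancel z i j h = ≼-≺-trans (≼-reflexive (solve 3 (λ a b c → a :- b := (a :- c) :- (b :- c)) ≈-refl (z j) (z i) (z c))) h

    -- `δ` is `t / (4 (s + 1))`, so that even the last of the `s + 1` squares satisfies
    -- `2 R + 4 δ ≤ 3 t`. Its half-side is then less than `3 t / 2`, as `crowd` demands.
    module Levels (δ : Carrier) (0≺δ : 0# ≺ δ) (δ≈t : suc (3 + 4 * s) · δ ≈ t) where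

      -- Consecutive levels are 2δ apart, so a disk of radius less than δ crosses at most one.
      R : ℕ → Carrier
      R q = t ⊕ (q + q) · δ

      In : ℕ → Subset
      In q i = ⌊ ψ c i ≼? R q ⌋

      -- A disk that protrudes from the square only has to be removed if it meets a disk inside it.
      hit : ℕ → Subset
      hit q i = ⌊ dist c i ≼? R q ⌋ ∨ any n (λ j → In q j ∧ meet j i)

      S : ℕ → Subset
      S q = X ∩ ((λ i → not (In q i)) ∩ hit q)

      big : Subset
      big i = ⌊ δ ≼? r i ⌋

      t≼R : ∀ q → t ≼ R q
      t≼R q = by-diff (0≼· (q + q) (≺⇒≼ 0≺δ)) (solve 2 (λ t a → a := (t :+ a) :- t) ≈-refl t _)

      0≼R : ∀ q → 0# ≼ R q
      0≼R q = ≼-trans (≺⇒≼ 0≺t) (t≼R q)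

      R-step : ∀ {q q′} → q < q′ → R q ⊕ (δ ⊕ δ) ≼ R q′
      R-step {q} {q′} l = ≼-respˡ (solve 3 (λ t a d → t :+ ((a :+ d) :+ d) := (t :+ a) :+ (d :+ d)) ≈-refl t ((q + q) · δ) δ)
        (⊕-mono ≼-refl (·-mono (≺⇒≼ 0≺δ) (≤-trans (s≤s (≤-reflexive (sym (+-suc q q)))) (+-mono-≤ l l))))

      R-bound : ∀ {q} → q < suc s → (R q ⊕ R q) ⊕ 4 · δ ≼ t ⊕ t ⊕ t
      R-bound {q} (s≤s l) = ≼-respˡ
        (≈-trans (F.+-congˡ (≈-trans (·-+ (q + q + (q + q)) 4 δ) (F.+-congʳ (·-+ (q + q) (q + q) δ))))
          (solve 3 (λ t a b → (t :+ t) :+ ((a :+ a) :+ b) := ((t :+ a) :+ (t :+ a)) :+ b) ≈-refl t ((q + q) · δ) (4 · δ)))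
        (⊕-mono ≼-refl (≼-respʳ δ≈t (·-mono (≺⇒≼ 0≺δ)
          (≤-trans (+-monoˡ-≤ 4 (+-mono-≤ (+-mono-≤ l l) (+-mono-≤ l l))) (≤-reflexive (four s))))))
        where
        four : ∀ s → s + s + (s + s) + 4 ≡ suc (3 + 4 * s)
        four = solve-∀

      R-range : ∀ {q u} → q < suc s → AbsLe (R q) u → Range t u
      R-range {q} {u} l (h , k) =
        ≼-≺-trans (⊕-mono h h) below , ≼-≺-trans (≼-respˡ (solve 1 (λ u → (:- u) :+ (:- u) := :- (u :+ u)) ≈-refl u) (⊕-mono k k)) below
        where
        below : R q ⊕ R q ≺ t ⊕ t ⊕ t
        below = ≺-≼-trans (by-diff≺ (0≺4δ) (solve 2 (λ a b → b := (a :+ b) :- a) ≈-refl _ _)) (R-bound l)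
          where
          0≺4δ : 0# ≺ 4 · δ
          0≺4δ = ≺-≼-trans 0≺δ (by-diff (0≼· 3 (≺⇒≼ 0≺δ)) (solve 2 (λ a b → a := (a :+ b) :- b) ≈-refl (3 · δ) δ))

      S-out : ∀ {q i} → S q i ≡ true → ¬ ψ c i ≼ R q
      S-out {q} {i} Si h = true≢false (yes! (_ ≼? _) h) (not-true (∧-fst (∧-snd {X i} Si)))

      S-touches : ∀ {q i} → i < n → S q i ≡ true → Touches (R q) i
      S-touches {q} {i} i<n Si = ∨-elim (∧-snd {not (In q i)} (∧-snd {X i} Si))
        (λ h → dx i , dy i , ≼-respˡ (solve 2 (λ a b → con (ℤ.+ 0) := (a :- a) :* (a :- a) :+ (b :- b) :* (b :- b)) ≈-refl (dx i) (dy i)) (0≼sq (r i)) ,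
               dist⇒AbsLe (from-yes! (dist c i ≼? R q) h))
        (λ h → let j , j<n , e = any-witness n h
                   _ , _ , pj , pi = meet⇒point j<n i<n (∧-snd {In q j} e)
               in _ , _ , to-relative {i} pi , inside j<n (from-yes! (ψ c j ≼? R q) (∧-fst e)) pj)

      -- A disk of radius at most `δ` that reaches one square lies inside every later one.
      small-once : ∀ {q q′ i} → q < q′ → q′ < suc s → i < n → (S q ∖ big) i ≡ true → (S q′ ∖ big) i ≡ false
      small-once {q} {q′} {i} q<q′ _ i<n h = [ (λ h′ → ⊥-elim (S-out {q′} (∧-fst h′) bound)) , (λ f → f) ]′ (true-or-false _)
        where
        r≼δ : r i ≼ δ
        r≼δ = ≺⇒≼ (from-no! (δ ≼? r i) (not-true (∧-snd {S q i} h)))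
        bound : ψ c i ≼ R q′
        bound = ≼-trans (ψ-touching i<n (S-touches {q} i<n (∧-fst h)))
                  (≼-trans (⊕-mono ≼-refl (⊕-mono r≼δ r≼δ)) (R-step q<q′))

      -- If each of the `s + 1` disjoint sets had more than `s` disks, `X` would have at least
      -- `(s + 1)²`.
      sparse-level : ∃[ q ] q < suc s × ♯ (S q ∖ big) ≤ s
      sparse-level = [ (λ h → let q , q<J , e = any-witness (suc s) h in q , q<J , ≤-pred (from-yes! (_ ℕ.≤? _) e))
                     , (λ h → ⊥-elim (<⇒≱ X<JJ (♯-disjoint-family (suc s) (λ q → S q ∖ big)
                                (λ _ _ e → ∧-fst (∧-fst e)) small-once (λ {q} q<J → crowded h q<J)))) ]′
                     (true-or-false (any (suc s) (λ q → ⌊ suc (♯ (S q ∖ big)) ℕ.≤? suc s ⌋)))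
        where
        crowded : any (suc s) (λ q → ⌊ suc (♯ (S q ∖ big)) ℕ.≤? suc s ⌋) ≡ false → ∀ {q} → q < suc s → suc s ≤ ♯ (S q ∖ big)
        crowded h {q} q<J = ≮⇒≥ λ l → true≢false (any-intro (suc s) q<J (yes! (_ ℕ.≤? _) l)) h

      -- The right side is `3 t`, that is `12 (s + 1)` times `δ`; it covers a side of the square and
      -- `δ` beyond either end.
      R-cells : ∀ {q} → q < suc s → (R q ⊕ δ) ⊕ (R q ⊕ δ) ≼ suc (11 + 12 * s) · δ
      R-cells {q} q<J = ≼-trans
        (by-diff (0≼· 2 (≺⇒≼ 0≺δ)) (solve 2 (λ R d → (con (ℤ.+ 0) :+ d) :+ d := ((R :+ R) :+ ((((con (ℤ.+ 0) :+ d) :+ d) :+ d) :+ d)) :- ((R :+ d) :+ (R :+ d))) ≈-refl (R q) δ))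
        (≼-trans (R-bound q<J) (≼-reflexive (≈-sym (≈-trans (≈-reflexive (cong (_· δ) (twelve s)))
          (≈-trans (·-+ (u + u) u δ) (F.+-cong (≈-trans (·-+ u u δ) (F.+-cong δ≈t δ≈t)) δ≈t))))))
        where
        u : ℕ
        u = suc (3 + 4 * s)
        twelve : ∀ s → suc (11 + 12 * s) ≡ suc (3 + 4 * s) + suc (3 + 4 * s) + suc (3 + 4 * s)
        twelve = solve-∀

      ♯S-bound : ∀ {q} → q < suc s → ♯ (S q ∖ big) ≤ s → ♯ (S q) ≤ 4 * (2 * (suc (11 + 12 * s) * 1)) + s
      ♯S-bound {q} q<J few = ≤-trans (≤-reflexive (♯-split (S q) big)) (+-mono-≤
        (Packing.big-crossings (0≼R q) 0≺δ (11 + 12 * s) (R-cells q<J)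
          (λ i<n j<n a b → ind i<n j<n (∧-fst (∧-fst a)) (∧-fst (∧-fst b)))
          (λ {i} i<n a → from-yes! (δ ≼? r i) (∧-snd {S q i} a) , S-touches {q} i<n (∧-fst a) , S-out {q} (∧-fst a)))
        few)

      ♯I-bound : ∀ {q p′} → q < suc s → p ≡ suc p′ → ♯ ((X ∖ S q) ∩ In q) ≤ 3 * (3 * p′)
      ♯I-bound {q} q<J e = crowd e (λ _ a → ∧-fst (∧-fst a)) λ {i} i<n a →
        let hx , hy = dist⇒AbsLe (≼-trans (by-diff (≺⇒≼ (r>0 i<n)) (solve 2 (λ d r → r := (d :+ r) :- d) ≈-refl (dist c i) (r i)))
                                          (from-yes! (ψ c i ≼? R q) (∧-snd {(X ∖ S q) i} a)))
        in R-range q<J hx , R-range q<J hy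

      not-S : ∀ {q u} → ((X ∖ S q) ∖ In q) u ≡ true → ¬ hit q u ≡ true
      not-S {q} {u} h k = true≢false (∧-pair (∧-fst {X u} h′) (∧-pair (∧-snd {(X ∖ S q) u} h) k)) (not-true (∧-snd {X u} h′))
        where
        h′ : (X ∖ S q) u ≡ true
        h′ = ∧-fst h

      -- A disk with its centre in the square is either removed or inside. So none of the `p` or
      -- more centres in the ball of radius `t` belongs to the outside part.
      ♯U-bound : ∀ q → ♯ ((X ∖ S q) ∖ In q) + p ≤ ♯ X
      ♯U-bound q = ≤-trans (+-mono-≤ (♯-mono {(X ∖ S q) ∖ In q} {X ∖ ball X c l₀} away) (≤-trans t-heavy (♯-mono {ball X c l₀} λ {i} _ b → ∧-pair (∧-fst {X i} b) b)))
        (≤-reflexive (trans (+-comm (♯ (X ∖ ball X c l₀)) _) (sym (♯-split X (ball X c l₀)))))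
        where
        away : (X ∖ S q) ∖ In q ⊆ X ∖ ball X c l₀
        away {u} _ h = ∧-pair (∧-fst {X u} (∧-fst {(X ∖ S q) u} h)) (not-false ([ (λ b → ⊥-elim (not-S {q} h (∨-left
          (yes! (_ ≼? _) (≼-trans (from-yes! (_ ≼? _) (∧-snd {X u} b)) (t≼R q)))))) , (λ f → f) ]′ (true-or-false (ball X c l₀ u))))

      -- The square shrinks to the outermost disk of `X` inside it. The guard contains all input
      -- disks in that square, which is why `hit` ranges over all positions and not only over `X`.
      guard : ∀ q → ∃[ G ] ((X ∖ S q) ∩ In q ⊆ ⟪ G ⟫) ×
              (∀ {g u} → g < n → u < n → ⟪ G ⟫ g ≡ true → ((X ∖ S q) ∖ In q) u ≡ true → meet g u ≡ false)
      guard q = [ (λ h → nonempty (any-witness n h)) , empty ]′ (true-or-false (any n (X ∩ In q)))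
        where
        Guard : Basic → Set
        Guard G = ((X ∖ S q) ∩ In q ⊆ ⟪ G ⟫) ×
              (∀ {g u} → g < n → u < n → ⟪ G ⟫ g ≡ true → ((X ∖ S q) ∖ In q) u ≡ true → meet g u ≡ false)
        nonempty : ∃[ i ] i < n × (X ∩ In q) i ≡ true → ∃ Guard
        nonempty (i , i<n , e) =
          let l , l<n , XIl , top = greatest {λ a b → ψ c a ≼ ψ c b} ≼-trans (λ a b → ≼-total _ _) (X ∩ In q) i<n e in
          row c l c<n l<n ,
          (λ {j} j<n a → yes! (_ ≼? _) (top j<n (∧-pair (∧-fst (∧-fst a)) (∧-snd {(X ∖ S q) j} a)))) ,
          λ {g} {u} g<n u<n Gg Uu → [ (λ m → ⊥-elim (not-S {q} Uu (∨-right (any-intro n g<n (∧-pair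
              (yes! (_ ≼? _) (≼-trans (from-yes! (_ ≼? _) Gg) (from-yes! (_ ≼? _) (∧-snd {X l} XIl)))) m)))))
            , (λ f → f) ]′ (true-or-false (meet g u))
        -- With nothing of `X` inside, disk `c` serves as the guard. It is removed, since its centre
        -- is in the square, so by independence it meets no disk of the outside part.
        empty : any n (X ∩ In q) ≡ false → ∃ Guard
        empty h = single c c<n ,
          (λ i<n a → ⊥-elim (true≢false (any-intro n i<n (∧-pair (∧-fst (∧-fst a)) (∧-snd {(X ∖ S q) _} a))) h)) ,
          λ {g} {u} g<n u<n Gg Uu → subst (λ g → meet g u ≡ false) (⁅⁆-≡ Gg) (ind c<n u<n Xc (∧-fst (∧-fst Uu))
            λ { refl → not-S {q} Uu (∨-left (yes! (_ ≼? _) (dist-self (0≼R q)))) })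

  large-separation : ∀ {X} → Independent X → 21 ≤ ♯ X → Separation X
  large-separation {X} ind big = assemble (divide (3 + 4 * s) L.0≺t)
    where
    m p′ s : ℕ
    m = ♯ X
    -- `suc p′` is the least integer above `m / 10`. Thus `9 * p′` disks inside and `m ∸ suc p′`
    -- outside are both at most nine tenths of `m`.
    p′ = m / 10
    s = isqrt m
    10p′≤m : 10 * p′ ≤ m
    10p′≤m = ≤-trans (≤-reflexive (*-comm 10 p′)) (m/n*n≤m m 10)
    m<10p : m ≤ 10 * suc p′
    m<10p = ≤-trans (≤-reflexive (m≡m%n+[m/n]*n m 10)) (≤-trans (+-mono-≤ (<⇒≤ (m%n<n m 10)) (≤-reflexive (*-comm p′ 10))) (≤-reflexive (sym (*-suc 10 p′))))
    2≤p : 2 ≤ suc p′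
    2≤p = s≤s (≮⇒≥ λ l → <⇒≱ (s≤s (s≤s (s≤s (s≤s (s≤s (s≤s (s≤s (s≤s (s≤s (s≤s (s≤s z≤n))))))))))) (≤-trans big (≤-trans m<10p (*-monoʳ-≤ 10 l))))
    p≤m : suc p′ ≤ m
    p≤m = ≤-trans (+-mono-≤ (≤-pred 2≤p) ≤-refl) (≤-trans (≤-trans (≤-reflexive (cong (λ k → p′ + k) (sym (+-identityʳ p′)))) (*-monoˡ-≤ p′ {2} {10} (s≤s (s≤s z≤n)))) 10p′≤m)
    4≤s : 4 ≤ s
    4≤s = ≮⇒≥ λ l → <⇒≱ (≤-trans (m≤n+m 17 4) big) (≤-trans (<⇒≤ (isqrt-upper m)) (*-mono-≤ l l))
    module L = Large ind (suc p′) s 2≤p (scale (s≤s z≤n) p≤m) (isqrt-upper m)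
    -- The `8 * 12 (s + 1)` slots and `s` small disks make `96 + 97 s`; since more than 20 disks
    -- give `s ≥ 4`, the 96 is at most `24 s`. Hence the 121.
    count : ∀ {a} → a ≤ 4 * (2 * (suc (11 + 12 * s) * 1)) + s → a * a ≤ separatorConstant * m
    count {a} h = square-bound {k = 121} {a} {s} separatorConstant-≡ a≤ (isqrt-lower m)
      where
      expand : ∀ s → 4 * (2 * (suc (11 + 12 * s) * 1)) + s ≡ 24 * 4 + 97 * s
      expand = solve-∀
      collect : ∀ s → 24 * s + 97 * s ≡ 121 * s
      collect = solve-∀
      a≤ : a ≤ 121 * s
      a≤ = ≤-trans h (≤-trans (≤-reflexive (expand s)) (≤-trans (+-monoˡ-≤ (97 * s) (*-monoʳ-≤ 24 4≤s)) (≤-reflexive (collect s))))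
    assemble : ∃[ δ ] 0# ≺ δ × suc (3 + 4 * s) · δ ≈ L.t → Separation X
    assemble (δ , 0≺δ , δ≈t) = let q , q<J , few = V.sparse-level
                                   G , I⊆ , G⊥ = V.guard q in record
      { S = V.S q ; In = V.In q ; G = G
      ; S⊆X = λ {i} _ → ∧-fst {X i}
      ; I⊆G = I⊆
      ; G⊥U = G⊥
      ; ♯I≤ = ≤-trans (*-monoʳ-≤ 10 (V.♯I-bound q<J refl)) (≤-trans (≤-reflexive (nine p′)) (*-monoʳ-≤ 9 10p′≤m))
      ; ♯U≤ = outer (V.♯U-bound q)
      ; ♯S≤ = count (V.♯S-bound q<J few)
      }
      where
      module V = L.Levels δ 0≺δ δ≈t
      ten : ∀ a → 10 * a ≡ 9 * a + a
      ten = solve-∀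
      outer : ∀ {u} → u + suc p′ ≤ m → 10 * u ≤ 9 * m
      outer {u} h = +-cancelʳ-≤ m (10 * u) (9 * m) (≤-trans (+-monoʳ-≤ (10 * u) m<10p)
        (≤-trans (≤-reflexive (sym (*-distribˡ-+ 10 u (suc p′)))) (≤-trans (*-monoʳ-≤ 10 h) (≤-reflexive (ten m)))))
      nine : ∀ a → 10 * (3 * (3 * a)) ≡ 9 * (10 * a)
      nine = solve-∀

  separation : ∀ {X} → Independent X → 1 ≤ ♯ X → Separation X
  separation {X} ind pos with ♯ X ℕ.≤? 20
  ... | yes l = small-separation l pos
  ... | no ¬l = large-separation ind (≰⇒> ¬l)

-- Decomposition of a solution

-- Since `(s + 1)² ≤ 2 (s² + 1)` and `1 ≤ m`, the square of `c (s + 1)` is at most `2 c² (K + 1) m`.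
budget-bound : ∀ c {K s b m} → s * s ≤ K * m → 1 ≤ m → ((c * c) * (2 * (K + 1))) * m ≤ b * b → c * suc s ≤ b
budget-bound c {K} {s} {b} {m} s²≤ 1≤m h = ≮⇒≥ λ b<cs → <⇒≱ (*-mono-< b<cs b<cs) (begin
  (c * suc s) * (c * suc s)                ≡⟨ expand c s ⟩
  (c * c) * (s * s + 1 + 2 * s)            ≤⟨ *-monoʳ-≤ (c * c) (+-monoʳ-≤ (s * s + 1) (twice s)) ⟩
  (c * c) * (s * s + 1 + (s * s + 1))      ≤⟨ *-monoʳ-≤ (c * c) (+-mono-≤ (+-mono-≤ s²≤ 1≤m) (+-mono-≤ s²≤ 1≤m)) ⟩
  (c * c) * (K * m + m + (K * m + m))      ≡⟨ collect c K m ⟩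
  ((c * c) * (2 * (K + 1))) * m            ≤⟨ h ⟩
  b * b                                    ∎)
  where
  open ≤-Reasoning
  expand : ∀ c s → (c * suc s) * (c * suc s) ≡ (c * c) * (s * s + 1 + 2 * s)
  expand = solve-∀
  collect : ∀ c K m → (c * c) * (K * m + m + (K * m + m)) ≡ ((c * c) * (2 * (K + 1))) * m
  collect = solve-∀
  twice : ∀ s → 2 * s ≤ s * s + 1
  twice zero    = z≤n
  twice (suc k) = ≤-trans (m≤m+n (2 * suc k) (k * k)) (≤-reflexive (square k))
    where
    square : ∀ k → 2 * suc k + k * k ≡ suc k * suc k + 1
    square = solve-∀

-- Since 20 d ≤ b′ + d, the square of b′ is at least 0.9 (b′ + d)².
budget-shrinks : ∀ {C m m′ b′ d} → C * m ≤ (b′ + d) * (b′ + d) → 20 * d ≤ b′ + d → 10 * m′ ≤ 9 * m → C * m′ ≤ b′ * b′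
budget-shrinks {C} {m} {m′} {b′} {d} h 20d≤ m′≤ = *-cancelˡ-≤ 10 (begin
  10 * (C * m′)                                  ≡⟨ shuffle 10 C m′ ⟩
  C * (10 * m′)                                  ≤⟨ *-monoʳ-≤ C m′≤ ⟩
  C * (9 * m)                                    ≡⟨ shuffle C 9 m ⟩
  9 * (C * m)                                    ≤⟨ *-monoʳ-≤ 9 h ⟩
  9 * ((b′ + d) * (b′ + d))                      ≡⟨ expand b′ d ⟩
  9 * (b′ * b′) + (18 * d * b′ + d * (9 * d))    ≤⟨ +-monoʳ-≤ (9 * (b′ * b′)) (+-monoʳ-≤ (18 * d * b′) (*-monoʳ-≤ d 9d≤)) ⟩
  9 * (b′ * b′) + (18 * d * b′ + d * b′)         ≡⟨ cong (λ k → 9 * (b′ * b′) + k) (collect d b′) ⟩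
  9 * (b′ * b′) + (19 * d) * b′                  ≤⟨ +-monoʳ-≤ (9 * (b′ * b′)) (*-monoˡ-≤ b′ 19d≤) ⟩
  9 * (b′ * b′) + b′ * b′                        ≡⟨ ten (b′ * b′) ⟩
  10 * (b′ * b′)                                 ∎)
  where
  open ≤-Reasoning
  shuffle : ∀ a b c → a * (b * c) ≡ b * (a * c)
  shuffle = solve-∀
  expand : ∀ b d → 9 * ((b + d) * (b + d)) ≡ 9 * (b * b) + (18 * d * b + d * (9 * d))
  expand = solve-∀
  collect : ∀ d b → 18 * d * b + d * b ≡ (19 * d) * b
  collect = solve-∀
  ten : ∀ k → 9 * k + k ≡ 10 * k
  ten = solve-∀
  nineteen : ∀ d → 20 * d ≡ 19 * d + d
  nineteen = solve-∀
  19d≤ : 19 * d ≤ b′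
  19d≤ = +-cancelʳ-≤ d _ _ (≤-trans (≤-reflexive (sym (nineteen d))) 20d≤)
  9d≤ : 9 * d ≤ b′
  9d≤ = ≤-trans (*-monoˡ-≤ d (m≤m+n 9 10)) 19d≤

abstract
  -- Chosen so that one separator spends at most a twentieth of the budget. A twentieth is little
  -- enough because `(19 / 20)²` exceeds `9 / 10`, the factor by which the parts shrink.
  budgetConstant : ℕ
  budgetConstant = (20 * 20) * (2 * (separatorConstant + 1))

  budgetConstant-≡ : budgetConstant ≡ (20 * 20) * (2 * (separatorConstant + 1))
  budgetConstant-≡ = refl

  1≤budgetConstant : 1 ≤ budgetConstant
  1≤budgetConstant = *-mono-≤ {1} {20 * 20} (s≤s z≤n) (*-mono-≤ {1} {2} (s≤s z≤n) (m≤n+m 1 separatorConstant))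

module Decomposition (ℝ : RealNumbers) (n : ℕ) (x y r : ℕ → RealNumbers.Carrier ℝ)
                     (r>0 : ∀ {i} → i < n → OrderedField._≺_ ℝ (RealNumbers.0# ℝ) (r i)) where
  open Separators ℝ n x y r r>0
  open Counting n

  perp : Subset → Subset
  perp A j = not (any n (λ i → A i ∧ meet i j))

  perp-elim : ∀ {A i j} → perp A j ≡ true → i < n → A i ≡ true → meet i j ≡ false
  perp-elim {A} {i} {j} h i<n a with true-or-false (meet i j)
  ... | inj₂ f = f
  ... | inj₁ m = ⊥-elim (true≢false (any-intro n i<n (∧-pair a m)) (not-true h))

  perp-intro : ∀ {A j} → (∀ {i} → i < n → A i ≡ true → meet i j ≡ false) → perp A j ≡ true
  perp-intro {A} {j} h with true-or-false (any n (λ i → A i ∧ meet i j))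
  ... | inj₂ f = not-false f
  ... | inj₁ t = let i , i<n , e = any-witness n t in ⊥-elim (true≢false (∧-snd {A i} e) (h i<n (∧-fst e)))

  perp-∪ : ∀ {A B j} → perp A j ≡ true → perp B j ≡ true → perp (A ∪ B) j ≡ true
  perp-∪ {A} {B} {j} h k = perp-intro λ i<n e → ∨-elim e (perp-elim {A} {j = j} h i<n) (perp-elim {B} {j = j} k i<n)

  perp-∪ʳ : ∀ A {B} → perp (A ∪ B) ⊆ perp B
  perp-∪ʳ A {B} {j} _ h = perp-intro λ {i} i<n b → perp-elim {A ∪ B} {j = j} h i<n (∨-right {A i} b)

  perp-∪ˡ : ∀ {A} B → perp (A ∪ B) ⊆ perp A
  perp-∪ˡ {A} B {j} _ h = perp-intro λ {i} i<n a → perp-elim {A ∪ B} {j = j} h i<n (∨-left a)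

  meet-false-sym : ∀ {i j} → i < n → j < n → meet i j ≡ false → meet j i ≡ false
  meet-false-sym {i} {j} i<n j<n h with true-or-false (meet j i)
  ... | inj₂ f = f
  ... | inj₁ t = ⊥-elim (true≢false (meet-sym j<n i<n t) h)

  Independent-∪ : ∀ {A B} → Independent A → Independent B →
    (∀ {i j} → i < n → j < n → A i ≡ true → B j ≡ true → meet i j ≡ false) → Independent (A ∪ B)
  Independent-∪ {A} {B} ha hb cross {i} {j} i<n j<n a b ne =
    ∨-elim a (λ ai → ∨-elim b (λ aj → ha i<n j<n ai aj ne) (λ bj → cross i<n j<n ai bj))
             (λ bi → ∨-elim b (λ aj → meet-false-sym j<n i<n (cross j<n i<n aj bi)) (λ bj → hb i<n j<n bi bj ne))

  ♯-cross : ∀ {A B} → (∀ {i j} → i < n → j < n → A i ≡ true → B j ≡ true → meet i j ≡ false) →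
            ♯ (A ∪ B) ≡ ♯ A + ♯ B
  ♯-cross {A} {B} cross = ♯-∪ {A} {B} λ {i} i<n a →
    [ (λ b → ⊥-elim (true≢false (meet-refl i<n) (cross i<n i<n a b))) , (λ f → f) ]′ (true-or-false (B i))

  Independent-⁅⁆ : ∀ x → Independent ⁅ x ⁆
  Independent-⁅⁆ x _ _ a b ne = ⊥-elim (ne (trans (sym (⁅⁆-≡ a)) (⁅⁆-≡ b)))

  -- The regions of the recursion are the sets perp Z.
  data Generator : ℕ → Subset → Set where
    gnil   : Generator 0 ∅
    gbasic : ∀ {ℓ Z} (G : Basic) → Generator ℓ Z → Generator (suc ℓ) (⟪ G ⟫ ∪ Z)
    gperp  : ∀ {ℓ Z} (G : Basic) → Generator ℓ Z → Generator (suc ℓ) (perp ⟪ G ⟫ ∪ Z)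

  -- Attainable L k W m: k rounds of joining suffice to find m disjoint disks
  -- in W when the regions generated by at most L sets are available.
  data Attainable (L : ℕ) : ℕ → Subset → ℕ → Set where
    alone : ∀ {k g} → g < n → Attainable L k ⁅ g ⁆ 1
    widen : ∀ {k k′ W W′ m} → k ≤ k′ → W ⊆ W′ → Attainable L k W m → Attainable L k′ W′ m
    join  : ∀ {k ℓ Z W₁ W₂ a b} → ℓ ≤ L → Generator ℓ Z → W₁ ⊆ perp Z → W₂ ⊆ perp Z →
            (∀ {i j} → i < n → j < n → W₁ i ≡ true → W₂ j ≡ true → meet i j ≡ false) →
            1 ≤ a → Attainable L k W₁ a → Attainable L k W₂ b → Attainable L (suc k) (perp Z) (a + b)

  module Completeness (L : ℕ) where

    -- `Attainable` has no empty case, because the value 0 also marks the invalid pairs of the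
    -- program. The parts left by a separator may be empty, though.
    Attainable⁰ : ℕ → Subset → ℕ → Set
    Attainable⁰ k W m = m ≡ 0 ⊎ Attainable L k W m

    -- The disks of the separator are joined one at a time, each as a single disk with the region
    -- that avoids it. This costs one round and one generating set per disk.
    peel : ∀ {X V} → Independent X → V ⊆ X → ∀ k {S Z ℓ ρ} → ♯ S ≡ k → S ⊆ X → Generator ℓ Z → k + ℓ ≤ L →
           (∀ {i} → i < n → S i ≡ true → V i ≡ false) → S ⊆ perp Z → V ⊆ perp Z →
           (∀ {Z′} → Generator (k + ℓ) Z′ → V ⊆ perp Z′ → Attainable⁰ ρ (perp Z′) (♯ V)) → Attainable⁰ (k + ρ) (perp Z) (k + ♯ V)
    peel ind V⊆X zero ♯S S⊆X gen k+ℓ≤L S#V S⊆Z V⊆Z rest = rest gen V⊆Z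
    peel {X} {V} ind V⊆X (suc k) {S} {Z} {ℓ} {ρ} ♯S S⊆X gen k+ℓ≤L S#V S⊆Z V⊆Z rest =
      inj₂ (extend (peel {X} {V} ind V⊆X k {S ∖ ⁅ g ⁆} {⁅ g ⁆ ∪ Z}
        (suc-injective (trans (sym (♯-remove g<n Sg)) ♯S))
        (λ l e → S⊆X l (∧-fst e)) (gbasic (single g g<n) gen) (≤-trans (≤-reflexive (+-suc k ℓ)) k+ℓ≤L)
        (λ l e → S#V l (∧-fst e))
        (λ {i} l e → perp-∪ {⁅ g ⁆} {Z} (away l (S⊆X l (∧-fst e)) λ { refl → true≢false (⁅⁆-refl g) (not-true (∧-snd {S g} e)) }) (S⊆Z l (∧-fst e)))
        (λ {i} l e → perp-∪ {⁅ g ⁆} {Z} (away l (V⊆X l e) λ { refl → true≢false e (S#V g<n Sg) }) (V⊆Z l e))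
        (λ {Z′} gen′ → rest (subst (λ k → Generator k Z′) (+-suc k ℓ) gen′))))
      where
      witness : ∃[ g ] g < n × S g ≡ true
      witness = ♯-witness (≤-trans (s≤s z≤n) (≤-reflexive (sym ♯S)))
      g : ℕ
      g = proj₁ witness
      g<n : g < n
      g<n = proj₁ (proj₂ witness)
      Sg : S g ≡ true
      Sg = proj₂ (proj₂ witness)
      away : ∀ {i} → i < n → X i ≡ true → g ≢ i → perp ⁅ g ⁆ i ≡ true
      away {i} i<n Xi ne = perp-intro λ {k} k<n e → subst (λ k → meet k i ≡ false) (⁅⁆-≡ e) (ind g<n i<n (S⊆X g<n Sg) Xi ne)
      g∈ : ⁅ g ⁆ ⊆ perp Z
      g∈ _ e = subst (λ k → perp Z k ≡ true) (⁅⁆-≡ e) (S⊆Z g<n Sg)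
      extend : Attainable⁰ (k + ρ) (perp (⁅ g ⁆ ∪ Z)) (k + ♯ V) → Attainable L (suc (k + ρ)) (perp Z) (suc (k + ♯ V))
      extend (inj₁ e) = subst (λ m → Attainable L (suc (k + ρ)) (perp Z) (suc m)) (sym e) (widen z≤n g∈ (alone {k = 0} g<n))
      extend (inj₂ best) = join (≤-trans (m≤n+m ℓ (suc k)) k+ℓ≤L) gen g∈ (perp-∪ʳ ⁅ g ⁆)
        (λ i<n j<n a b → perp-elim (perp-∪ˡ {⁅ g ⁆} Z j<n b) i<n a) (s≤s z≤n) (alone g<n) best

    -- `b` counts the sets that may still be added to the description of the region. A separator
    -- spends `s` single disks and one guard or its polar, and the square of the remainder still
    -- pays for either part.
    complete : ∀ fuel {X Z ℓ b} → Independent X → 1 ≤ ♯ X → ♯ X ≤ fuel → Generator ℓ Z → X ⊆ perp Z →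
               b + ℓ ≤ L → budgetConstant * ♯ X ≤ b * b → Attainable L (2 * ♯ X) (perp Z) (♯ X)
    complete zero ind pos le = ⊥-elim (<⇒≱ pos le)
    complete (suc fuel) {X} {Z} {ℓ} {b} ind pos le gen X⊆Z bℓ≤L budget =
      [ (λ e → ⊥-elim (<-irrefl (sym (trans ♯X≡ e)) pos))
      , (λ best → subst (λ m → Attainable L (2 * ♯ X) (perp Z) m) (sym ♯X≡) (widen rounds (λ _ e → e) best)) ]′
      (peel {X} {X ∖ S} ind (λ _ → ∧-fst) s refl S⊆X gen sℓ≤L
        (λ {i} _ e → trans (cong (λ b → X i ∧ not b) e) (∧-zeroʳ (X i))) (λ l e → X⊆Z l (S⊆X l e)) (λ l e → X⊆Z l (∧-fst e)) split)
      where
      open Separation (separation ind pos)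
      s V : ℕ
      s = ♯ S
      V = ♯ (X ∖ S)
      ♯X≡ : ♯ X ≡ s + V
      ♯X≡ = trans (♯-split X S) (cong (_+ V) (♯-cong (λ _ → ∧-snd {X _}) (λ l e → ∧-pair (S⊆X l e) e)))
      V≡ : V ≡ ♯ I + ♯ U
      V≡ = ♯-split (X ∖ S) In
      rounds : s + 2 * V ≤ 2 * ♯ X
      rounds = ≤-trans (+-monoˡ-≤ (2 * V) (m≤m+n s (s + 0))) (≤-reflexive (trans (sym (*-distribˡ-+ 2 s V)) (cong (2 *_) (sym ♯X≡))))
      20s≤b : 20 * suc s ≤ b
      20s≤b = budget-bound 20 {separatorConstant} {s} {b} {♯ X} ♯S≤ pos (subst (λ c → c * ♯ X ≤ b * b) budgetConstant-≡ budget)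
      s<b : suc s ≤ b
      s<b = ≤-trans (m≤m+n (suc s) (19 * suc s)) 20s≤b
      b′ : ℕ
      b′ = b ∸ suc s
      b≡ : b ≡ b′ + suc s
      b≡ = sym (m∸n+n≡m s<b)
      sℓ≤L : s + ℓ ≤ L
      sℓ≤L = ≤-trans (+-monoˡ-≤ ℓ (≤-trans (n≤1+n s) s<b)) bℓ≤L
      b′ℓ≤L : b′ + suc (s + ℓ) ≤ L
      b′ℓ≤L = ≤-trans (≤-reflexive (trans (sym (+-assoc b′ (suc s) ℓ)) (cong (_+ ℓ) (sym b≡)))) bℓ≤L
      budget′ : ∀ {m} → 10 * m ≤ 9 * ♯ X → budgetConstant * m ≤ b′ * b′
      budget′ = budget-shrinks {budgetConstant} {♯ X} {b′ = b′} {suc s} (subst (λ b → budgetConstant * ♯ X ≤ b * b) b≡ budget)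
                               (≤-trans 20s≤b (≤-reflexive b≡))
      smaller : ∀ {m} → 10 * m ≤ 9 * ♯ X → m ≤ fuel
      smaller {m} h = ≤-pred (≤-trans (≰⇒> λ X≤m → <⇒≱ (+-monoˡ-≤ (9 * ♯ X) pos) (≤-trans (*-monoʳ-≤ 10 X≤m) h)) le)
      split : ∀ {Z′} → Generator (s + ℓ) Z′ → X ∖ S ⊆ perp Z′ → Attainable⁰ (2 * V) (perp Z′) V
      split {Z′} gen′ V⊆ = combine (♯ I) (♯ U) refl refl
        where
        -- Since the inside part is contained in `⟪ G ⟫`, no disk of `perp ⟪ G ⟫` meets it, so that
        -- polar may join the sets to be avoided.
        bestI : 1 ≤ ♯ I → Attainable L (2 * ♯ I) (perp (perp ⟪ G ⟫ ∪ Z′)) (♯ I)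
        bestI 1≤I = complete fuel (λ i<n j<n a c → ind i<n j<n (∧-fst (∧-fst a)) (∧-fst (∧-fst c))) 1≤I (smaller ♯I≤)
          (gperp G gen′)
          (λ {i} i<n a → perp-∪ {perp ⟪ G ⟫} {Z′} (perp-intro λ g<n e → meet-false-sym i<n g<n (perp-elim {⟪ G ⟫} e i<n (I⊆G i<n a))) (V⊆ i<n (∧-fst a)))
          b′ℓ≤L (budget′ ♯I≤)
        bestU : 1 ≤ ♯ U → Attainable L (2 * ♯ U) (perp (⟪ G ⟫ ∪ Z′)) (♯ U)
        bestU 1≤U = complete fuel (λ i<n j<n a c → ind i<n j<n (∧-fst (∧-fst a)) (∧-fst (∧-fst c))) 1≤U (smaller ♯U≤)
          (gbasic G gen′)
          (λ {u} u<n a → perp-∪ {⟪ G ⟫} {Z′} (perp-intro λ g<n e → G⊥U g<n u<n e a) (V⊆ u<n (∧-fst a)))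
          b′ℓ≤L (budget′ ♯U≤)
        combine : ∀ i u → ♯ I ≡ i → ♯ U ≡ u → Attainable⁰ (2 * V) (perp Z′) V
        combine zero zero eI eU = inj₁ (trans V≡ (cong₂ _+_ eI eU))
        combine (suc i) zero eI eU = inj₂ (subst (λ m → Attainable L (2 * m) (perp Z′) m) (sym (trans V≡ (trans (cong (♯ I +_) eU) (+-identityʳ _))))
          (widen ≤-refl (perp-∪ʳ (perp ⟪ G ⟫)) (bestI (≤-trans (s≤s z≤n) (≤-reflexive (sym eI))))))
        combine zero (suc u) eI eU = inj₂ (subst (λ m → Attainable L (2 * m) (perp Z′) m) (sym (trans V≡ (cong (_+ ♯ U) eI)))
          (widen ≤-refl (perp-∪ʳ ⟪ G ⟫) (bestU (≤-trans (s≤s z≤n) (≤-reflexive (sym eU))))))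
        combine (suc i) (suc u) eI eU = inj₂ (subst (λ m → Attainable L (2 * m) (perp Z′) m) (sym V≡)
          (widen last (λ _ e → e)
            (join (≤-trans (n≤1+n _) (≤-trans (m≤n+m _ b′) b′ℓ≤L)) gen′
              (perp-∪ʳ (perp ⟪ G ⟫)) (perp-∪ʳ ⟪ G ⟫)
              -- The regions are separate by construction: the left one avoids `perp ⟪ G ⟫`, and the
              -- right one is contained in it.
              (λ {i} {j} i<n j<n a c → meet-false-sym j<n i<n (perp-elim {perp ⟪ G ⟫} (perp-∪ˡ {perp ⟪ G ⟫} Z′ i<n a) j<n (perp-∪ˡ {⟪ G ⟫} Z′ j<n c)))
              1≤I (widen leI (λ _ e → e) (bestI 1≤I)) (widen leU (λ _ e → e) (bestU 1≤U)))))
          where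
          1≤I : 1 ≤ ♯ I
          1≤I = ≤-trans (s≤s z≤n) (≤-reflexive (sym eI))
          1≤U : 1 ≤ ♯ U
          1≤U = ≤-trans (s≤s z≤n) (≤-reflexive (sym eU))
          -- This is `2 * V ∸ 2`. It covers the rounds of either part because the other part is
          -- nonempty, and leaves a round for the join.
          k : ℕ
          k = i + (i + 0) + (u + (u + 0)) + 2
          double : ∀ a b → suc (a + (a + 0) + (b + (b + 0)) + 2) + 1 ≡ 2 * (suc a + suc b)
          double = solve-∀
          last : suc k ≤ 2 * (♯ I + ♯ U)
          last = ≤-trans (m≤m+n (suc k) 1) (≤-reflexive (trans (double i u) (sym (cong₂ (λ a b → 2 * (a + b)) eI eU))))
          leftI : ∀ a b → 2 * suc a + (b + (b + 0)) ≡ a + (a + 0) + (b + (b + 0)) + 2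
          leftI = solve-∀
          leftU : ∀ a b → 2 * suc b + (a + (a + 0)) ≡ a + (a + 0) + (b + (b + 0)) + 2
          leftU = solve-∀
          leI : 2 * ♯ I ≤ k
          leI = ≤-trans (≤-reflexive (cong (2 *_) eI)) (≤-trans (m≤m+n _ _) (≤-reflexive (leftI i u)))
          leU : 2 * ♯ U ≤ k
          leU = ≤-trans (≤-reflexive (cong (2 *_) eU)) (≤-trans (m≤m+n _ _) (≤-reflexive (leftU i u)))

-- The program

-- Variables 2 and 3 hold k and n.  A memory address p stands for the set of
-- the positions i < n such that cell p + i is nonzero.

-- The summand is a function of the loop variable, polymorphic in the depth, because it has to be
-- placed below further loops.
sumE : ∀ {d} → ℕ → (ℕ → ∀ {d′} → Exp d′) → Exp d
sumE {d} b f = fold b (const 0) (plus (var d) (f (suc d)))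

maxE argmaxE : ∀ {d} → ℕ → (ℕ → ∀ {d′} → Exp d′) → Exp d
maxE {d} b f    = fold b (const 0) (ifleq (var d) (f (suc d)) (f (suc d)) (var d))
argmaxE {d} b f = fold b (const 0) (ifleq (f d) (f (suc d)) (var (suc d)) (var d))

meetE : ∀ {d} → ℕ → ℕ → Exp d
meetE i j = leqR ((coord 0 i :⊖ coord 0 j) :⊗ (coord 0 i :⊖ coord 0 j) :⊕ (coord 1 i :⊖ coord 1 j) :⊗ (coord 1 i :⊖ coord 1 j))
                 ((coord 2 i :⊕ coord 2 j) :⊗ (coord 2 i :⊕ coord 2 j))

ψR : ℕ → ℕ → RExp
ψR c j = :max (:max (coord 0 j :⊖ coord 0 c) (coord 0 c :⊖ coord 0 j)) (:max (coord 1 j :⊖ coord 1 c) (coord 1 c :⊖ coord 1 j)) :⊕ coord 2 j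

cellE perpE : ∀ {d} → ℕ → ℕ → Exp d
cellE p i = load (plus (var p) (var i))
perpE p j = ifleq (sumE 3 λ i → ifleq (const 1) (cellE p i) (meetE i j) (const 0)) (const 0) (const 1) (const 0)

pairE : ∀ {d} → ℕ → ℕ → ℕ → Exp d
pairE p q i = plus (cellE p i) (cellE q i)

-- Conflicts are counted for `i < j` only, since every disk meets itself.
conflictE sizeE : ∀ {d} → ℕ → ℕ → Exp d
conflictE p q = sumE 3 λ i → sumE 3 λ j →
  ifleq (plus (var i) (const 1)) (var j)
    (ifleq (const 1) (pairE p q i) (ifleq (const 1) (pairE p q j) (meetE i j) (const 0)) (const 0)) (const 0)
sizeE p q = sumE 3 λ i → ifleq (const 1) (pairE p q i) (const 1) (const 0)

outsideE : ∀ {d} → ℕ → ℕ → ℕ → Exp d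
outsideE w p q = sumE 3 λ i → ifleq (const 1) (pairE p q i) (ifleq (const 1) (cellE w i) (const 0) (const 1)) (const 0)

-- The first two tests keep both windows below the mark `m`, from which on the new row is written. A
-- pair that fails any test has value 0.
valueE : ∀ {d} → ℕ → ℕ → ℕ → ℕ → Exp d
valueE m w p q =
  ifleq (plus (var p) (var 3)) (var m)
    (ifleq (plus (var q) (var 3)) (var m)
      (ifleq (plus (conflictE p q) (outsideE w p q)) (const 0) (sizeE p q) (const 0)) (const 0)) (const 0)

soloE : ∀ {d} → ℕ → Exp d
soloE p = ifleq (conflictE p p) (const 0) (sizeE p p) (const 0)

singleE : Exp 6
singleE = ifleq (var 4) (var 5) (ifleq (var 5) (var 4) (const 1) (const 0)) (const 0)

rowE : Exp 7
rowE = leqR (ψR 4 6) (ψR 4 5)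

singles rows : Cmd 4
singles = for 3 (for 3 (push singleE))
rows    = for 3 (for 3 (for 3 (push rowE)))

unions perps round : Cmd 6
unions = lettop (for 6 (for 6 (for 3 (push (pairE 7 8 9)))))
perps  = lettop (for 6 (for 3 (push (perpE 7 8))))
round  = unions ⨟ perps

powerE : Exp 6
powerE = fold 5 (const 1) (plus (plus (var 6) (var 6)) (plus (var 6) (var 6)))

guardedRound : Cmd 6
guardedRound = ifleq powerE (var 4) round nop

rounds : Cmd 4
rounds = lett (fold 2 (const 0) (plus (var 4) (const (16 * budgetConstant)))) (for 4 guardedRound)

firstE : Exp 9
firstE = argmaxE 8 λ p → maxE 8 λ q → valueE 8 7 p q

secondE : Exp 10
secondE = argmaxE 8 λ q → valueE 8 7 9 q

improvement : Cmd 8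
improvement = lettop (lett firstE (lett secondE (for 3 (push (pairE 9 10 11)))))

-- The regions are the addresses below the mark taken here, while the two sets to be united come
-- from everything recorded since. A round thus adds the same number of cells each time.
improvements : Cmd 4
improvements = lettop (lett (plus (var 2) (var 2)) (for 5 (for 4 improvement)))

listMember : Cmd 7
listMember = ifleq (const 1) (cellE 5 6) (push (var 6)) nop

output : Cmd 4
output = lettop (lett (argmaxE 4 λ p → soloE p)
  (ifleq (var 2) (soloE 5)
    (reset ⨟ for 3 listMember ⨟ answer 1)
    (answer 0)))

search : Cmd 4
search = singles ⨟ rows ⨟ rounds ⨟ improvements ⨟ output

search-ok : T (okC search)
search-ok = tt

-- What the expressions of the program compute

maximum argmax : ℕ → (ℕ → ℕ) → ℕ
maximum b f = foldn b (λ i a → if leq a (f i) then f i else a) 0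
argmax b f  = foldn b (λ i a → if leq (f a) (f i) then i else a) 0

maximum-upper : ∀ b (f : ℕ → ℕ) {i} → i < b → f i ≤ maximum b f
maximum-upper (suc b) f {i} l with leq (maximum b f) (f b) in eq | ℕ._≟_ i b
... | true  | yes refl = ≤-refl
... | true  | no ne    = ≤-trans (maximum-upper b f (≤∧≢⇒< (≤-pred l) ne)) (leq-≤ eq)
... | false | yes refl = <⇒≤ (≰⇒> (leq-≰ eq))
... | false | no ne    = maximum-upper b f (≤∧≢⇒< (≤-pred l) ne)

maximum-attained : ∀ b (f : ℕ → ℕ) → maximum b f ≡ 0 ⊎ ∃[ i ] i < b × maximum b f ≡ f i
maximum-attained zero f = inj₁ refl
maximum-attained (suc b) f with leq (maximum b f) (f b) | maximum-attained b f
... | true  | _                = inj₂ (b , ≤-refl , refl)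
... | false | inj₁ e           = inj₁ e
... | false | inj₂ (i , l , e) = inj₂ (i , m≤n⇒m≤1+n l , e)

argmax-upper : ∀ b (f : ℕ → ℕ) {i} → i < b → f i ≤ f (argmax b f)
argmax-upper (suc b) f {i} l with leq (f (argmax b f)) (f b) in eq | ℕ._≟_ i b
... | true  | yes refl = ≤-refl
... | true  | no ne    = ≤-trans (argmax-upper b f (≤∧≢⇒< (≤-pred l) ne)) (leq-≤ eq)
... | false | yes refl = <⇒≤ (≰⇒> (leq-≰ eq))
... | false | no ne    = argmax-upper b f (≤∧≢⇒< (≤-pred l) ne)

argmax-≤ : ∀ b (f : ℕ → ℕ) → argmax b f ≤ b
argmax-≤ zero f = z≤n
argmax-≤ (suc b) f with leq (f (argmax b f)) (f b)
... | true  = n≤1+n b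
... | false = m≤n⇒m≤1+n (argmax-≤ b f)

argmax₂-upper : ∀ m (f : ℕ → ℕ → ℕ) {p q} → p < m → q < m →
  let P = argmax m (λ p → maximum m (f p)) in f p q ≤ f P (argmax m (f P))
argmax₂-upper m f {p} {q} p<m q<m =
  ≤-trans (≤-trans (maximum-upper m (f p) q<m) (argmax-upper m (λ p → maximum m (f p)) p<m))
    ([ (λ e → ≤-trans (≤-reflexive e) z≤n) , (λ (i , l , e) → ≤-trans (≤-reflexive e) (argmax-upper m (f P) l)) ]′ (maximum-attained m (f P)))
  where
  P : ℕ
  P = argmax m (λ p → maximum m (f p))

indicator : ∀ b → (if b then 1 else 0) ≡ [ b ]
indicator true  = refl
indicator false = refl

if-true : ∀ {b : Bool} {u v : ℕ} → b ≡ true → (if b then u else v) ≡ u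
if-true refl = refl

if-false : ∀ {b : Bool} {u v : ℕ} → b ≡ false → (if b then u else v) ≡ v
if-false refl = refl

positive-suc : ∀ a → leq 1 (suc a) ≡ true
positive-suc a = leq-true (s≤s z≤n)

positive-0 : leq 1 0 ≡ false
positive-0 = leq-false λ ()

positive-+ : ∀ a b → leq 1 (a + b) ≡ leq 1 a ∨ leq 1 b
positive-+ zero    b = sym (cong (_∨ leq 1 b) positive-0)
positive-+ (suc a) b = trans (positive-suc (a + b)) (sym (cong (_∨ leq 1 b) (positive-suc a)))

positive-[] : ∀ b → leq 1 [ b ] ≡ b
positive-[] true  = positive-suc 0
positive-[] false = positive-0

module Values (ℝ : RealNumbers) (n : ℕ) (R : ℕ → RealNumbers.Carrier ℝ)
              (r>0 : ∀ {i} → i < n → OrderedField._≺_ ℝ (RealNumbers.0# ℝ) (R (2 + i + i + i))) where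
  open Decomposition ℝ n (λ i → R (0 + i + i + i)) (λ i → R (1 + i + i + i)) (λ i → R (2 + i + i + i)) r>0 public
  open Separators ℝ n (λ i → R (0 + i + i + i)) (λ i → R (1 + i + i + i)) (λ i → R (2 + i + i + i)) r>0 public
  open Counting n public

  Memory : Set
  Memory = ℕ → ℕ

  window : Memory → ℕ → Subset
  window M p i = leq 1 (M (p + i))

  pair : Memory → ℕ → ℕ → ℕ → ℕ
  pair M p q i = M (p + i) + M (q + i)

  meetV : ℕ → ℕ → ℕ
  meetV i j = if meet i j then 1 else 0

  perpV conflictV sizeV : Memory → ℕ → ℕ → ℕ
  perpV M p j = if leq (sumTo n (λ i → if leq 1 (M (p + i)) then meetV i j else 0)) 0 then 1 else 0
  conflictV M p q = sumTo n λ i → sumTo n λ j →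
    if leq (i + 1) j then (if leq 1 (pair M p q i) then (if leq 1 (pair M p q j) then meetV i j else 0) else 0) else 0
  sizeV M p q = sumTo n λ i → if leq 1 (pair M p q i) then 1 else 0

  soloV : Memory → ℕ → ℕ
  soloV M p = if leq (conflictV M p p) 0 then sizeV M p p else 0

  outsideV : Memory → ℕ → ℕ → ℕ → ℕ
  outsideV M w p q = sumTo n λ i → if leq 1 (pair M p q i) then (if leq 1 (M (w + i)) then 0 else 1) else 0

  valueV : Memory → ℕ → ℕ → ℕ → ℕ → ℕ
  valueV M m w p q =
    if leq (p + n) m then (if leq (q + n) m then
      (if leq (conflictV M p q + outsideV M w p q) 0 then sizeV M p q else 0) else 0) else 0

  infix 4 _≗_

  _≗_ : Subset → Subset → Set
  A ≗ B = ∀ {i} → i < n → A i ≡ B i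

  ≗⇒⊆ : ∀ {A B} → A ≗ B → A ⊆ B
  ≗⇒⊆ h l a = trans (sym (h l)) a

  ≗-sym : ∀ {A B} → A ≗ B → B ≗ A
  ≗-sym h l = sym (h l)

  ⊆⇒≗ : ∀ {A B} → A ⊆ B → B ⊆ A → A ≗ B
  ⊆⇒≗ {A} {B} h k {i} l with true-or-false (A i) | true-or-false (B i)
  ... | inj₁ a | _      = trans a (sym (h l a))
  ... | inj₂ a | inj₂ b = trans a (sym b)
  ... | inj₂ a | inj₁ b = trans (k l b) (sym b)

  perp-mono : ∀ {A B} → A ⊆ B → perp B ⊆ perp A
  perp-mono {A} {B} h {j} l e = perp-intro {A} {j} λ i<n a → perp-elim {B} {j = j} e i<n (h i<n a)

  perp-cong : ∀ {A B} → A ≗ B → perp A ≗ perp B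
  perp-cong {A} {B} h {j} = ⊆⇒≗ {perp A} {perp B} (λ {j} → perp-mono {B} {A} (≗⇒⊆ (≗-sym {A} {B} h)) {j}) (λ {j} → perp-mono {A} {B} (≗⇒⊆ h) {j}) {j}

  window-pair : ∀ M p q i → leq 1 (pair M p q i) ≡ (window M p ∪ window M q) i
  window-pair M p q i = positive-+ (M (p + i)) (M (q + i))

  positive-perpV : ∀ M p j → leq 1 (perpV M p j) ≡ perp (window M p) j
  positive-perpV M p j with true-or-false (perp (window M p) j)
  ... | inj₁ h = trans (cong (leq 1) (if-true (leq-true (≤-reflexive (sumTo-≡0 n zeros))))) (trans (positive-suc 0) (sym h))
    where
    zeros : ∀ {i} → i < n → (if leq 1 (M (p + i)) then meetV i j else 0) ≡ 0
    zeros {i} l with true-or-false (window M p i)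
    ... | inj₁ a = trans (if-true a) (if-false (perp-elim {window M p} {j = j} h l a))
    ... | inj₂ a = if-false a
  ... | inj₂ h = trans (cong (leq 1) (if-false (leq-false nonzero))) (trans positive-0 (sym h))
    where
    nonzero : ¬ sumTo n (λ i → if leq 1 (M (p + i)) then meetV i j else 0) ≤ 0
    nonzero le = true≢false (perp-intro {window M p} {j} free) h
      where
      free : ∀ {i} → i < n → window M p i ≡ true → meet i j ≡ false
      free {i} l a with true-or-false (meet i j)
      ... | inj₂ f = f
      ... | inj₁ t with () ← trans (sym (trans (if-true a) (if-true t))) (sumTo-0 n (n≤0⇒n≡0 le) l)

  sizeV-♯ : ∀ M p q → sizeV M p q ≡ ♯ (window M p ∪ window M q)
  sizeV-♯ M p q = sumTo-cong n λ {i} _ → trans (indicator _) (cong [_] (window-pair M p q i))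

  conflictV⇒Independent : ∀ M p q → conflictV M p q ≡ 0 → Independent (window M p ∪ window M q)
  conflictV⇒Independent M p q h {i} {j} i<n j<n a b ne =
    [ (λ i<j → ordered i<n j<n i<j a b) , (λ j<i → meet-false-sym j<n i<n (ordered j<n i<n j<i b a)) ]′ (≢⇒<∨> ne)
    where
    ordered : ∀ {i j} → i < n → j < n → i < j → (window M p ∪ window M q) i ≡ true → (window M p ∪ window M q) j ≡ true → meet i j ≡ false
    ordered {i} {j} i<n j<n i<j a b with true-or-false (meet i j)
    ... | inj₂ f = f
    ... | inj₁ t with () ← trans (sym (trans (if-true (leq-true (≤-trans (≤-reflexive (+-comm i 1)) i<j)))
                             (trans (if-true (trans (window-pair M p q i) a)) (trans (if-true (trans (window-pair M p q j) b)) (if-true t)))))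
                           (sumTo-0 n (sumTo-0 n h i<n) j<n)

  Independent⇒conflictV : ∀ M p q → Independent (window M p ∪ window M q) → conflictV M p q ≡ 0
  Independent⇒conflictV M p q ind = sumTo-≡0 n λ {i} i<n → sumTo-≡0 n λ {j} j<n → zero-at i j i<n j<n
    where
    zero-at : ∀ i j → i < n → j < n →
      (if leq (i + 1) j then (if leq 1 (pair M p q i) then (if leq 1 (pair M p q j) then meetV i j else 0) else 0) else 0) ≡ 0
    zero-at i j i<n j<n with leq (i + 1) j in l
    ... | false = refl
    ... | true with true-or-false (leq 1 (pair M p q i)) | true-or-false (leq 1 (pair M p q j))
    ...   | inj₂ a | _ = if-false a
    ...   | inj₁ a | inj₂ b = trans (if-true a) (if-false b)
    ...   | inj₁ a | inj₁ b = trans (if-true a) (trans (if-true b) (if-false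
            (ind i<n j<n (trans (sym (window-pair M p q i)) a) (trans (sym (window-pair M p q j)) b)
              λ { refl → <-irrefl refl (≤-trans (≤-reflexive (+-comm 1 i)) (leq-≤ l)) })))

  outsideV⇒⊆ : ∀ M w p q → outsideV M w p q ≡ 0 → window M p ∪ window M q ⊆ window M w
  outsideV⇒⊆ M w p q h {i} i<n a with true-or-false (window M w i)
  ... | inj₁ b = b
  ... | inj₂ b with () ← trans (sym (trans (if-true (trans (window-pair M p q i) a)) (if-false b))) (sumTo-0 n h i<n)

  ⊆⇒outsideV : ∀ M w p q → window M p ∪ window M q ⊆ window M w → outsideV M w p q ≡ 0
  ⊆⇒outsideV M w p q h = sumTo-≡0 n zero-at
    where
    zero-at : ∀ {i} → i < n → (if leq 1 (pair M p q i) then (if leq 1 (M (w + i)) then 0 else 1) else 0) ≡ 0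
    zero-at {i} l with true-or-false (leq 1 (pair M p q i))
    ... | inj₂ a = if-false a
    ... | inj₁ a = trans (if-true a) (if-true (h l (trans (sym (window-pair M p q i)) a)))

  valueV-valid : ∀ M m w p q → p + n ≤ m → q + n ≤ m → Independent (window M p ∪ window M q) →
    window M p ∪ window M q ⊆ window M w → valueV M m w p q ≡ ♯ (window M p ∪ window M q)
  valueV-valid M m w p q p≤ q≤ ind sub =
    trans (if-true (leq-true p≤)) (trans (if-true (leq-true q≤)) (trans (if-true (leq-true (≤-reflexive (cong₂ _+_ (Independent⇒conflictV M p q ind) (⊆⇒outsideV M w p q sub)))))
      (sizeV-♯ M p q)))

  -- A positive value certifies all tests at once, so that nothing has to be known about how the two
  -- sets were recorded.
  valueV-positive : ∀ M m w p q → 1 ≤ valueV M m w p q →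
    p + n ≤ m × q + n ≤ m × Independent (window M p ∪ window M q) × window M p ∪ window M q ⊆ window M w ×
    valueV M m w p q ≡ ♯ (window M p ∪ window M q)
  valueV-positive M m w p q h with leq (p + n) m in p≤ | leq (q + n) m in q≤ | leq (conflictV M p q + outsideV M w p q) 0 in z
  ... | true | true | true =
    leq-≤ p≤ , leq-≤ q≤ , conflictV⇒Independent M p q (n≤0⇒n≡0 (m+n≤o⇒m≤o (conflictV M p q) (leq-≤ z))) ,
    outsideV⇒⊆ M w p q (m+n≡0⇒n≡0 (conflictV M p q) (n≤0⇒n≡0 (leq-≤ z))) , sizeV-♯ M p q
  valueV-positive M m w p q () | true | true | false
  valueV-positive M m w p q () | true | false | _
  valueV-positive M m w p q () | false | _ | _

-- Growth of the list of regions

2^-double : ∀ e → 2 ^ suc e ≡ 2 ^ e + 2 ^ e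
2^-double e = cong (2 ^ e +_) (+-identityʳ (2 ^ e))

4^≡2^*2^ : ∀ r → 4 ^ r ≡ 2 ^ r * 2 ^ r
4^≡2^*2^ zero    = refl
4^≡2^*2^ (suc r) = trans (cong (4 *_) (4^≡2^*2^ r)) (quadruple (2 ^ r))
  where
  quadruple : ∀ a → 4 * (a * a) ≡ (2 * a) * (2 * a)
  quadruple = solve-∀

n<4^n : ∀ n → n < 4 ^ n
n<4^n zero    = s≤s z≤n
n<4^n (suc n) = ≤-trans (+-mono-≤ (≤-trans (s≤s z≤n) (n<4^n n)) (n<4^n n))
  (≤-trans (+-monoʳ-≤ (4 ^ n) (m≤m+n (4 ^ n) (4 ^ n + (4 ^ n + 0)))) ≤-refl)

foldn-4^ : ∀ t → foldn t (λ _ a → a + a + (a + a)) 1 ≡ 4 ^ t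
foldn-4^ zero    = refl
foldn-4^ (suc t) = trans (cong (λ a → a + a + (a + a)) (foldn-4^ t)) (four (4 ^ t))
  where
  four : ∀ a → a + a + (a + a) ≡ 4 * a
  four = solve-∀

module Pools (ℝ : RealNumbers) (n : ℕ) (R : ℕ → RealNumbers.Carrier ℝ)
             (r>0 : ∀ {i} → i < n → OrderedField._≺_ ℝ (RealNumbers.0# ℝ) (R (2 + i + i + i))) (1≤n : 1 ≤ n) (k : ℕ) where
  open Values ℝ n R r>0
  open Compilation ℝ
  open RealRAM ℝ using (_[_≔_])
  open Store

  env : ℕ → ℕ
  env 2 = k
  env 3 = n
  env _ = 0

  -- Every window below the top counts, whether or not it was written as one row; the program makes
  -- no difference between them.
  InPool : Store → Subset → Set
  InPool s A = ∃[ p ] p + n ≤ top s × (window (mem s) p ≗ A)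

  window-cong : ∀ {M M′ t p} → p + n ≤ t → (∀ a → a < t → M a ≡ M′ a) → window M p ≗ window M′ p
  window-cong {p = p} p≤ same {i} i<n = cong (leq 1) (same (p + i) (≤-trans (+-monoʳ-< p i<n) p≤))

  pool-⊑ : ∀ {A s s′} → s ⊑ s′ → InPool s A → InPool s′ A
  pool-⊑ {s = s} {s′} (grow l kept) (p , p≤ , w) =
    p , ≤-trans p≤ l , λ i<n → trans (window-cong {mem s′} {mem s} {p = p} p≤ kept i<n) (w i<n)

  pool-≗ : ∀ {A B s} → A ≗ B → InPool s A → InPool s B
  pool-≗ h (p , p≤ , w) = p , p≤ , λ l → trans (w l) (h l)

  row-pool : ∀ {A s s′ E} → Row s s′ n E →
             (∀ {j M} → j < n → (∀ a → a < top s → M a ≡ mem s a) → leq 1 (E j M) ≡ A j) → InPool s′ A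
  row-pool {A} {s} {s′} {E} new h = top s , ≤-reflexive (sym (length≡ new)) , λ {j} j<n →
    let M , low , v = cells {s} {s′} {n} {E} new j<n in trans (cong (leq 1) v) (h j<n low)

  wp-singles : ∀ {B s Q} →
    (∀ s′ → s ⊑ s′ → top s′ ≡ top s + n * n → (∀ {g} → g < n → InPool s′ ⁅ g ⁆) → Q s′) → wp R B singles env Q s
  wp-singles {B} = wp-collect R {B = B} 3 (for 3 (push singleE)) env n (λ g s → InPool s ⁅ g ⁆) pool-⊑
    λ {g} {s} g<n _ next → wp-row R {B = B} 3 singleE (env [ 4 ≔ g ]) λ s′ new →
      next s′ (extends new) (length≡ new) (row-pool {E = λ j M → ⟦ singleE ⟧ ((env [ 4 ≔ g ]) [ 5 ≔ j ]) M R} new λ {j} _ _ → same g j)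
    where
    same : ∀ g j → leq 1 (if leq g j then (if leq j g then 1 else 0) else 0) ≡ ⁅ g ⁆ j
    same g j with leq g j in a | leq j g in b
    ... | true  | true  = trans (positive-suc 0) (sym (yes! (g ℕ.≟ j) (≤-antisym (leq-≤ a) (leq-≤ b))))
    ... | true  | false = trans positive-0 (sym (no! (g ℕ.≟ j) λ { refl → leq-≰ b ≤-refl }))
    ... | false | _     = trans positive-0 (sym (no! (g ℕ.≟ j) λ { refl → leq-≰ a ≤-refl }))

  wp-rows : ∀ {B s Q} →
    (∀ s′ → s ⊑ s′ → top s′ ≡ top s + n * (n * n) → (∀ {c l} → c < n → l < n → InPool s′ (inRow c l)) → Q s′) →
    wp R B rows env Q s
  wp-rows {B} done = wp-collect R {B = B} 3 (for 3 (for 3 (push rowE))) env (n * n) (λ c s → ∀ {l} → l < n → InPool s (inRow c l))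
    (λ ext h l<n → pool-⊑ ext (h l<n))
    (λ {c} _ _ next → wp-collect R {B = B} 3 (for 3 (push rowE)) (env [ 4 ≔ c ]) n (λ l s → InPool s (inRow c l)) pool-⊑
      (λ {l} {s} _ _ next′ → wp-row R {B = B} 3 rowE ((env [ 4 ≔ c ]) [ 5 ≔ l ]) λ s′ new →
        next′ s′ (extends new) (length≡ new) (row-pool {E = λ j M → ⟦ rowE ⟧ (((env [ 4 ≔ c ]) [ 5 ≔ l ]) [ 6 ≔ j ]) M R} new λ {j} _ _ →
          trans (cong (leq 1) (indicator (inRow c l j))) (positive-[] (inRow c l j)))) next)
    λ s′ ext size h → done s′ ext size λ c<n l<n → h c<n l<n

  record Closure (s s′ : Store) : Set where
    field
      grows  : s ⊑ s′
      unite  : ∀ {A B} → InPool s A → InPool s B → InPool s′ (A ∪ B)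
      unite⊥ : ∀ {A B} → InPool s A → InPool s B → InPool s′ (perp (A ∪ B))
      polar  : ∀ {A} → InPool s A → InPool s′ (perp A)

  -- Pairs of all `m` addresses are united, not only pairs of row starts, so a round adds `m * m`
  -- unions of `n` cells and then a polar for every address.
  unionSize roundSize : ℕ → ℕ
  unionSize m = m + m * (m * n)
  roundSize m = unionSize m + unionSize m * n

  wp-unions : ∀ {B s Q} b t → top s ≤ B →
    (∀ s′ → s ⊑ s′ → top s′ ≡ unionSize (top s) → (∀ {A B} → InPool s A → InPool s B → InPool s′ (A ∪ B)) → Q s′) →
    wp R B unions ((env [ 4 ≔ b ]) [ 5 ≔ t ]) Q s
  wp-unions {B} {s} b t m≤B done = m≤B , wp-collect R {7} {B} 6 (for 6 (for 3 (push (pairE 7 8 9)))) ρ (m * n)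
      (λ p s′ → ∀ {q} → q < m → p + n ≤ m → q + n ≤ m → InPool s′ (U p q))
      (λ ext h l a c → pool-⊑ ext (h l a c))
      (λ {p} {s₁} _ ext₁ next → wp-collect R {8} {B} 6 (for 3 (push (pairE 7 8 9))) (ρ [ 7 ≔ p ]) n
        (λ q s′ → p + n ≤ m → q + n ≤ m → InPool s′ (U p q)) (λ ext h a c → pool-⊑ ext (h a c))
        (λ {q} {s₂} _ ext₂ next′ → wp-row R {9} {B} 3 (pairE 7 8 9) ((ρ [ 7 ≔ p ]) [ 8 ≔ q ]) λ s′ new →
          next′ s′ (extends new) (length≡ new) λ p≤ q≤ → row-pool {E = λ i M → pair M p q i} new λ {i} {M} i<n low →
            let ext = ⊑-trans ext₁ ext₂
                same : ∀ a → a < m → M a ≡ mem s a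
                same = λ a a<m → trans (low a (≤-trans a<m (top-≤ ext))) (kept ext a a<m)
            in trans (window-pair M p q i) (cong₂ _∨_ (window-cong {M} {mem s} {p = p} p≤ same i<n) (window-cong {M} {mem s} {p = q} q≤ same i<n)))
        λ s′ ext size h → next s′ ext size (λ q<m → h q<m))
      λ s′ ext size h → done s′ ext size λ (p , p≤ , wp) (q , q≤ , wq) →
        pool-≗ {U p q} {_} {s′} (λ i<n → cong₂ _∨_ (wp i<n) (wq i<n)) (by-position {p} {q} {s′} h p≤ q≤)
    where
    m : ℕ
    m = top s
    ρ : ℕ → ℕ
    ρ = ((env [ 4 ≔ b ]) [ 5 ≔ t ]) [ 6 ≔ m ]
    U : ℕ → ℕ → Subset
    U p q = window (mem s) p ∪ window (mem s) q
    by-position : ∀ {p q s′} → (∀ {p} → p < m → ∀ {q} → q < m → p + n ≤ m → q + n ≤ m → InPool s′ (U p q)) →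
                  p + n ≤ m → q + n ≤ m → InPool s′ (U p q)
    by-position h p≤ q≤ = h (≤-trans (m<m+n _ 1≤n) p≤) (≤-trans (m<m+n _ 1≤n) q≤) p≤ q≤

  wp-perps : ∀ {B s Q} b t → top s ≤ B →
    (∀ s′ → s ⊑ s′ → top s′ ≡ top s + top s * n → (∀ {A} → InPool s A → InPool s′ (perp A)) → Q s′) →
    wp R B perps ((env [ 4 ≔ b ]) [ 5 ≔ t ]) Q s
  wp-perps {B} {s} b t m≤B done = m≤B , wp-collect R {7} {B} 6 (for 3 (push (perpE 7 8))) ρ n
      (λ p s′ → p + n ≤ m → InPool s′ (perp (window (mem s) p))) (λ ext h a → pool-⊑ ext (h a))
      (λ {p} {s₁} _ ext next → wp-row R {8} {B} 3 (perpE 7 8) (ρ [ 7 ≔ p ]) λ s′ new →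
        next s′ (extends new) (length≡ new) λ p≤ → row-pool {E = λ j M → perpV M p j} new λ {j} {M} j<n low →
          trans (positive-perpV M p j) (perp-cong (window-cong {M} {mem s} {p = p} p≤
            λ a a<m → trans (low a (≤-trans a<m (top-≤ ext))) (kept ext a a<m)) j<n))
      λ s′ ext size h → done s′ ext size λ (p , p≤ , w) →
        pool-≗ {perp (window (mem s) p)} {_} {s′} (perp-cong w) (h (≤-trans (m<m+n p 1≤n) p≤) p≤)
    where
    m : ℕ
    m = top s
    ρ : ℕ → ℕ
    ρ = ((env [ 4 ≔ b ]) [ 5 ≔ t ]) [ 6 ≔ m ]

  wp-round : ∀ {B s Q} b t → unionSize (top s) ≤ B →
    (∀ s′ → top s′ ≡ roundSize (top s) → Closure s s′ → Q s′) → wp R B round ((env [ 4 ≔ b ]) [ 5 ≔ t ]) Q s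
  wp-round {B} {s} {Q} b t m′≤B done =
    wp-unions {B} b t (≤-trans (m≤m+n (top s) _) m′≤B) λ s₁ ext₁ size₁ u →
    wp-perps {B} b t (≤-trans (≤-reflexive size₁) m′≤B) λ s₂ ext₂ size₂ v →
    done s₂ (trans size₂ (cong (λ m → m + m * n) size₁)) (record
      { grows  = ⊑-trans ext₁ ext₂
      ; unite  = λ a b → pool-⊑ ext₂ (u a b)
      ; unite⊥ = λ a b → v (u a b)
      ; polar  = λ a → v (pool-⊑ ext₁ a)
      })

  -- One round adds the polars of the basic sets, one lists the unions of length 1, and then each
  -- round doubles the length. The empty union is left out; its polar comes from `full-pool`.
  data Stage : ℕ → Store → Set where
    basics : ∀ {s} → (∀ G → InPool s ⟪ G ⟫) → Stage 0 s
    polars : ∀ {s} → (∀ G → InPool s ⟪ G ⟫) → (∀ G → InPool s (perp ⟪ G ⟫)) → Stage 1 s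
    closed : ∀ {e s} → (∀ {ℓ Z} → 1 ≤ ℓ → ℓ ≤ 2 ^ e → Generator ℓ Z → InPool s Z × InPool s (perp Z)) → Stage (2 + e) s

  generator-split : ∀ a b {Z} → Generator (a + b) Z →
    ∃[ Z₁ ] ∃[ Z₂ ] Generator a Z₁ × Generator b Z₂ × (∀ i → Z i ≡ (Z₁ ∪ Z₂) i)
  generator-split zero b gen = ∅ , _ , gnil , gen , λ _ → refl
  generator-split (suc a) b (gbasic G gen) = let Z₁ , Z₂ , g₁ , g₂ , e = generator-split a b gen in
    ⟪ G ⟫ ∪ Z₁ , Z₂ , gbasic G g₁ , g₂ , λ i → trans (cong (⟪ G ⟫ i ∨_) (e i)) (sym (∨-assoc (⟪ G ⟫ i) (Z₁ i) (Z₂ i)))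
  generator-split (suc a) b (gperp G gen) = let Z₁ , Z₂ , g₁ , g₂ , e = generator-split a b gen in
    perp ⟪ G ⟫ ∪ Z₁ , Z₂ , gperp G g₁ , g₂ , λ i → trans (cong (perp ⟪ G ⟫ i ∨_) (e i)) (sym (∨-assoc (perp ⟪ G ⟫ i) (Z₁ i) (Z₂ i)))

  stage-next : ∀ {r s s′} → Closure s s′ → Stage r s → Stage (suc r) s′
  stage-next cl (basics h) = polars (λ G → pool-⊑ (Closure.grows cl) (h G)) (λ G → Closure.polar cl (h G))
  stage-next {s = s} {s′} cl (polars h h⊥) = closed one
    where
    open Closure cl
    -- A generator of length 1 ends in `∅`, which need not be listed; the union of the set with
    -- itself has the same members.
    alone-in : ∀ {A} → InPool s A → InPool s′ (A ∪ ∅) × InPool s′ (perp (A ∪ ∅))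
    alone-in {A} a = pool-≗ {A ∪ A} {A ∪ ∅} {s′} (λ {i} _ → same i) (unite a a) ,
                     pool-≗ {perp (A ∪ A)} {perp (A ∪ ∅)} {s′} (perp-cong {A ∪ A} {A ∪ ∅} λ {i} _ → same i) (unite⊥ a a)
      where
      same : ∀ i → (A ∪ A) i ≡ (A ∪ ∅) i
      same i = trans (∨-idem (A i)) (sym (∨-identityʳ (A i)))
    one : ∀ {ℓ Z} → 1 ≤ ℓ → ℓ ≤ 1 → Generator ℓ Z → InPool s′ Z × InPool s′ (perp Z)
    one (s≤s z≤n) (s≤s z≤n) (gbasic G gnil) = alone-in (h G)
    one (s≤s z≤n) (s≤s z≤n) (gperp G gnil)  = alone-in (h⊥ G)
  stage-next {s = s} {s′} cl (closed {e} h) = closed more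
    where
    open Closure cl
    more : ∀ {ℓ Z} → 1 ≤ ℓ → ℓ ≤ 2 ^ suc e → Generator ℓ Z → InPool s′ Z × InPool s′ (perp Z)
    more {ℓ} {Z} 1≤ℓ ℓ≤ gen with ℓ ℕ.≤? 2 ^ e
    ... | yes l = let a , b = h 1≤ℓ l gen in pool-⊑ grows a , pool-⊑ grows b
    ... | no ¬l =
      let rest = ℓ ∸ 2 ^ e
          eq = m+[n∸m]≡n (<⇒≤ (≰⇒> ¬l))
          Z₁ , Z₂ , g₁ , g₂ , same = generator-split (2 ^ e) rest (subst (λ ℓ → Generator ℓ Z) (sym eq) gen)
          p₁ = proj₁ (h (m^n>0 2 e) ≤-refl g₁)
          p₂ = proj₁ (h (m<n⇒0<n∸m (≰⇒> ¬l)) (≤-trans (∸-monoˡ-≤ (2 ^ e) (≤-trans ℓ≤ (≤-reflexive (2^-double e)))) (≤-reflexive (m+n∸m≡n (2 ^ e) (2 ^ e)))) g₂)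
      in pool-≗ {Z₁ ∪ Z₂} {Z} {s′} (λ {i} _ → sym (same i)) (unite p₁ p₂) ,
         pool-≗ {perp (Z₁ ∪ Z₂)} {perp Z} {s′} (perp-cong {Z₁ ∪ Z₂} {Z} λ {i} _ → sym (same i)) (unite⊥ p₁ p₂)

  cycles : ℕ
  cycles = k * (16 * budgetConstant)

  foldn-cycles : ∀ k → foldn k (λ _ a → a + 16 * budgetConstant) 0 ≡ k * (16 * budgetConstant)
  foldn-cycles zero    = refl
  foldn-cycles (suc k) = trans (cong (_+ 16 * budgetConstant) (foldn-cycles k)) (+-comm (k * (16 * budgetConstant)) _)

  -- In this measure a round is at most a squaring, so `r` rounds give the exponent `2 ^ r`. The
  -- factor also leaves room for the improvements.
  scaled : ℕ → ℕ
  scaled m = (4 * (n * n)) * m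

  scaled-≥ : ∀ m → m ≤ scaled m
  scaled-≥ m = ≤-trans (≤-reflexive (sym (*-identityˡ m))) (*-monoˡ-≤ m {1} {4 * (n * n)} (*-mono-≤ {1} {4} (s≤s z≤n) (*-mono-≤ 1≤n 1≤n)))

  scaled-round : ∀ {m} → 1 ≤ m → scaled (roundSize m) ≤ scaled m * scaled m
  scaled-round {m} 1≤m = ≤-trans (*-monoʳ-≤ (4 * (n * n)) round≤) (≤-reflexive (regroup n m))
    where
    union≤ : unionSize m ≤ 2 * (m * (m * n))
    union≤ = ≤-trans (+-monoˡ-≤ (m * (m * n)) (≤-trans (≤-reflexive (sym (*-identityʳ m))) (*-monoʳ-≤ m (*-mono-≤ 1≤m 1≤n))))
               (≤-reflexive (cong (m * (m * n) +_) (sym (+-identityʳ _))))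
    round≤ : roundSize m ≤ 4 * (m * m * (n * n))
    round≤ = ≤-trans (+-mono-≤ (≤-trans (≤-reflexive (sym (*-identityʳ (unionSize m)))) (*-mono-≤ union≤ 1≤n)) (*-monoˡ-≤ n union≤)) (≤-reflexive (double m n))
      where
      double : ∀ m n → 2 * (m * (m * n)) * n + 2 * (m * (m * n)) * n ≡ 4 * (m * m * (n * n))
      double = solve-∀
    regroup : ∀ n m → (4 * (n * n)) * (4 * (m * m * (n * n))) ≡ ((4 * (n * n)) * m) * ((4 * (n * n)) * m)
    regroup = solve-∀

  wp-rounds : ∀ {B s Q} → Stage 0 s → 1 ≤ top s → 1 ≤ k → cycles ≤ B →
    (∀ r → 2 ^ r * 2 ^ r ≤ 4 * cycles → scaled (top s) ^ (2 ^ r) ≤ B) →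
    (∀ s′ e → s ⊑ s′ → scaled (top s′) ≤ B → Stage (2 + e) s′ → budgetConstant * k ≤ 2 ^ e * 2 ^ e → Q s′) →
    wp R B rounds env Q s
  wp-rounds {B} {s} {Q} stage 1≤top 1≤k c≤B cap done =
    ≤-trans (≤-reflexive folded) c≤B ,
    wp-for R {5} {B} 4 guardedRound (env [ 4 ≔ b ]) Inv
      (λ {t} {s₁} t<b inv next → step t s₁ (subst (t <_) folded t<b) inv next)
      (0 , z≤n , ⊑-refl , stage , ≤-reflexive (sym (*-identityʳ (scaled (top s)))) , ≤-trans 1≤c (m≤m+n cycles _) , inj₁ refl)
      finish
    where
    b : ℕ
    b = foldn k (λ _ a → a + 16 * budgetConstant) 0
    folded : b ≡ cycles
    folded = foldn-cycles k
    1≤c : 1 ≤ cycles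
    1≤c = *-mono-≤ 1≤k (*-mono-≤ {1} {16} (s≤s z≤n) 1≤budgetConstant)
    z : ℕ
    z = scaled (top s)
    -- After `t` passes, `r` of them made a round. Either all did, or `4 ^ r` exceeds the limit and
    -- the guard fails from then on.
    Inv : ℕ → Store → Set
    Inv t s₁ = ∃[ r ] r ≤ t × s ⊑ s₁ × Stage r s₁ × scaled (top s₁) ≤ z ^ (2 ^ r) × 2 ^ r * 2 ^ r ≤ 4 * cycles ×
               (r ≡ t ⊎ cycles < 4 ^ r)
    square : ∀ r → z ^ (2 ^ r) * z ^ (2 ^ r) ≡ z ^ (2 ^ suc r)
    square r = trans (sym (^-distribˡ-+-* z (2 ^ r) (2 ^ r))) (cong (z ^_) (sym (2^-double r)))
    step : ∀ {Q′ : Store → Set} t s₁ → t < cycles → Inv t s₁ → (∀ s′ → Inv (suc t) s′ → Q′ s′) →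
           wp R B guardedRound ((env [ 4 ≔ b ]) [ 5 ≔ t ]) Q′ s₁
    step t s₁ t<c (r , r≤t , ext , st , size , low , status) next = continue , stop
      where
      continue : foldn t (λ _ a → a + a + (a + a)) 1 ≤ b → wp R B round ((env [ 4 ≔ b ]) [ 5 ≔ t ]) _ s₁
      continue le = wp-round {B} b t (≤-trans (m≤m+n _ _) (≤-trans (scaled-≥ _) (≤-trans size′ (cap (suc r) low′))))
          λ s₂ size₂ cl → next s₂
            ( suc r , s≤s r≤t , ⊑-trans ext (Closure.grows cl) , stage-next cl st
            , ≤-trans (≤-reflexive (cong scaled size₂)) size′ , low′ , [ (λ e → inj₁ (cong suc e)) , (λ h → ⊥-elim (<⇒≱ h (≤-trans (^-monoʳ-≤ 4 r≤t) 4^t≤))) ]′ status)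
        where
        4^t≤ : 4 ^ t ≤ cycles
        4^t≤ = ≤-trans (≤-reflexive (sym (foldn-4^ t))) (≤-trans le (≤-reflexive folded))
        low′ : 2 ^ suc r * 2 ^ suc r ≤ 4 * cycles
        low′ = ≤-trans (≤-reflexive (sym (4^≡2^*2^ (suc r)))) (*-monoʳ-≤ 4 (≤-trans (^-monoʳ-≤ 4 r≤t) 4^t≤))
        size′ : scaled (roundSize (top s₁)) ≤ z ^ (2 ^ suc r)
        size′ = ≤-trans (scaled-round (≤-trans 1≤top (top-≤ ext))) (≤-trans (*-mono-≤ size size) (≤-reflexive (square r)))
      stop : ¬ foldn t (λ _ a → a + a + (a + a)) 1 ≤ b → _
      stop gt = next s₁ (r , m≤n⇒m≤1+n r≤t , ext , st , size , low , inj₂ ([ (λ { refl → big }) , (λ h → h) ]′ status))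
        where
        big : cycles < 4 ^ t
        big = ≰⇒> λ h → gt (≤-trans (≤-reflexive (foldn-4^ t)) (≤-trans h (≤-reflexive (sym folded))))
    finish : ∀ s′ → Inv b s′ → Q s′
    finish s′ (r , r≤b , ext , st , size , low , status) = conclude r st (≤-trans size (cap r low)) enough
      where
      enough : cycles < 4 ^ r
      enough = [ (λ { refl → subst (λ b → cycles < 4 ^ b) (sym folded) (n<4^n cycles) }) , (λ h → h) ]′ status
      16≤c : 16 ≤ cycles
      16≤c = *-mono-≤ 1≤k (*-monoʳ-≤ 16 1≤budgetConstant)
      conclude : ∀ r → Stage r s′ → scaled (top s′) ≤ B → cycles < 4 ^ r → Q s′
      conclude 0 _ _ l = ⊥-elim (<⇒≱ l (≤-trans (s≤s z≤n) 16≤c))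
      conclude 1 _ _ l = ⊥-elim (<⇒≱ l (≤-trans (s≤s (s≤s (s≤s (s≤s z≤n)))) 16≤c))
      conclude (suc (suc e)) st size l = done s′ e ext size st (*-cancelˡ-≤ 16 (≤-trans (≤-reflexive (reorder k budgetConstant))
        (≤-trans (<⇒≤ l) (≤-reflexive (trans (sixteen (4 ^ e)) (cong (16 *_) (4^≡2^*2^ e)))))))
        where
        reorder : ∀ k c → 16 * (c * k) ≡ k * (16 * c)
        reorder = solve-∀
        sixteen : ∀ a → 4 * (4 * a) ≡ 16 * a
        sixteen = solve-∀

-- Improvement of the recorded solutions

module Search (ℝ : RealNumbers) (n : ℕ) (R : ℕ → RealNumbers.Carrier ℝ)
              (r>0 : ∀ {i} → i < n → OrderedField._≺_ ℝ (RealNumbers.0# ℝ) (R (2 + i + i + i))) (1≤n : 1 ≤ n) (k : ℕ) where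
  open Values ℝ n R r>0
  open Pools ℝ n R r>0 1≤n k
  open Compilation ℝ
  open RealRAM ℝ using (_[_≔_])
  open Store

  Best : Store → Subset → ℕ → Set
  Best s W m = ∃[ Y ] InPool s Y × Y ⊆ W × Independent Y × m ≤ ♯ Y

  Independent-⊆ : ∀ {A B} → A ⊆ B → Independent B → Independent A
  Independent-⊆ h ind i<n j<n a b = ind i<n j<n (h i<n a) (h j<n b)

  ∪-cong : ∀ {A A′ B B′} → A ≗ A′ → B ≗ B′ → A ∪ B ≗ A′ ∪ B′
  ∪-cong h k l = cong₂ _∨_ (h l) (k l)

  -- Only sizes are compared; the set that is recorded need not be `A ∪ B`. Nonemptiness keeps its
  -- value apart from the 0 of invalid pairs.
  Improves : Store → Store → Subset → Set
  Improves s s′ W = ∀ {A B} → InPool s A → InPool s B → A ∪ B ⊆ W → Independent (A ∪ B) → 1 ≤ ♯ (A ∪ B) → Best s′ W (♯ (A ∪ B))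

  scope : ℕ → ℕ → ℕ → ℕ → ℕ → ℕ → ℕ
  scope N K r w m = ((((env [ 4 ≔ N ]) [ 5 ≔ K ]) [ 6 ≔ r ]) [ 7 ≔ w ]) [ 8 ≔ m ]

  firstE-≡ : ∀ N K r w m M → ⟦ firstE ⟧ (scope N K r w m) M R ≡ argmax m (λ p → maximum m (λ q → valueV M m w p q))
  firstE-≡ N K r w m M = refl

  secondE-≡ : ∀ N K r w m M P → ⟦ secondE ⟧ (scope N K r w m [ 9 ≔ P ]) M R ≡ argmax m (λ q → valueV M m w P q)
  secondE-≡ N K r w m M P = refl

  improves-by : ∀ {s s′ w P Q} → Row s s′ n (λ i M → pair M P Q i) →
    (∀ {p q} → p < top s → q < top s → valueV (mem s) (top s) w p q ≤ valueV (mem s) (top s) w P Q) →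
    Improves s s′ (window (mem s) w)
  improves-by {s} {s′} {w} {P} {Q} new best {A} {B} (p , p≤ , wa) (q , q≤ , wb) sub ind pos =
    let UA : window M p ∪ window M q ≗ A ∪ B
        UA = ∪-cong {window M p} {A} {window M q} {B} wa wb
        U⊆ : window M p ∪ window M q ⊆ A ∪ B
        U⊆ = ≗⇒⊆ UA
        size : ♯ (A ∪ B) ≡ ♯ (window M p ∪ window M q)
        size = ♯-cong {A ∪ B} {window M p ∪ window M q} (≗⇒⊆ (≗-sym {window M p ∪ window M q} {A ∪ B} UA)) U⊆
        value = valueV-valid M m w p q p≤ q≤ (Independent-⊆ {window M p ∪ window M q} {A ∪ B} U⊆ ind) (λ l e → sub l (U⊆ l e))
        better : ♯ (A ∪ B) ≤ valueV M m w P Q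
        better = ≤-trans (≤-reflexive (trans size (sym value))) (best (≤-trans (m<m+n p 1≤n) p≤) (≤-trans (m<m+n q 1≤n) q≤))
        P≤ , Q≤ , indY , Y⊆ , valueY = valueV-positive M m w P Q (≤-trans pos better)
    in window M P ∪ window M Q
     , row-pool {E = λ i M → pair M P Q i} new (λ {i} {M′} i<n low → trans (window-pair M′ P Q i)
         (cong₂ _∨_ (window-cong {M′} {M} {p = P} P≤ low i<n) (window-cong {M′} {M} {p = Q} Q≤ low i<n)))
     , Y⊆ , indY , ≤-trans better (≤-reflexive valueY)
    where
    m : ℕ
    m = top s
    M : Memory
    M = mem s

  wp-pair : ∀ {C s Q} N K r w (e₁ : Exp 9) (e₂ : Exp 10) P P′ → top s ≤ C →
    ⟦ e₁ ⟧ (scope N K r w (top s)) (mem s) R ≡ P → P ≤ C → ⟦ e₂ ⟧ (scope N K r w (top s) [ 9 ≔ P ]) (mem s) R ≡ P′ → P′ ≤ C →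
    (∀ {p q} → p < top s → q < top s → valueV (mem s) (top s) w p q ≤ valueV (mem s) (top s) w P P′) →
    (∀ s′ → s ⊑ s′ → top s′ ≡ top s + n → Improves s s′ (window (mem s) w) → Q s′) →
    wp R C (lettop (lett e₁ (lett e₂ (for 3 (push (pairE 9 10 11)))))) ((((env [ 4 ≔ N ]) [ 5 ≔ K ]) [ 6 ≔ r ]) [ 7 ≔ w ]) Q s
  wp-pair {C} {s} {Q} N K r w e₁ e₂ P P′ m≤C refl P≤ refl P′≤ best done =
    m≤C , P≤ , P′≤ , wp-row R {11} {C} 3 (pairE 9 10 11) ((scope N K r w (top s) [ 9 ≔ P ]) [ 10 ≔ P′ ]) {s} {Q} λ s′ new →
      done s′ (extends new) (length≡ new) (improves-by {s} {s′} {w} {P} {P′} new best)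

  wp-improvement : ∀ {C s Q} N K r w → top s ≤ C →
    (∀ s′ → s ⊑ s′ → top s′ ≡ top s + n → Improves s s′ (window (mem s) w) → Q s′) →
    wp R C improvement ((((env [ 4 ≔ N ]) [ 5 ≔ K ]) [ 6 ≔ r ]) [ 7 ≔ w ]) Q s
  wp-improvement {C} {s} {Q} N K r w m≤C done =
    wp-pair {C} {s} {Q} N K r w firstE secondE
      (argmax m (λ p → maximum m (valueV M m w p))) (argmax m (valueV M m w (argmax m (λ p → maximum m (valueV M m w p))))) m≤C
      (firstE-≡ N K r w m M) (≤-trans (argmax-≤ m (λ p → maximum m (valueV M m w p))) m≤C)
      (secondE-≡ N K r w m M (argmax m (λ p → maximum m (valueV M m w p)))) (≤-trans (argmax-≤ m (valueV M m w (argmax m (λ p → maximum m (valueV M m w p))))) m≤C)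
      (λ p<m q<m → argmax₂-upper m (valueV M m w) p<m q<m) done
    where
    m : ℕ
    m = top s
    M : Memory
    M = mem s

  -- The invariant of the rounds: regions come from `s₀`, the memory before the first of them, and
  -- solutions from the current memory `s`.
  Progress : Store → ℕ → Store → Set
  Progress s₀ r s = ∀ {L} → (∀ {ℓ Z} → ℓ ≤ L → Generator ℓ Z → InPool s₀ (perp Z)) →
    ∀ {W m} → Attainable L r W m → Best s W m

  module _ {s₀ : Store} (single-pool : ∀ {g} → g < n → InPool s₀ ⁅ g ⁆) where

    best-⊑ : ∀ {s s′ W m} → s ⊑ s′ → Best s W m → Best s′ W m
    best-⊑ {s} {s′} ext (Y , p , rest) = Y , pool-⊑ {Y} {s} {s′} ext p , rest

    best-alone : ∀ {s g} → s₀ ⊑ s → g < n → Best s ⁅ g ⁆ 1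
    best-alone {s} {g} ext g<n = ⁅ g ⁆ , pool-⊑ {⁅ g ⁆} {s₀} {s} ext (single-pool g<n) , (λ _ e → e) , Independent-⁅⁆ g , ≤-reflexive (sym (♯-⁅⁆ g<n))

    best-widen : ∀ {s W W′ m} → W ⊆ W′ → Best s W m → Best s W′ m
    best-widen h (Y , p , Y⊆ , rest) = Y , p , (λ l e → h l (Y⊆ l e)) , rest

    progress-zero : Progress s₀ 0 s₀
    progress-zero region (alone g<n)      = best-alone ⊑-refl g<n
    progress-zero region (widen {W = W} {W′} z≤n h at) = best-widen {s₀} {W} {W′} h (progress-zero region at)

    -- The two parts of a join are replaced by recorded sets in the same subregions. These
    -- subregions do not meet, so the union stays independent and its size is the sum; it competes
    -- for the record of the whole region.
    progress-suc : ∀ {r s s′} → s₀ ⊑ s → s ⊑ s′ → (∀ {W} → InPool s₀ W → Improves s s′ W) →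
                   Progress s₀ r s → Progress s₀ (suc r) s′
    progress-suc {r} {s} {s′} ext₀ ext improve prog {L} region = go ≤-refl
      where
      go : ∀ {r′ W m} → r′ ≤ suc r → Attainable L r′ W m → Best s′ W m
      go le (alone g<n) = best-alone (⊑-trans ext₀ ext) g<n
      go le (widen {W = W} {W′} k≤ h at) = best-widen {s′} {W} {W′} h (go (≤-trans k≤ le) at)
      go (s≤s le) (join {Z = Z} {a = a} {b} ℓ≤L gen h₁ h₂ cross 1≤a at₁ at₂) =
        let A , pA , A⊆ , indA , a≤ = prog region (widen le (λ _ e → e) at₁)
            B , pB , B⊆ , indB , b≤ = prog region (widen le (λ _ e → e) at₂)
            crossAB = λ {i} {j} (i<n : i < n) (j<n : j < n) (ai : A i ≡ true) (bj : B j ≡ true) → cross i<n j<n (A⊆ i<n ai) (B⊆ j<n bj)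
            a+b≤ = ≤-trans (+-mono-≤ a≤ b≤) (≤-reflexive (sym (♯-cross {A} {B} crossAB)))
            Y , pY , Y⊆ , indY , y≤ = improve (region ℓ≤L gen) pA pB
              (λ l e → ∨-elim e (λ ai → h₁ l (A⊆ l ai)) (λ bi → h₂ l (B⊆ l bi)))
              (Independent-∪ {A} {B} indA indB crossAB) (≤-trans 1≤a (≤-trans (m≤m+n a b) a+b≤))
        in Y , pY , Y⊆ , indY , ≤-trans a+b≤ y≤

  wp-improvement-loop : ∀ {C s Q} (c : Cmd 8) →
    (∀ {s₁ Q′} N K r w → top s₁ ≤ C → (∀ s′ → s₁ ⊑ s′ → top s′ ≡ top s₁ + n → Improves s₁ s′ (window (mem s₁) w) → Q′ s′) →
      wp R C c ((((env [ 4 ≔ N ]) [ 5 ≔ K ]) [ 6 ≔ r ]) [ 7 ≔ w ]) Q′ s₁) →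
    (∀ {g} → g < n → InPool s ⁅ g ⁆) → k + k ≤ C → top s + (k + k) * (top s * n) ≤ C →
    (∀ s′ → s ⊑ s′ → top s′ ≡ top s + (k + k) * (top s * n) → Progress s (k + k) s′ → Q s′) →
    wp R C (lettop (lett (plus (var 2) (var 2)) (for 5 (for 4 c)))) env Q s
  wp-improvement-loop {C} {s} {Q} c spec single-pool kk≤C size≤C done =
    ≤-trans (m≤m+n N _) size≤C , kk≤C ,
    wp-for R {6} {C} 5 (for 4 c) ((env [ 4 ≔ N ]) [ 5 ≔ k + k ]) Inv step
      (⊑-refl , sym (+-identityʳ N) , progress-zero {s} single-pool)
      λ s′ (ext , size , prog) → done s′ ext size prog
    where
    N : ℕ
    N = top s
    Inv : ℕ → Store → Set
    Inv r s₁ = s ⊑ s₁ × top s₁ ≡ N + r * (N * n) × Progress s r s₁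
    bound : ∀ {r} → r ≤ k + k → N + r * (N * n) ≤ C
    bound r≤ = ≤-trans (+-monoʳ-≤ N (*-monoˡ-≤ (N * n) r≤)) size≤C
    step : ∀ {r s₁} {Q′ : Store → Set} → r < k + k → Inv r s₁ → (∀ s′ → Inv (suc r) s′ → Q′ s′) →
           wp R C (for 4 c) (((env [ 4 ≔ N ]) [ 5 ≔ k + k ]) [ 6 ≔ r ]) Q′ s₁
    step {r} {s₁} {Q′} r<kk (ext , size , prog) next =
      wp-for R {7} {C} 4 c (((env [ 4 ≔ N ]) [ 5 ≔ k + k ]) [ 6 ≔ r ])
        (λ w s₂ → s₁ ⊑ s₂ × top s₂ ≡ top s₁ + w * n × (∀ {v} → v < w → v + n ≤ N → Improves s₁ s₂ (window (mem s) v)))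
        (λ {w} {s₂} w<N (ext₂ , size₂ , h) next′ → spec {s₂} N (k + k) r w (fits w<N size₂) λ s₃ ext₃ size₃ imp →
          next′ s₃ ( ⊑-trans ext₂ ext₃
                   , trans size₃ (trans (cong (_+ n) size₂) (trans (+-assoc (top s₁) (w * n) n) (cong (top s₁ +_) (+-comm (w * n) n))))
                   , extend ext₂ ext₃ h imp))
        (⊑-refl , sym (+-identityʳ (top s₁)) , λ ())
        λ s′ (ext′ , size′ , h) → next s′
          ( ⊑-trans ext ext′
          , trans size′ (trans (cong (_+ N * n) size) (trans (+-assoc N (r * (N * n)) (N * n)) (cong (N +_) (+-comm (r * (N * n)) (N * n)))))
          , progress-suc {s} single-pool {r} {s₁} {s′} ext ext′ (λ {W} → by-window {s′} h {W}) prog)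
      where
      fits : ∀ {w t} → w < N → t ≡ top s₁ + w * n → t ≤ C
      fits {w} w<N refl = ≤-trans (+-mono-≤ (≤-reflexive size) (*-monoˡ-≤ n (<⇒≤ w<N)))
        (≤-trans (≤-reflexive (trans (+-assoc N (r * (N * n)) (N * n)) (cong (N +_) (+-comm (r * (N * n)) (N * n))))) (bound r<kk))
      improves-⊑ : ∀ {t u v W} → s₁ ⊑ t → u ⊑ v → Improves t u W → Improves s₁ v W
      improves-⊑ {t} {u} {v} {W} e e′ imp {A} {B} a b sub ind pos =
        best-⊑ {s} single-pool {u} {v} {W} e′ (imp {A} {B} (pool-⊑ {A} {s₁} {t} e a) (pool-⊑ {B} {s₁} {t} e b) sub ind pos)
      improves-≗ : ∀ {t u V W} → V ≗ W → Improves t u V → Improves t u W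
      improves-≗ {t} {u} {V} {W} h imp {A} {B} a b sub ind pos =
        best-widen {s} single-pool {u} {V} {W} (≗⇒⊆ h) (imp {A} {B} a b (λ l e → ≗⇒⊆ (≗-sym {V} {W} h) l (sub l e)) ind pos)
      extend : ∀ {w s₂ s₃} → s₁ ⊑ s₂ → s₂ ⊑ s₃ → (∀ {v} → v < w → v + n ≤ N → Improves s₁ s₂ (window (mem s) v)) →
               Improves s₂ s₃ (window (mem s₂) w) → ∀ {v} → v < suc w → v + n ≤ N → Improves s₁ s₃ (window (mem s) v)
      extend {w} {s₂} {s₃} ext₂ ext₃ h imp {v} l v≤ with ℕ._≟_ v w
      ... | yes refl = improves-≗ {s₁} {s₃} {window (mem s₂) w} {window (mem s) w}
            (window-cong {mem s₂} {mem s} {p = w} v≤ (kept (⊑-trans ext ext₂)))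
            (improves-⊑ {s₂} {s₃} {s₃} {window (mem s₂) w} ext₂ ⊑-refl imp)
      ... | no ne    = improves-⊑ {s₁} {s₂} {s₃} {window (mem s) v} ⊑-refl ext₃ (h (≤∧≢⇒< (≤-pred l) ne) v≤)
      by-window : ∀ {s′} → (∀ {v} → v < N → v + n ≤ N → Improves s₁ s′ (window (mem s) v)) → ∀ {W} → InPool s W → Improves s₁ s′ W
      by-window {s′} h {W} (v , v≤ , e) = improves-≗ {s₁} {s′} {window (mem s) v} {W} e (h (≤-trans (m<m+n v 1≤n) v≤) v≤)

  wp-improvements : ∀ {C s Q} → (∀ {g} → g < n → InPool s ⁅ g ⁆) → k + k ≤ C → top s + (k + k) * (top s * n) ≤ C →
    (∀ s′ → s ⊑ s′ → top s′ ≡ top s + (k + k) * (top s * n) → Progress s (k + k) s′ → Q s′) →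
    wp R C improvements env Q s
  wp-improvements {C} {s} {Q} = wp-improvement-loop {C} {s} {Q} improvement (λ {s₁} {Q′} → wp-improvement {C} {s₁} {Q′})

  window-idem : ∀ M p → window M p ∪ window M p ≗ window M p
  window-idem M p {i} _ = ∨-idem (window M p i)

  soloV-valid : ∀ M p → Independent (window M p) → soloV M p ≡ ♯ (window M p)
  soloV-valid M p ind = trans (if-true (leq-true (≤-reflexive (Independent⇒conflictV M p p
      (Independent-⊆ {window M p ∪ window M p} {window M p} (≗⇒⊆ (window-idem M p)) ind)))))
    (trans (sizeV-♯ M p p) (sumTo-cong n λ {i} l → cong [_] (window-idem M p {i} l)))

  soloV-positive : ∀ M p → 1 ≤ soloV M p → Independent (window M p) × soloV M p ≡ ♯ (window M p)
  soloV-positive M p h with true-or-false (leq (conflictV M p p) 0)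
  ... | inj₂ e = ⊥-elim (<⇒≱ h (≤-reflexive (if-false e)))
  ... | inj₁ e = ind , soloV-valid M p ind
    where
    ind : Independent (window M p)
    ind = Independent-⊆ {window M p} {window M p ∪ window M p} (≗⇒⊆ (≗-sym {window M p ∪ window M p} {window M p} (window-idem M p)))
            (conflictV⇒Independent M p p (n≤0⇒n≡0 (leq-≤ e)))

  record Found (s : Store) : Set where
    field
      answers    : ans s ≡ 1
      positions  : ∀ {j} → j < k → mem s j < n
      increasing : ∀ {i j} → i < j → j < k → mem s i < mem s j
      separate   : ∀ {i j} → i < k → j < k → i ≢ j → meet (mem s i) (mem s j) ≡ false

  Result : Store → Set
  Result s = Found s ⊎ (ans s ≡ 0 × (∀ X → Independent X → ¬ k ≤ ♯ X))

  module Listing (M : Memory) (P : ℕ) where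

    -- Increasing order makes the positions distinct. `intact` tells which cells of the old memory
    -- have not yet been overwritten by the list.
    record Listed (i : ℕ) (s : Store) : Set where
      field
        count   : top s ≡ sumTo i (λ i → [ window M P i ])
        intact  : ∀ a → top s ≤ a → mem s a ≡ M a
        bounded : ∀ {j} → j < top s → mem s j < i
        member  : ∀ {j} → j < top s → window M P (mem s j) ≡ true
        ordered : ∀ {i j} → i < j → j < top s → mem s i < mem s j

    []-≤1 : ∀ b → [ b ] ≤ 1
    []-≤1 true  = ≤-refl
    []-≤1 false = z≤n

    top≤ : ∀ {i s} → Listed i s → top s ≤ i
    top≤ {i} L = ≤-trans (≤-reflexive (Listed.count L)) (≤-trans (sumTo-mono i λ {j} _ → []-≤1 (window M P j))
                   (≤-reflexive (trans (sumTo-const i 1) (*-identityʳ i))))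

    start : ∀ {a} → Listed 0 (store a 0 M)
    start = record { count = refl ; intact = λ _ _ → refl ; bounded = λ () ; member = λ () ; ordered = λ _ () }

    -- The list may overwrite the chosen set while it is being read. After `i` positions at most `i`
    -- cells are written, and cell `P + i` lies beyond them.
    read : ∀ {i s} → Listed i s → mem s (P + i) ≡ M (P + i)
    read {i} L = Listed.intact L (P + i) (≤-trans (top≤ L) (m≤n+m i P))

    skip-nonmember : ∀ {i s} → Listed i s → window M P i ≡ false → Listed (suc i) s
    skip-nonmember {i} L e = record
      { count = trans count (sym (trans (cong (λ b → sumTo i _ + [ b ]) e) (+-identityʳ _)))
      ; intact = intact ; bounded = λ l → m≤n⇒m≤1+n (bounded l) ; member = member ; ordered = ordered }
      where open Listed L

    add-member : ∀ {i s} → Listed i s → window M P i ≡ true → Listed (suc i) (store (ans s) (suc (top s)) (mem s [ top s ≔ i ]))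
    add-member {i} {s} L e = record
      { count   = trans (cong suc count) (trans (+-comm 1 _) (cong (λ b → sumTo i _ + [ b ]) (sym e)))
      ; intact  = λ a l → trans (upd-other (mem s) (top s) a λ { refl → <-irrefl refl l }) (intact a (<⇒≤ l))
      ; bounded = λ {j} l → below j (m≤n⇒m<n∨m≡n (≤-pred l))
      ; member  = λ {j} l → inside j (m≤n⇒m<n∨m≡n (≤-pred l))
      ; ordered = λ {i′} {j} i′<j l → sorted i′ j i′<j (m≤n⇒m<n∨m≡n (≤-pred l))
      }
      where
      open Listed L
      m′ : Memory
      m′ = mem s [ top s ≔ i ]
      old : ∀ {j} → j < top s → m′ j ≡ mem s j
      old {j} l = upd-other (mem s) (top s) j λ { refl → <-irrefl refl l }
      last : m′ (top s) ≡ i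
      last = upd-same (mem s) (top s)
      below : ∀ j → j < top s ⊎ j ≡ top s → m′ j < suc i
      below j (inj₁ l)    = s≤s (≤-trans (≤-reflexive (old l)) (<⇒≤ (bounded l)))
      below j (inj₂ refl) = s≤s (≤-reflexive last)
      inside : ∀ j → j < top s ⊎ j ≡ top s → window M P (m′ j) ≡ true
      inside j (inj₁ l)    = trans (cong (window M P) (old l)) (member l)
      inside j (inj₂ refl) = trans (cong (window M P) last) e
      sorted : ∀ i′ j → i′ < j → j < top s ⊎ j ≡ top s → m′ i′ < m′ j
      sorted i′ j i′<j (inj₁ l)    = ≤-trans (s≤s (≤-reflexive (old (<-trans i′<j l)))) (≤-trans (ordered i′<j l) (≤-reflexive (sym (old l))))
      sorted i′ j i′<j (inj₂ refl) = ≤-trans (s≤s (≤-reflexive (old i′<j))) (≤-trans (bounded i′<j) (≤-reflexive (sym last)))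

  wp-report : ∀ {C s Q} P → 1 ≤ k → (∀ {p} → p < top s → soloV (mem s) p ≤ soloV (mem s) P) →
    (∀ X → Independent X → k ≤ ♯ X → ∃[ Y ] InPool s Y × Independent Y × k ≤ ♯ Y) → (∀ s′ → Result s′ → Q s′) →
    wp R C (ifleq (var 2) (soloE 5) (reset ⨟ for 3 listMember ⨟ answer 1) (answer 0)) ((env [ 4 ≔ top s ]) [ 5 ≔ P ]) Q s
  wp-report {C} {s} {Q} P 1≤k best complete done =
    (λ (k≤ : k ≤ soloV M P) → wp-for R {6} {C} 3 listMember ((env [ 4 ≔ top s ]) [ 5 ≔ P ]) Listed
       (λ {i} {s₁} {Q′} i<n L next →
           (λ (h : 1 ≤ mem s₁ (P + i)) → next _ (add-member L (leq-true (≤-trans h (≤-reflexive (read L))))))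
         , (λ (h : ¬ 1 ≤ mem s₁ (P + i)) → next s₁ (skip-nonmember L (leq-false λ l → h (≤-trans l (≤-reflexive (sym (read L))))))))
       start (λ s₁ L → done _ (inj₁ (found k≤ L))))
    , (λ (¬k≤ : ¬ k ≤ soloV M P) → done _ (inj₂ (refl , λ X ind k≤X → ¬k≤ (big X ind k≤X))))
    where
    M : Memory
    M = mem s
    open Listing M P
    big : ∀ X → Independent X → k ≤ ♯ X → k ≤ soloV M P
    big X ind k≤X =
      let Y , (p , p≤ , w) , indY , k≤Y = complete X ind k≤X
          indW = Independent-⊆ {window M p} {Y} (≗⇒⊆ w) indY
      in ≤-trans k≤Y (≤-trans (≤-reflexive (trans (♯-cong {Y} {window M p} (≗⇒⊆ (≗-sym {window M p} {Y} w)) (≗⇒⊆ w)) (sym (soloV-valid M p indW))))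
           (best (≤-trans (m<m+n p 1≤n) p≤)))
    found : ∀ {s₁} → k ≤ soloV M P → Listed n s₁ → Found (store 1 (top s₁) (mem s₁))
    found {s₁} k≤ L =
      let ind , size = soloV-positive M P (≤-trans 1≤k k≤)
          k≤top : k ≤ top s₁
          k≤top = ≤-trans k≤ (≤-reflexive (trans size (sym count)))
      in record
        { answers    = refl
        ; positions  = λ l → bounded (≤-trans l k≤top)
        ; increasing = λ i<j j<k → ordered i<j (≤-trans j<k k≤top)
        ; separate   = λ {i} {j} i<k j<k ne → let i< = ≤-trans i<k k≤top
                                                  j< = ≤-trans j<k k≤top
            in ind (bounded i<) (bounded j<) (member i<) (member j<)
                 λ e → [ (λ l → <-irrefl e (ordered l j<)) , (λ l → <-irrefl (sym e) (ordered l i<)) ]′ (≢⇒<∨> ne)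
        }
      where
      open Listed L

  wp-output : ∀ {C s Q} → 1 ≤ k → top s ≤ C →
    (∀ X → Independent X → k ≤ ♯ X → ∃[ Y ] InPool s Y × Independent Y × k ≤ ♯ Y) → (∀ s′ → Result s′ → Q s′) →
    wp R C output env Q s
  wp-output {C} {s} {Q} 1≤k m≤C complete done = m≤C ,
    wp-lett R {5} {C} (argmaxE 4 λ p → soloE p) (ifleq (var 2) (soloE 5) (reset ⨟ for 3 listMember ⨟ answer 1) (answer 0)) (env [ 4 ≔ top s ]) {s} {Q}
      (argmax (top s) (soloV (mem s))) refl (≤-trans (argmax-≤ (top s) (soloV (mem s))) m≤C)
      (wp-report {C} {s} {Q} (argmax (top s) (soloV (mem s))) 1≤k (λ l → argmax-upper (top s) (soloV (mem s)) l) complete done)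

-- Correctness of the search

module Correctness (ℝ : RealNumbers) (n : ℕ) (R : ℕ → RealNumbers.Carrier ℝ)
                   (r>0 : ∀ {i} → i < n → OrderedField._≺_ ℝ (RealNumbers.0# ℝ) (R (2 + i + i + i)))
                   (1≤n : 1 ≤ n) (k : ℕ) (1≤k : 1 ≤ k) (k≤n : k ≤ n) where
  open Values ℝ n R r>0
  open Pools ℝ n R r>0 1≤n k
  open Search ℝ n R r>0 1≤n k
  open Compilation ℝ
  open OrderedField ℝ using (≼-trans; ≼-total; _≼_; _≼?_)
  open Store

  initialSize : ℕ
  initialSize = n * n + n * (n * n)

  -- The budget is fixed for `k` disks, so a larger independent set is trimmed to exactly `k`.
  subset-of-size : ∀ d m X → ♯ X ≡ d + m → ∃[ X′ ] X′ ⊆ X × ♯ X′ ≡ m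
  subset-of-size zero    m X e = X , (λ _ a → a) , e
  subset-of-size (suc d) m X e =
    let x , x<n , Xx = ♯-witness (≤-trans (s≤s z≤n) (≤-reflexive (sym e)))
        X′ , sub , e′ = subset-of-size d m (X ∖ ⁅ x ⁆) (suc-injective (trans (sym (♯-remove x<n Xx)) e))
    in X′ , (λ l a → ∧-fst (sub l a)) , e′

  -- The recursion starts with no set to be avoided. That region is a row, given by the least square
  -- around centre 0 that contains every disk.
  full-pool : ∀ {s} → (∀ {c l} → c < n → l < n → InPool s (inRow c l)) → InPool s (perp ∅)
  full-pool {s} rows = let l , l<n , _ , top = greatest {λ a b → ψ 0 a ≼ ψ 0 b} ≼-trans (λ a b → ≼-total _ _) (λ _ → true) 1≤n refl in
    pool-≗ {inRow 0 l} {perp ∅} {s} (λ {j} j<n → trans (yes! (ψ 0 j ≼? ψ 0 l) (top j<n refl)) (sym (perp-intro {∅} {j} λ _ ()))) (rows 1≤n l<n)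

  attains : ∀ {s₁ s₂ e} → (∀ {ℓ Z} → ℓ ≤ 2 ^ e → Generator ℓ Z → InPool s₁ (perp Z)) → budgetConstant * k ≤ 2 ^ e * 2 ^ e →
            Progress s₁ (k + k) s₂ → ∀ X → Independent X → k ≤ ♯ X → ∃[ Y ] InPool s₂ Y × Independent Y × k ≤ ♯ Y
  attains {s₁} {s₂} {e} region budget prog X ind k≤X =
    let X′ , sub , size = subset-of-size (♯ X ∸ k) k X (sym (m∸n+n≡m k≤X))
        Y , pY , _ , indY , k≤Y = prog region (widen {W′ = perp ∅} (≤-reflexive (cong (k +_) (+-identityʳ k))) (λ _ e → e)
          (subst (λ m → Attainable (2 ^ e) (2 * m) (perp ∅) m) size
            (Completeness.complete (2 ^ e) (♯ X′) {X′} {∅} {0} {2 ^ e} (Independent-⊆ {X′} {X} sub ind)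
              (≤-trans 1≤k (≤-reflexive (sym size))) ≤-refl gnil (λ {j} _ _ → perp-intro {∅} {j} λ _ ())
              (≤-reflexive (+-identityʳ _)) (subst (λ m → budgetConstant * m ≤ 2 ^ e * 2 ^ e) (sym size) budget))))
    in Y , pY , indY , k≤Y

  wp-search : ∀ {C M} → cycles ≤ C → (∀ r → 2 ^ r * 2 ^ r ≤ 4 * cycles → scaled initialSize ^ (2 ^ r) ≤ C) →
              wp R C search env Result (store n 0 M)
  wp-search {C} {M} cycles≤ cap =
    wp-singles {C} λ s₁ ext₁ size₁ points →
    wp-rows {C} λ s₂ ext₂ size₂ rows →
    let size : top s₂ ≡ initialSize
        size = trans size₂ (cong (_+ n * (n * n)) size₁)
    in wp-rounds {C} (basics λ { (single g g<n) → pool-⊑ ext₂ (points g<n) ; (row c l c<n l<n) → rows c<n l<n })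
         (≤-trans (≤-trans (*-mono-≤ 1≤n 1≤n) (m≤m+n (n * n) _)) (≤-reflexive (sym size))) 1≤k cycles≤
         (λ r h → subst (λ m → scaled m ^ (2 ^ r) ≤ C) (sym size) (cap r h))
         λ { s₃ e ext₃ scaled≤ (closed h) budget →
             wp-improvements {C} (λ g<n → pool-⊑ (⊑-trans ext₂ ext₃) (points g<n))
               (≤-trans kk≤ cycles≤) (≤-trans (size≤ (top s₃)) scaled≤) λ s₄ ext₄ size₄ prog →
             wp-output {C} 1≤k (≤-trans (≤-reflexive size₄) (≤-trans (size≤ (top s₃)) scaled≤))
               (attains {s₃} {s₄} {e} (λ { {zero} _ gnil → pool-⊑ ext₃ (full-pool {s₂} rows) ; {suc ℓ} ℓ≤ gen → proj₂ (h (s≤s z≤n) ℓ≤ gen) }) budget prog)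
               λ _ res → res }
    where
    -- The `2 k` rounds add `2 k n N` cells, and `k ≤ n` makes them fit into `scaled`.
    size≤ : ∀ N → N + (k + k) * (N * n) ≤ scaled N
    size≤ N = begin
      N + (k + k) * (N * n)                ≤⟨ +-mono-≤ one (*-monoˡ-≤ (N * n) (+-mono-≤ k≤n k≤n)) ⟩
      N * (n * n) + (n + n) * (N * n)      ≡⟨ collect n N ⟩
      (3 * (n * n)) * N                    ≤⟨ *-monoˡ-≤ N (*-monoˡ-≤ (n * n) (m≤n+m 3 1)) ⟩
      scaled N                             ∎
      where
      open ≤-Reasoning
      one : N ≤ N * (n * n)
      one = ≤-trans (≤-reflexive (sym (*-identityʳ N))) (*-monoʳ-≤ N (*-mono-≤ 1≤n 1≤n))
      collect : ∀ n N → N * (n * n) + (n + n) * (N * n) ≡ (3 * (n * n)) * N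
      collect = solve-∀
    kk≤ : k + k ≤ cycles
    kk≤ = ≤-trans (≤-reflexive (double k)) (*-monoʳ-≤ k (*-mono-≤ {2} {16} (s≤s (s≤s z≤n)) 1≤budgetConstant))
      where
      double : ∀ k → k + k ≡ k * (2 * 1)
      double = solve-∀

-- The running time

-- The degree comes from the program text alone. Any polynomial in the size bound will do, as it
-- changes the exponent of `n` by a constant factor.
PolynomiallyBounded : (ℕ → ℕ) → Set
PolynomiallyBounded f = ∃[ K ] ∃[ D ] (∀ B → f B ≤ K * suc B ^ D)

pb-const : ∀ c → PolynomiallyBounded (λ _ → c)
pb-const c = c , 0 , λ B → ≤-reflexive (sym (*-identityʳ c))

pb-+ : ∀ {f g} → PolynomiallyBounded f → PolynomiallyBounded g → PolynomiallyBounded (λ B → f B + g B)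
pb-+ {f} {g} (K , D , h) (K′ , D′ , h′) = K + K′ , D + D′ , λ B → begin
  f B + g B                                                ≤⟨ +-mono-≤ (h B) (h′ B) ⟩
  K * suc B ^ D + K′ * suc B ^ D′                          ≤⟨ +-mono-≤ (*-monoʳ-≤ K (^-monoʳ-≤ (suc B) (m≤m+n D D′))) (*-monoʳ-≤ K′ (^-monoʳ-≤ (suc B) (m≤n+m D′ D))) ⟩
  K * suc B ^ (D + D′) + K′ * suc B ^ (D + D′)             ≡⟨ *-distribʳ-+ (suc B ^ (D + D′)) K K′ ⟨
  (K + K′) * suc B ^ (D + D′)                              ∎
  where open ≤-Reasoning

pb-loop : ∀ {f} → PolynomiallyBounded f → PolynomiallyBounded (λ B → B * f B)
pb-loop {f} (K , D , h) = K , suc D , λ B → begin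
  B * f B                    ≤⟨ *-mono-≤ (n≤1+n B) (h B) ⟩
  suc B * (K * suc B ^ D)    ≡⟨ swap-factors (suc B) K (suc B ^ D) ⟩
  K * suc B ^ suc D          ∎
  where
  open ≤-Reasoning
  swap-factors : ∀ a b c → a * (b * c) ≡ b * (a * c)
  swap-factors = solve-∀

pb-E : ∀ {d} (e : Exp d) → PolynomiallyBounded (costE e)
pb-E (var x)         = pb-const 2
pb-E (const n)       = pb-const 1
pb-E (plus e f)      = pb-+ (pb-E e) (pb-+ (pb-E f) (pb-const 1))
pb-E (load e)        = pb-+ (pb-E e) (pb-const 1)
pb-E (ifleq a b e f) = pb-+ (pb-E a) (pb-+ (pb-E b) (pb-+ (pb-const 1) (pb-+ (pb-E e) (pb-E f))))
pb-E (leqR p q)      = pb-const _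
pb-E (fold b e f)    = pb-+ (pb-E e) (pb-+ (pb-const 2) (pb-+ (pb-loop (pb-+ (pb-const 1) (pb-+ (pb-E f) (pb-const 5)))) (pb-const 1)))

pb-C : ∀ {d} (c : Cmd d) → PolynomiallyBounded (costC c)
pb-C (push e)        = pb-+ (pb-E e) (pb-const 3)
pb-C (c ⨟ c′)        = pb-+ (pb-C c) (pb-C c′)
pb-C (for b c)       = pb-+ (pb-const 2) (pb-+ (pb-loop (pb-+ (pb-const 1) (pb-+ (pb-C c) (pb-const 3)))) (pb-const 1))
pb-C (lett e c)      = pb-+ (pb-E e) (pb-C c)
pb-C (lettop c)      = pb-+ (pb-const 2) (pb-C c)
pb-C (ifleq a b c e) = pb-+ (pb-E a) (pb-+ (pb-E b) (pb-+ (pb-const 1) (pb-+ (pb-C c) (pb-C e))))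
pb-C nop             = pb-const 0
pb-C (answer n)      = pb-const 1
pb-C reset           = pb-const 1

-- Registers 0 and 1 hold `n` and `k` on entry but serve the search as answer and memory mark, so
-- both are copied, with register 5 as the zero. For `k = 0` the answer is yes, for `k > n` it is
-- no.
algorithm : Program
algorithm =
  instr (addℕ 2 1 5) ⨾ instr (addℕ 3 0 5) ⨾ instr (constℕ 1 0) ⨾ instr (constℕ 4 1) ⨾
  cond (leqℕ 4 2) (cond (leqℕ 2 3) (compileC search) (instr (constℕ 0 0))) (instr (constℕ 0 1))

cyclesFor : ℕ → ℕ
cyclesFor k = k * (16 * budgetConstant)

-- All loop bounds and cell counts of the search stay below this.
sizeBound : ℕ → ℕ → ℕ
sizeBound n k = cyclesFor k + ((4 * (n * n)) * (n * n + n * (n * n))) ^ isqrt (4 * cyclesFor k)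

isqrt-greatest : ∀ {a m} → a * a ≤ m → a ≤ isqrt m
isqrt-greatest {a} {m} h = ≮⇒≥ λ l → <⇒≱ (isqrt-upper m) (≤-trans (*-mono-≤ l l) h)

-- The run on a given input

module Run (ℝ : RealNumbers) {n : ℕ} (O : Vector (RealRAM.Disk ℝ) n) (k : ℕ) where
  open RealRAM ℝ hiding (_∈_)
  open OrderedField ℝ
  open PlaneGeometry ℝ
  open Compilation ℝ
  open Point
  open Disk

  -- `c + 3 i` in the form that follows the recursion of `encode`.
  cell-index : ℕ → ℕ → ℕ
  cell-index c zero    = c
  cell-index c (suc i) = suc (suc (suc (cell-index c i)))

  cell-index-≡ : ∀ c i → c + i + i + i ≡ cell-index c i
  cell-index-≡ c zero    = trans (+-identityʳ _) (trans (+-identityʳ _) (+-identityʳ c))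
  cell-index-≡ c (suc i) = trans (three c i) (cong (λ m → suc (suc (suc m))) (cell-index-≡ c i))
    where
    three : ∀ c i → c + suc i + suc i + suc i ≡ suc (suc (suc (c + i + i + i)))
    three = solve-∀

  encode-x : ∀ {n} (O : Vector Disk n) (i : Fin n) → encode O (cell-index 0 (toℕ i)) ≡ x (centre (O i))
  encode-x O Fin.zero    = refl
  encode-x O (Fin.suc i) = encode-x (λ j → O (Fin.suc j)) i

  encode-y : ∀ {n} (O : Vector Disk n) (i : Fin n) → encode O (cell-index 1 (toℕ i)) ≡ y (centre (O i))
  encode-y O Fin.zero    = refl
  encode-y O (Fin.suc i) = encode-y (λ j → O (Fin.suc j)) i

  encode-r : ∀ {n} (O : Vector Disk n) (i : Fin n) → encode O (cell-index 2 (toℕ i)) ≡ radius (O i)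
  encode-r O Fin.zero    = refl
  encode-r O (Fin.suc i) = encode-r (λ j → O (Fin.suc j)) i

  X Y ρ : ℕ → Carrier
  X i = encode O (0 + i + i + i)
  Y i = encode O (1 + i + i + i)
  ρ i = encode O (2 + i + i + i)

  X-≡ : ∀ (i : Fin n) → X (toℕ i) ≡ x (centre (O i))
  X-≡ i = trans (cong (encode O) (cell-index-≡ 0 (toℕ i))) (encode-x O i)

  Y-≡ : ∀ (i : Fin n) → Y (toℕ i) ≡ y (centre (O i))
  Y-≡ i = trans (cong (encode O) (cell-index-≡ 1 (toℕ i))) (encode-y O i)

  ρ-≡ : ∀ (i : Fin n) → ρ (toℕ i) ≡ radius (O i)
  ρ-≡ i = trans (cong (encode O) (cell-index-≡ 2 (toℕ i))) (encode-r O i)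

  ρ>0 : ∀ {i} → i < n → 0# ≺ ρ i
  ρ>0 {i} i<n = subst (λ i → 0# ≺ ρ i) (Fin.toℕ-fromℕ< i<n) (subst (0# ≺_) (sym (ρ-≡ (fromℕ< i<n)))
    λ r≤0 → radius≉0 (O (fromℕ< i<n)) (≼-antisym r≤0 (radius≥0 (O (fromℕ< i<n)))))

  open Separators ℝ n X Y ρ ρ>0
  open Counting n

  meet-false⇒Disjoint : ∀ i j → meet (toℕ i) (toℕ j) ≡ false → Disjoint (O i) (O j)
  meet-false⇒Disjoint i j h (p , p∈i , p∈j) = true≢false (point⇒meet (Fin.toℕ<n i) (Fin.toℕ<n j) (inside i p∈i) (inside j p∈j)) h
    where
    inside : ∀ i → InDisk (x (centre (O i))) (y (centre (O i))) (radius (O i)) (x p) (y p) →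
             InDisk (X (toℕ i)) (Y (toℕ i)) (ρ (toℕ i)) (x p) (y p)
    inside i h rewrite X-≡ i | Y-≡ i | ρ-≡ i = h

  Disjoint⇒meet-false : ∀ i j → Disjoint (O i) (O j) → meet (toℕ i) (toℕ j) ≡ false
  Disjoint⇒meet-false i j h = [ (λ m → ⊥-elim (h (common m))) , (λ f → f) ]′ (true-or-false (meet (toℕ i) (toℕ j)))
    where
    inside : ∀ i {px py} → InDisk (X (toℕ i)) (Y (toℕ i)) (ρ (toℕ i)) px py →
             InDisk (x (centre (O i))) (y (centre (O i))) (radius (O i)) px py
    inside i h rewrite X-≡ i | Y-≡ i | ρ-≡ i = h
    common : meet (toℕ i) (toℕ j) ≡ true → ∃[ p ] (Disks._∈_ ℝ p (O i) × Disks._∈_ ℝ p (O j))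
    common m = let px , py , p∈i , p∈j = meet⇒point (Fin.toℕ<n i) (Fin.toℕ<n j) m in
      record { x = px ; y = py } , inside i p∈i , inside j p∈j

  Selection : Set
  Selection = ∃[ s ] IsDisjointSelection {n} {k} O s

  selection⇒independent : Selection → ∃[ A ] Independent A × k ≤ ♯ A
  selection⇒independent (s , inj , dis) = A , ind , enough
    where
    pos : ℕ → ℕ
    pos j with j ℕ.<? k
    ... | yes l = toℕ (s (fromℕ< l))
    ... | no _  = 0
    pos-≡ : ∀ {j} → j < k → ∃[ i ] toℕ i ≡ j × pos j ≡ toℕ (s i)
    pos-≡ {j} l with j ℕ.<? k
    ... | yes l′ = fromℕ< l′ , Fin.toℕ-fromℕ< l′ , refl
    ... | no ¬l  = ⊥-elim (¬l l)
    A : Subset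
    A i = any k (λ j → ⌊ pos j ℕ.≟ i ⌋)
    chosen : ∀ {i} → A i ≡ true → ∃[ j ] toℕ (s j) ≡ i
    chosen h = let j , l , e = any-witness k h
                   f , _ , e′ = pos-≡ l
               in f , trans (sym e′) (from-yes! (_ ℕ.≟ _) e)
    ind : Independent A
    ind {i} {j} _ _ a b ne with chosen {i} a | chosen {j} b
    ... | f , refl | g , refl = Disjoint⇒meet-false (s f) (s g) (dis f g λ { refl → ne refl })
    enough : k ≤ ♯ A
    enough = ≤-trans (≤-reflexive (sym (*-identityʳ k))) (♯-disjoint-family k (λ q → ⁅ pos q ⁆)
      (λ {q} q<k _ e → any-intro k q<k e)
      (λ {q} {q′} {i} q<q′ q′<k _ e → distinct q<q′ q′<k e)
      λ {q} q<k → let f , _ , e = pos-≡ q<k in ≤-reflexive (sym (♯-⁅⁆ (≤-trans (s≤s (≤-reflexive e)) (Fin.toℕ<n (s f))))))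
      where
      distinct : ∀ {q q′ i} → q < q′ → q′ < k → ⁅ pos q ⁆ i ≡ true → ⁅ pos q′ ⁆ i ≡ false
      distinct {q} {q′} {i} q<q′ q′<k e = no! (pos q′ ℕ.≟ i) λ e′ →
        let f , tf , ef = pos-≡ (<-trans q<q′ q′<k)
            g , tg , eg = pos-≡ q′<k
            same : s f ≡ s g
            same = Fin.toℕ-injective (trans (sym ef) (trans (⁅⁆-≡ e) (trans (sym e′) eg)))
        in <-irrefl (trans (sym tf) (trans (cong toℕ (inj same)) tg)) q<q′

  start : State
  start = exec (constℕ 4 1) (exec (constℕ 1 0) (exec (addℕ 3 0 5) (exec (addℕ 2 1 5) (input O k))))

  dispatch : ∀ c {Q : State → Set} → (1 ≤ k → k ≤ n → Eval (compileC search) start c Q) →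
    (¬ k ≤ n → Q (setRegℕ 0 0 start)) → (¬ 1 ≤ k → Q (setRegℕ 0 1 start)) → Eval algorithm (input O k) (8 + c) Q
  dispatch c main infeasible trivial =
    -- Four moves, two tests and one unit for each of the two immediate answers make 8.
    ev-weaken (≤-reflexive (overhead c)) ((λ ()) ▸ (λ ()) ▸ (λ ()) ▸ (λ ()) ▸
      ev-cond (λ h → let 1≤k = ≤-trans (from-yes! (1 ℕ.≤? (k + 0)) h) (≤-reflexive (+-identityʳ k)) in
                 ev-cond (λ h′ → main 1≤k (≤-trans (≤-reflexive (sym (+-identityʳ k)))
                                             (≤-trans (from-yes! (k + 0 ℕ.≤? (n + 0)) h′) (≤-reflexive (+-identityʳ n)))))
                         (λ h′ → ev-instr (λ ()) (infeasible λ k≤n → from-no! (k + 0 ℕ.≤? (n + 0)) h′ (+-monoˡ-≤ 0 k≤n))))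
              (λ h → ev-instr (λ ()) (trivial λ 1≤k → from-no! (1 ℕ.≤? (k + 0)) h (≤-trans 1≤k (≤-reflexive (sym (+-identityʳ k)))))))
    where
    overhead : ∀ c → suc (suc (suc (suc (1 + (1 + (c + 1) + 1))))) ≡ 8 + c
    overhead = solve-∀

  infeasible-output : ¬ k ≤ n → CorrectOutput O k (setRegℕ 0 0 start)
  infeasible-output k≰n = inj₂ (refl , λ (s , inj , _) → k≰n (Fin.injective⇒≤ inj))

  trivial-output : ¬ 1 ≤ k → CorrectOutput O k (setRegℕ 0 1 start)
  trivial-output k≱1 = inj₁ (refl , (λ i → ⊥-elim (none i)) , ((λ {i} _ → ⊥-elim (none i)) , λ i → ⊥-elim (none i)) , λ i → ⊥-elim (none i))
    where
    none : ¬ Fin k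
    none i = k≱1 (≤-trans (s≤s z≤n) (Fin.toℕ<n i))

  module _ (1≤k : 1 ≤ k) (k≤n : k ≤ n) where
    open Pools ℝ n (encode O) ρ>0 (≤-trans 1≤k k≤n) k
    open Search ℝ n (encode O) ρ>0 (≤-trans 1≤k k≤n) k
    open Correctness ℝ n (encode O) ρ>0 (≤-trans 1≤k k≤n) k 1≤k k≤n

    -- Register 0 still holds the number of disks, so `n` is the initial answer of the store.
    start-sim : Sim (encode O) 4 start env (store n 0 (λ _ → 0))
    start-sim = sim refl refl refl refl registers
      where
      registers : Agree 4 start env
      registers 0 () _
      registers 1 (s≤s ()) _
      registers 2 _ _ = +-identityʳ k
      registers 3 _ _ = +-identityʳ n
      registers (suc (suc (suc (suc _)))) _ (s≤s (s≤s (s≤s (s≤s ()))))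

    2^r-bound : ∀ r → 2 ^ r * 2 ^ r ≤ 4 * cycles → scaled initialSize ^ (2 ^ r) ≤ sizeBound n k
    2^r-bound r h = ≤-trans (^-monoʳ-≤ z {{ℕ.>-nonZero z>0}} (isqrt-greatest {2 ^ r} h)) (m≤n+m _ (cyclesFor k))
      where
      1≤n : 1 ≤ n
      1≤n = ≤-trans 1≤k k≤n
      z : ℕ
      z = scaled initialSize
      z>0 : 1 ≤ z
      z>0 = ≤-trans (≤-trans (*-mono-≤ 1≤n 1≤n) (m≤m+n (n * n) _)) (scaled-≥ initialSize)

    n≤sizeBound : n ≤ sizeBound n k
    n≤sizeBound = ≤-trans (≤-trans n≤initial (≤-trans (scaled-≥ initialSize) (≤-reflexive (sym (*-identityʳ _))))) (2^r-bound 0 1≤4c)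
      where
      1≤n : 1 ≤ n
      1≤n = ≤-trans 1≤k k≤n
      n≤initial : n ≤ initialSize
      n≤initial = ≤-trans (≤-trans (≤-reflexive (sym (*-identityʳ n))) (*-monoʳ-≤ n 1≤n)) (m≤m+n (n * n) _)
      1≤4c : 1 ≤ 4 * cycles
      1≤4c = *-mono-≤ {1} {4} (s≤s z≤n) (*-mono-≤ 1≤k (*-mono-≤ {1} {16} (s≤s z≤n) 1≤budgetConstant))

    below-start : Below 4 env (sizeBound n k)
    below-start 0 () _
    below-start 1 (s≤s ()) _
    below-start 2 _ _ = ≤-trans k≤n n≤sizeBound
    below-start 3 _ _ = n≤sizeBound
    below-start (suc (suc (suc (suc _)))) _ (s≤s (s≤s (s≤s (s≤s ()))))

    result-output : ∀ {τ s} → Result s → Sim (encode O) 4 τ env s → CorrectOutput O k τ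
    result-output {τ} {s} (inj₂ (e , none)) S = inj₂ (trans (Sim.ans≡ S) e , λ sel →
      let A , ind , enough = selection⇒independent sel in none A ind enough)
    result-output {τ} {s} (inj₁ found) S =
      inj₁ (trans (Sim.ans≡ S) answers , sel , (injective , disjoint) , λ j → trans (cong (λ M → M (toℕ j)) (Sim.mem≡ S)) (sym (at j)))
      where
      open Found found
      M : ℕ → ℕ
      M = Store.mem s
      sel : Fin k → Fin n
      sel j = fromℕ< (positions (Fin.toℕ<n j))
      at : ∀ j → toℕ (sel j) ≡ M (toℕ j)
      at j = Fin.toℕ-fromℕ< (positions (Fin.toℕ<n j))
      injective : ∀ {i j} → sel i ≡ sel j → i ≡ j
      injective {i} {j} e with toℕ i ℕ.≟ toℕ j
      ... | yes i≡j = Fin.toℕ-injective i≡j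
      ... | no i≢j  = ⊥-elim ([ (λ l → <-irrefl same (increasing l (Fin.toℕ<n j))) , (λ l → <-irrefl (sym same) (increasing l (Fin.toℕ<n i))) ]′ (≢⇒<∨> i≢j))
        where
        same : M (toℕ i) ≡ M (toℕ j)
        same = trans (sym (at i)) (trans (cong toℕ e) (at j))
      disjoint : ∀ i j → i ≢ j → Disjoint (O (sel i)) (O (sel j))
      disjoint i j ne = meet-false⇒Disjoint (sel i) (sel j) (trans (cong₂ meet (at i) (at j))
        (separate (Fin.toℕ<n i) (Fin.toℕ<n j) λ e → ne (Fin.toℕ-injective e)))

    search-run : Eval (compileC search) start (costC search (sizeBound n k)) (CorrectOutput O k)
    search-run = ev-map (λ (s , res , S) → result-output res S)
      (evalC (encode O) search {Result} (s≤s (s≤s z≤n)) search-ok start-sim below-start (wp-search (m≤m+n (cyclesFor k) _) 2^r-bound))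

-- The exponent and the constant

abstract
  search-polynomial : PolynomiallyBounded (costC search)
  search-polynomial = pb-C search

timeFactor timeDegree : ℕ
timeFactor = proj₁ search-polynomial
timeDegree = proj₁ (proj₂ search-polynomial)

search-time : ∀ B → costC search B ≤ timeFactor * suc B ^ timeDegree
search-time = proj₂ (proj₂ search-polynomial)

cycleFactor : ℕ
cycleFactor = 16 * budgetConstant

exponent : ℕ → ℕ
exponent k = ((11 + cycleFactor) * timeDegree) * isqrt (4 * cyclesFor k)

exponent-sqrt : exponent ∈O[√k]
exponent-sqrt = (a * a) * (4 * cycleFactor) , λ k → begin
  exponent k * exponent k                                              ≡⟨ [m*n]*[o*p]≡[m*o]*[n*p] a (q k) a (q k) ⟩
  (a * a) * (q k * q k)                                                ≤⟨ *-monoʳ-≤ (a * a) (isqrt-lower (4 * cyclesFor k)) ⟩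
  (a * a) * (4 * (k * cycleFactor))                                    ≡⟨ regroup (a * a) k cycleFactor ⟩
  ((a * a) * (4 * cycleFactor)) * k                                    ∎
  where
  open ≤-Reasoning
  a : ℕ
  a = (11 + cycleFactor) * timeDegree
  q : ℕ → ℕ
  q k = isqrt (4 * cyclesFor k)
  regroup : ∀ b k c → b * (4 * (k * c)) ≡ (b * (4 * c)) * k
  regroup = solve-∀

n≤2^n : ∀ n → n ≤ 2 ^ n
n≤2^n zero    = z≤n
n≤2^n (suc n) = ≤-trans (+-mono-≤ (m^n>0 2 n) (n≤2^n n)) (≤-reflexive (cong (2 ^ n +_) (sym (+-identityʳ (2 ^ n)))))

-- The base is at most `n ^ 8`, and `c ≤ 2 ^ c` gives `k * c ≤ n ^ (1 + c)`. So all three summands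
-- are at most `n ^ ((9 + c) * q)`, and the factor 4 that covers their sum is at most `n * n`: hence
-- 11.
power-bound : ∀ {n k} c q → 2 ≤ n → k ≤ n → 1 ≤ q →
              suc (k * c + ((4 * (n * n)) * (n * n + n * (n * n))) ^ q) ≤ n ^ ((11 + c) * q)
power-bound {n} {k} c q 2≤n k≤n 1≤q = begin
  1 + (k * c + z ^ q)         ≤⟨ +-mono-≤ (n^>0 m) (+-mono-≤ cycles≤ cells≤) ⟩
  n ^ m + (n ^ m + n ^ m)            ≤⟨ m≤m+n _ (n ^ m) ⟩
  n ^ m + (n ^ m + n ^ m) + n ^ m    ≡⟨ four (n ^ m) ⟩
  (2 * 2) * n ^ m                    ≤⟨ *-monoˡ-≤ (n ^ m) (*-mono-≤ 2≤n 2≤n) ⟩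
  (n * n) * n ^ m                    ≡⟨ *-assoc n n (n ^ m) ⟩
  n ^ (2 + m)                        ≤⟨ up (≤-trans (+-monoˡ-≤ m (≤-trans (≤-reflexive (sym (*-identityʳ 2))) (*-monoʳ-≤ 2 1≤q))) (≤-reflexive (sym (*-distribʳ-+ q 2 (9 + c))))) ⟩
  n ^ ((11 + c) * q)       ∎
  where
  open ≤-Reasoning
  1≤n : 1 ≤ n
  1≤n = ≤-trans (s≤s z≤n) 2≤n
  z m : ℕ
  z = (4 * (n * n)) * (n * n + n * (n * n))
  m = (9 + c) * q
  up : ∀ {a b} → a ≤ b → n ^ a ≤ n ^ b
  up = ^-monoʳ-≤ n {{ℕ.>-nonZero 1≤n}}
  n^>0 : ∀ a → 1 ≤ n ^ a
  n^>0 a = m^n>0 n {{ℕ.>-nonZero 1≤n}} a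
  four : ∀ a → a + (a + a) + a ≡ (2 * 2) * a
  four = solve-∀
  1+c≤m : suc c ≤ m
  1+c≤m = ≤-trans (≤-trans (m≤n+m (suc c) 8) (≤-reflexive (trans (+-suc 8 c) (sym (*-identityʳ _))))) (*-monoʳ-≤ (9 + c) 1≤q)
  8q≤m : 8 * q ≤ m
  8q≤m = *-monoˡ-≤ q {8} {9 + c} (m≤m+n 8 (suc c) ⟨≡⟩ +-suc 8 c)
    where
    _⟨≡⟩_ : ∀ {a b c} → a ≤ b → b ≡ c → a ≤ c
    h ⟨≡⟩ refl = h
  cycles≤ : k * c ≤ n ^ m
  cycles≤ = ≤-trans (*-mono-≤ k≤n (≤-trans (n≤2^n c) (^-monoˡ-≤ c 2≤n))) (up 1+c≤m)
  z≤ : z ≤ n ^ 8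
  z≤ = ≤-trans (*-mono-≤ (*-monoˡ-≤ (n * n) (*-mono-≤ 2≤n 2≤n))
         (≤-trans (+-monoˡ-≤ (n * (n * n)) (≤-trans (≤-reflexive (sym (*-identityˡ (n * n)))) (*-monoˡ-≤ (n * n) 1≤n)))
           (≤-trans (≤-reflexive (double (n * (n * n)))) (*-monoˡ-≤ (n * (n * n)) 2≤n)))) (≤-reflexive (eighth n))
    where
    double : ∀ a → a + a ≡ 2 * a
    double = solve-∀
    eighth : ∀ n → ((n * n) * (n * n)) * (n * (n * (n * n))) ≡ n * (n * (n * (n * (n * (n * (n * (n * 1)))))))
    eighth = solve-∀
  cells≤ : z ^ q ≤ n ^ m
  cells≤ = ≤-trans (^-monoˡ-≤ q z≤) (≤-trans (≤-reflexive (^-*-assoc n 8 q)) (up 8q≤m))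

1≤isqrt-cycles : ∀ {k} → 1 ≤ k → 1 ≤ isqrt (4 * cyclesFor k)
1≤isqrt-cycles 1≤k = isqrt-greatest {1} (*-mono-≤ {1} {4} (s≤s z≤n) (*-mono-≤ 1≤k (*-mono-≤ {1} {16} (s≤s z≤n) 1≤budgetConstant)))

polynomial-bound : ∀ {n} K D a q {T S} → 1 ≤ n → T ≤ K * S ^ D → S ≤ n ^ (a * q) → 8 + T ≤ (8 + K) * n ^ ((a * D) * q)
polynomial-bound {n} K D a q {T} {S} 1≤n T≤ S≤ = begin
  8 + T                                                 ≤⟨ +-monoʳ-≤ 8 (≤-trans T≤ (*-monoʳ-≤ K (^-monoˡ-≤ D S≤))) ⟩
  8 + K * (n ^ (a * q)) ^ D                             ≡⟨ cong (λ e → 8 + K * e) (trans (^-*-assoc n (a * q) D) (cong (n ^_) (reorder a q D))) ⟩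
  8 + K * n ^ ((a * D) * q)                             ≤⟨ +-monoˡ-≤ _ (≤-trans (≤-reflexive (sym (*-identityʳ 8))) (*-monoʳ-≤ 8 (m^n>0 n {{ℕ.>-nonZero 1≤n}} ((a * D) * q)))) ⟩
  8 * n ^ ((a * D) * q) + K * n ^ ((a * D) * q)         ≡⟨ *-distribʳ-+ (n ^ ((a * D) * q)) 8 K ⟨
  (8 + K) * n ^ ((a * D) * q)                           ∎
  where
  open ≤-Reasoning
  reorder : ∀ a q d → (a * q) * d ≡ (a * d) * q
  reorder = solve-∀

smallTime : ℕ
smallTime = 8 + timeFactor * suc (sizeBound 1 1) ^ timeDegree

timeConstant : ℕ
timeConstant = (8 + timeFactor) + smallTime

-- Powers of `n` absorb constants only for `n ≥ 2`. The one remaining instance is `n = k = 1`, and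
-- its time `smallTime` is part of the constant.
time-bound : ∀ {n k} → 1 ≤ k → k ≤ n → 8 + costC search (sizeBound n k) ≤ timeConstant * (n ⊔ 1) ^ exponent k
time-bound {n} {k} 1≤k k≤n with n ℕ.≤? 1
... | no n≰1 = ≤-trans
  (polynomial-bound timeFactor timeDegree (11 + cycleFactor) (isqrt (4 * cyclesFor k)) (≤-trans 1≤k k≤n) (search-time (sizeBound n k))
    (power-bound {n} {k} cycleFactor (isqrt (4 * cyclesFor k)) (≰⇒> n≰1) k≤n (1≤isqrt-cycles 1≤k)))
  (*-mono-≤ (m≤m+n (8 + timeFactor) smallTime) (^-monoˡ-≤ (exponent k) (m≤m⊔n n 1)))
time-bound {suc zero} {suc zero} _ _ | yes _ = ≤-trans (+-monoʳ-≤ 8 (search-time (sizeBound 1 1)))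
  (≤-trans (m≤n+m smallTime (8 + timeFactor)) (≤-trans (≤-reflexive (sym (*-identityʳ timeConstant))) (*-monoʳ-≤ timeConstant (m^n>0 1 (exponent 1)))))
time-bound {suc zero} {suc (suc k)} 1≤k (s≤s ()) | yes _
time-bound {suc (suc n)} {k} 1≤k k≤n | yes (s≤s ())
time-bound {zero} {suc k} 1≤k () | yes _

constant-bound : ∀ n k → 8 + 0 ≤ timeConstant * (n ⊔ 1) ^ exponent k
constant-bound n k = *-mono-≤ {8} {timeConstant} {1} (≤-trans (m≤m+n 8 timeFactor) (m≤m+n (8 + timeFactor) _))
  (m^n>0 (n ⊔ 1) {{ℕ.>-nonZero (m≤n⊔m n 1)}} (exponent k))

theorem1p4 : (ℝ : RealNumbers) → let open RealRAM ℝ in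
    ∃[ P ] ∃[ C ] ∃[ e ] e ∈O[√k] ×
    (∀ (n k : ℕ) (O : Vector Disk n) → IsSet O →
    ∃[ t ] ∃[ τ ] ⟨ P , input O k ⟩⇓[ t ] τ
    × t ≤ C * (n ⊔ 1) ^ e k
    × CorrectOutput O k τ)
theorem1p4 ℝ = algorithm , timeConstant , exponent , exponent-sqrt , λ n k O _ → solve-instance n k O
  where
  open RealRAM ℝ
  open Compilation ℝ using (Eval; eval)
  solve-instance : ∀ n k (O : Vector Disk n) →
    ∃[ t ] ∃[ τ ] ⟨ algorithm , input O k ⟩⇓[ t ] τ × t ≤ timeConstant * (n ⊔ 1) ^ exponent k × CorrectOutput O k τ
  solve-instance n k O = decide (1 ℕ.≤? k) (k ℕ.≤? n)
    where
    open Run ℝ O k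
    bounded : ∀ {b} → b ≤ timeConstant * (n ⊔ 1) ^ exponent k → Eval algorithm (input O k) b (CorrectOutput O k) →
      ∃[ t ] ∃[ τ ] ⟨ algorithm , input O k ⟩⇓[ t ] τ × t ≤ timeConstant * (n ⊔ 1) ^ exponent k × CorrectOutput O k τ
    bounded h (eval run t≤ post) = _ , _ , run , ≤-trans t≤ h , post
    decide : Dec (1 ≤ k) → Dec (k ≤ n) → _
    decide (yes 1≤k) (yes k≤n) = bounded (time-bound 1≤k k≤n)
      (dispatch _ (λ _ _ → search-run 1≤k k≤n) infeasible-output trivial-output)
    -- The search is not entered, so its share of the cost may be taken as 0.
    decide (no k≱1)  _         = bounded (constant-bound n k)
      (dispatch 0 (λ 1≤k _ → ⊥-elim (k≱1 1≤k)) infeasible-output trivial-output)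
    decide (yes _)   (no k≰n)  = bounded (constant-bound n k)
      (dispatch 0 (λ _ k≤n → ⊥-elim (k≰n k≤n)) infeasible-output trivial-output)
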